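{- For every $v\equiv 1$ or $5\pmod{10}$ with $v\notin\{5,15\}$, there exists a super-simple $2$-$(v,5,1)$DD.
   Context: A $2$-$(v,5,1)$ directed design ($2$-$(v,5,1)$DD) is a pair $(V,\mathcal{B})$ where $|V|=v$ and $\mathcal{B}$ is a collection of ordered $5$-tuples of distinct elements of $V$ (blocks) such that every ordered pair $(x,y)$ of distinct elements of $V$ occurs in exactly one block as a subsequence. Forgetting the order in each block gives its underlying $2$-$(v,5,2)$-BIBD; the directed design is super-simple if any two blocks of the underlying design intersect in at most two points. -}

module Defs where

open import Data.Nat using (ℕ; _≤_; _<_)
open import Data.Fin using (Fin)
open import Data.Fin.Properties using (_≟_)
open import Data.Fin.Base using () renaming (_<_ to _<ᶠ_)
open import Data.Vec using (Vec; lookup)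
open import Data.Vec.Membership.Propositional using (_∈_)
open import Data.Vec.Membership.DecPropositional using () renaming (_∈?_ to ∈?-gen)
open import Data.List using (List; length; filter)
open import Data.List.Base using (allFin)
open import Data.Product using (Σ; ∃; _×_; _,_)
open import Relation.Binary.PropositionalEquality using (_≡_; _≢_)
open import Relation.Nullary using (¬_)

Block : ℕ → Set
Block v = Vec (Fin v) 5

DistinctEntries : ∀ {v} → Block v → Set
DistinctEntries b = ∀ (i j : Fin 5) → lookup b i ≡ lookup b j → i ≡ j

OccursIn : ∀ {v} → Fin v → Fin v → Block v → Set
OccursIn x y b = Σ (Fin 5) λ i → Σ (Fin 5) λ j →
  (i <ᶠ j) × (lookup b i ≡ x) × (lookup b j ≡ y)

record DirectedDesign (v : ℕ) : Set where
  field
    n         : ℕ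
    blocks    : Fin n → Block v
    distinct  : ∀ k → DistinctEntries (blocks k)
    covered   : ∀ (x y : Fin v) → x ≢ y →
                Σ (Fin n) λ k → OccursIn x y (blocks k) ×
                  (∀ k′ → OccursIn x y (blocks k′) → k′ ≡ k)

-- Number of points common to (the underlying sets of) two blocks.
-- Since entries of a block are distinct, this is the size of the
-- intersection of the underlying 5-sets.
commonPoints : ∀ {v} → Block v → Block v → ℕ
commonPoints {v} b c =
  length (filter (λ i → ∈?-gen _≟_ (lookup b i) c) (allFin 5))

SuperSimple : ∀ {v} → DirectedDesign v → Set
SuperSimple D = ∀ k k′ → k ≢ k′ → commonPoints (blocks k) (blocks k′) ≤ 2
  where open DirectedDesign D

{-# OPTIONS --safe #-}

-- A directed design is assembled from ingredients on smaller point sets, each covering every ordered pair of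
-- a symmetric relation exactly once. If every pair lies in only one ingredient, blocks of different ingredients
-- share at most one point, so super-simplicity survives the assembly.
--
-- Give weight 10 to the points of five groups of a TD(6, m), and weight 0, 4 or 10 to the points of its sixth
-- group; replace each block by a group divisible design of type 10⁵, 10⁵4¹ or 10⁶, and fill the groups
-- together with one new point. From orders 10m + 1 and 10t + 1 this gives order 10(5m + t) + 1, and from 10m + 1
-- and 10t + 5, where t < m, it gives order 10(5m + t) + 5. A TD(6, m) exists whenever gcd(m, 6) = 1, by lines of
-- slopes 0, 1, 2, 3, 4, ∞ over ℤ/m; such m occur so densely that every n ≥ 117 is of the form 5m + t with
-- 2 ≤ t < m. The remaining orders come from related recursions and from explicit designs, invariant under a
-- cyclic group, which are verified by evaluation.
module Submission where

open import Defs
open import Data.Nat using (ℕ; _%_)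
open import Data.Sum using (_⊎_)
open import Data.Product using (Σ; _×_)
open import Relation.Binary.PropositionalEquality using (_≡_; _≢_)

open import Algebra.Bundles using (CommutativeSemiring)
open import Algebra.Definitions
open import Algebra.Structures using (IsCommutativeSemiring)
open import Data.Bool using (Bool; true; false; T; if_then_else_; _∧_; _∨_; not)
open import Data.Bool.Properties using () renaming (_≟_ to _≟ᵇ_)
open import Data.Empty using (⊥; ⊥-elim)
open import Data.Fin using (Fin; zero; suc; toℕ; fromℕ<; opposite)
open import Data.Fin.Base using () renaming (_<_ to _<ᶠ_)
open import Data.Fin.Properties
  using (<⇒≢; _≟_; _<?_; +↔⊎; *↔×; toℕ<n; toℕ-fromℕ<; fromℕ<-toℕ; toℕ-injective; <-cmp;
         opposite-involutive; opposite-prop; suc-injective)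
open import Data.List as List using (List; []; _∷_; length; filter; cartesianProduct)
open import Data.List.Base using (allFin)
open import Data.List.Membership.Propositional using (_∈_)
open import Data.List.Membership.Propositional.Properties
  using (∈-lookup; ∈-filter⁺; ∈-filter⁻; ∈-cartesianProduct⁺; ∈-allFin)
open import Data.List.Relation.Unary.All as All using (All; []; _∷_)
open import Data.List.Relation.Unary.All.Properties using (all-filter)
open import Data.List.Relation.Unary.AllPairs using ([]; _∷_)
open import Data.List.Relation.Unary.Any as Any using ()
open import Data.List.Relation.Unary.Any.Properties using (lookup-index)
open import Data.List.Relation.Unary.Unique.Propositional using (Unique)
import Data.List.Relation.Unary.Unique.Propositional.Properties as Unique
open import Data.Maybe using (Maybe; just; nothing; is-just; _<∣>_)
open import Data.Maybe.Properties using (just-injective)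
open import Data.Nat
  using (zero; suc; pred; _+_; _*_; _∸_; _/_; _≤_; _<_; _≤?_; _<ᵇ_; _≤ᵇ_; _≡ᵇ_; z≤n; s≤s; NonZero; >-nonZero⁻¹)
  renaming (_<?_ to _<ⁿ?_)
open import Data.Nat.DivMod
  using (m%n<n; m<n⇒m%n≡m; m*n%n≡0; %-distribˡ-+; %-distribˡ-*; [m+kn]%n≡m%n; m≡m%n+[m/n]*n; _mod_)
open import Data.Nat.Induction using (<-rec)
open import Data.Nat.Properties
  using (+-assoc; +-comm; *-assoc; *-comm; *-distribˡ-+; *-identityˡ; suc-pred; <⇒≤; ≤∧≢⇒<; ≤-pred; ≤-trans;
         m+[n∸m]≡n; m∸n≤m; m<n⇒0<n∸m; ∸-monoʳ-<; <-asym; ≡ᵇ⇒≡; ≤-reflexive; ≮⇒≥; m≤m+n; m≤n⇒∃[o]m+o≡n;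
         +-monoˡ-≤; +-monoʳ-≤; +-cancelˡ-≤)
  renaming (_≟_ to _≟ⁿ_)
open import Data.Nat.Tactic.RingSolver using (solve-∀)
open import Data.Product using (_,_; proj₁; proj₂)
open import Data.Product.Function.NonDependent.Propositional using (_×-↔_)
open import Data.Product.Properties using (≡-dec)
open import Data.Sum using (inj₁; inj₂; [_,_]′)
open import Data.Sum.Function.Propositional using (_⊎-↔_)
open import Data.Unit using (⊤; tt)
open import Data.Vec as Vec using (Vec; []; _∷_)
open import Data.Vec.Membership.DecPropositional using () renaming (_∈?_ to ∈?-gen)
open import Data.Vec.Membership.Propositional using () renaming (_∈_ to _∈ᵛ_)
open import Data.Vec.Properties using (lookup∘tabulate)
import Data.Vec.Relation.Unary.Any as VecAny
import Data.Vec.Relation.Unary.Any.Properties as VecAny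
open import Function using (_∘_)
open import Function.Bundles using (_↔_; Inverse; mk↔ₛ′)
open import Function.Properties.Inverse using (↔-refl; ↔-sym; ↔-trans)
open import Relation.Binary using (tri<; tri≈; tri>)
open import Relation.Binary.PropositionalEquality
  using (refl; sym; trans; cong; cong₂; subst; subst₂; isEquivalence; setoid; module ≡-Reasoning)
open import Relation.Nullary using (Dec; yes; no; ¬_; contradiction; ¬?; _×-dec_)
open import Relation.Nullary.Decidable using (recompute; does; map′; True; toWitness)

open ≡-Reasoning

-- Order 5 is the obstacle behind the designs with holes. Its 20 ordered pairs would be covered by
-- two blocks, both consisting of all five points, so no super-simple design of that order exists.
-- Five points can therefore be adjoined only if one group is filled completely and every other
-- group leaves the pairs of new points uncovered. Super-simplicity is carried in a form without
-- counting: blocks that share three points are equal. With blocks of an arbitrary type, a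
-- construction only has to say where points go and which ingredient a pair belongs to. The explicit
-- designs are checked by self-lookup. Each pair or triple of positions in a base block has a key
-- that is invariant under the group. A table sends the code of a key back to its positions; if
-- every entry finds itself, no two entries have the same key, because a search has one result.
-- Collisions of codes or a faulty table could only make a check fail. The same device verifies the
-- transversal designs of orders that are not coprime to 6.

-- Directed designs relative to a relation, and their unions

Pos : Set
Pos = Fin 5

-- Only pairs related by `R` are covered, so complete designs, group divisible designs and designs
-- with a hole are all instances. In `sound` both orders of `i` and `j` occur, which together with
-- `cover` makes `R` symmetric. In `simple` the positions on the two sides are independent, since a
-- common triple may be ordered differently in two blocks.
record Design (P : Set) (R : P → P → Set) : Set₁ where
  field
    Blk    : Set
    pt     : Blk → Pos → P
    sound  : ∀ b {i j} → i ≢ j → R (pt b i) (pt b j)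
    cover  : ∀ {x y} → R x y → Σ Blk λ b → Σ Pos λ i → Σ Pos λ j →
             i <ᶠ j × pt b i ≡ x × pt b j ≡ y
    unique : ∀ b b′ {i j i′ j′} → i <ᶠ j → i′ <ᶠ j′ →
             pt b i ≡ pt b′ i′ → pt b j ≡ pt b′ j′ → b ≡ b′
    simple : ∀ b b′ {i j k i′ j′ k′} → i ≢ j → i ≢ k → j ≢ k → i′ ≢ j′ → i′ ≢ k′ → j′ ≢ k′ →
             pt b i ≡ pt b′ i′ → pt b j ≡ pt b′ j′ → pt b k ≡ pt b′ k′ → b ≡ b′

open Design

DD : ℕ → Set₁
DD v = Design (Fin v) _≢_

GDD : (k : ℕ) → (Fin k → Set) → Set₁
GDD k Q = Design (Σ (Fin k) Q) (λ x y → proj₁ x ≢ proj₁ y)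

-- Blocks of different pieces share at most one point, because a pair lies in only one piece;
-- hence super-simplicity is inherited from the pieces.
module Union {I P : Set} {Pᵢ : I → Set} {Rᵢ : ∀ i → Pᵢ i → Pᵢ i → Set} {R : P → P → Set}
  (D : ∀ i → Design (Pᵢ i) (Rᵢ i))
  (e : ∀ i → Pᵢ i → P)
  (e-injective : ∀ i {x y} → e i x ≡ e i y → x ≡ y)
  (into : ∀ i {x y} → Rᵢ i x y → R (e i x) (e i y))
  (split : ∀ {x y} → R x y → Σ I λ i → Σ (Pᵢ i) λ x′ → Σ (Pᵢ i) λ y′ →
           e i x′ ≡ x × e i y′ ≡ y × Rᵢ i x′ y′)
  (piece-unique : ∀ i j {x y x′ y′} → Rᵢ i x y → Rᵢ j x′ y′ →
                  e i x ≡ e j x′ → e i y ≡ e j y′ → i ≡ j)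
  where

  union : Design P R
  union .Blk = Σ I λ i → Blk (D i)
  union .pt (i , b) p = e i (pt (D i) b p)
  union .sound (i , b) p≢q = into i (sound (D i) b p≢q)
  union .cover r with split r
  ... | i , x′ , y′ , refl , refl , r′ with cover (D i) r′
  ... | b , p , q , p<q , refl , refl = (i , b) , p , q , p<q , refl , refl
  union .unique (i , b) (j , b′) p<q p′<q′ eq₁ eq₂
    with piece-unique i j (sound (D i) b (<⇒≢ p<q)) (sound (D j) b′ (<⇒≢ p′<q′)) eq₁ eq₂
  ... | refl = cong (i ,_) (unique (D i) b b′ p<q p′<q′ (e-injective i eq₁) (e-injective i eq₂))
  union .simple (i , b) (j , b′) p≢q p≢r q≢r p′≢q′ p′≢r′ q′≢r′ eq₁ eq₂ eq₃
    with piece-unique i j (sound (D i) b p≢q) (sound (D j) b′ p′≢q′) eq₁ eq₂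
  ... | refl = cong (i ,_) (simple (D i) b b′ p≢q p≢r q≢r p′≢q′ p′≢r′ q′≢r′
                 (e-injective i eq₁) (e-injective i eq₂) (e-injective i eq₃))

open Union using (union)

-- A union with a single piece.
transport : ∀ {P Q R S} → Design P R → (f : P ↔ Q) →
            (∀ {x y} → R x y → S (Inverse.to f x) (Inverse.to f y)) →
            (∀ {x y} → S x y → R (Inverse.from f x) (Inverse.from f y)) → Design Q S
transport {P} {Q} {R} {S} D f R⇒S S⇒R = union {I = ⊤} (λ _ → D) (λ _ → to)
  (λ _ → injective) (λ _ → R⇒S)
  (λ {x} {y} s → tt , from x , from y , strictlyInverseˡ x , strictlyInverseˡ y , S⇒R s)
  (λ _ _ _ _ _ _ → refl)
  where
  open Inverse f
  injective : ∀ {x y} → to x ≡ to y → x ≡ y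
  injective {x} {y} eq = trans (sym (strictlyInverseʳ x)) (trans (cong from eq) (strictlyInverseʳ y))

toDD : ∀ {P v} → Design P _≢_ → P ↔ Fin v → DD v
toDD D f = transport D f
  (λ x≢y eq → x≢y (trans (sym (strictlyInverseʳ _)) (trans (cong from eq) (strictlyInverseʳ _))))
  (λ x≢y eq → x≢y (trans (sym (strictlyInverseˡ _)) (trans (cong to eq) (strictlyInverseˡ _))))
  where open Inverse f

-- Transversal designs and Wilson's fundamental construction

record TD (k m : ℕ) : Set₁ where
  field
    Row  : Set
    at   : Row → Fin k → Fin m
    join : ∀ {c c′} → c ≢ c′ → ∀ u v → Σ Row λ r → at r c ≡ u × at r c′ ≡ v
    meet : ∀ {c c′} → c ≢ c′ → ∀ r r′ → at r c ≡ at r′ c → at r c′ ≡ at r′ c′ → r ≡ r′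

open TD

module Wilson {k m : ℕ} (T : TD k m) (wt : Fin k → Fin m → ℕ) where

  Inflated : Fin k → Set
  Inflated c = Σ (Fin m) λ a → Fin (wt c a)

  Over : Row T → Fin k → Set
  Over r c = Fin (wt c (at T r c))

  embed : ∀ r → Σ (Fin k) (Over r) → Σ (Fin k) Inflated
  embed r (c , p) = c , at T r c , p

  at-≡ : ∀ r r′ {x y} → embed r x ≡ embed r′ y → at T r (proj₁ x) ≡ at T r′ (proj₁ x)
  at-≡ r r′ {c , p} {c′ , p′} eq with cong proj₁ eq
  ... | refl = cong (λ { (_ , a , _) → a }) eq

  embed-injective : ∀ r {x y} → embed r x ≡ embed r y → x ≡ y
  embed-injective r refl = refl

  row : ∀ {x y : Σ (Fin k) Inflated} → proj₁ x ≢ proj₁ y → Σ (Row T) λ r →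
        Σ (Σ (Fin k) (Over r)) λ x′ → Σ (Σ (Fin k) (Over r)) λ y′ →
        embed r x′ ≡ x × embed r y′ ≡ y × proj₁ x′ ≢ proj₁ y′
  row {c , a , p} {c′ , a′ , p′} c≢c′ with join T c≢c′ a a′
  ... | r , refl , refl = r , (c , p) , (c′ , p′) , refl , refl , c≢c′

  -- Two points of different groups lie over exactly one row of `T`, so the rows index the pieces of
  -- a union. All orientation comes from the ingredients.
  wilson : (∀ r → GDD k (Over r)) → GDD k Inflated
  wilson D = union D embed embed-injective (λ _ c≢c′ → c≢c′) row
    (λ r r′ c≢c′ _ eq₁ eq₂ → meet T c≢c′ r r′ (at-≡ r r′ eq₁) (at-≡ r r′ eq₂))

open Wilson using (wilson)

-- Designs with a hole, and filling in groups

data Outside {A H : Set} : A ⊎ H → A ⊎ H → Set where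
  left  : ∀ {a y} → Outside (inj₁ a) y
  right : ∀ {x a} → Outside x (inj₁ a)

Incomplete : Set → Set → Set₁
Incomplete A H = Design (A ⊎ H) (λ x y → x ≢ y × Outside x y)

module Fill {k : ℕ} {Q : Fin k → Set} {H : Set} (c₀ : Fin k) where

  -- Only the group c₀ is filled together with the hole H; the other groups leave the pairs inside H uncovered.
  Filling : (c : Fin k) → Q c ⊎ H → Q c ⊎ H → Set
  Filling c x y = x ≢ y × (c ≡ c₀ ⊎ Outside x y)

  Piece : Maybe (Fin k) → Set
  Piece nothing  = Σ (Fin k) Q
  Piece (just c) = Q c ⊎ H

  Rel : ∀ i → Piece i → Piece i → Set
  Rel nothing  x y = proj₁ x ≢ proj₁ y
  Rel (just c) x y = Filling c x y

  embed : ∀ i → Piece i → Σ (Fin k) Q ⊎ H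
  embed nothing  x        = inj₁ x
  embed (just c) (inj₁ q) = inj₁ (c , q)
  embed (just c) (inj₂ h) = inj₂ h

  embed-injective : ∀ i {x y} → embed i x ≡ embed i y → x ≡ y
  embed-injective nothing refl = refl
  embed-injective (just c) {inj₁ _} {inj₁ _} refl = refl
  embed-injective (just c) {inj₂ _} {inj₂ _} refl = refl

  into : ∀ i {x y} → Rel i x y → embed i x ≢ embed i y
  into nothing  c≢c′       refl = c≢c′ refl
  into (just c) (x≢y , _) eq    = x≢y (embed-injective (just c) eq)

  piece : ∀ {x y} → x ≢ y → Σ (Maybe (Fin k)) λ i → Σ (Piece i) λ x′ → Σ (Piece i) λ y′ →
          embed i x′ ≡ x × embed i y′ ≡ y × Rel i x′ y′
  piece {inj₁ (c , q)} {inj₁ (c′ , q′)} x≢y with c ≟ c′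
  ... | no c≢c′  = nothing , (c , q) , (c′ , q′) , refl , refl , c≢c′
  ... | yes refl = just c , inj₁ q , inj₁ q′ , refl , refl , (λ { refl → x≢y refl }) , inj₂ left
  piece {inj₁ (c , q)} {inj₂ h} x≢y = just c , inj₁ q , inj₂ h , refl , refl , (λ ()) , inj₂ left
  piece {inj₂ h} {inj₁ (c , q)} x≢y = just c , inj₂ h , inj₁ q , refl , refl , (λ ()) , inj₂ right
  piece {inj₂ h} {inj₂ h′} x≢y = just c₀ , inj₂ h , inj₂ h′ , refl , refl , (λ { refl → x≢y refl }) , inj₁ refl

  group-≡ : ∀ {c c′ q y} → inj₁ {B = H} (c , q) ≡ embed (just c′) y → c ≡ c′
  group-≡ {y = inj₁ _} refl = refl

  group-≡′ : ∀ {c} {x : Σ (Fin k) Q} {y} → inj₁ {B = H} x ≡ embed (just c) y → proj₁ x ≡ c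
  group-≡′ {y = inj₁ _} refl = refl

  -- Except for `c₀`, a filling covers only pairs with a point in its own group, and this point
  -- names the group. Two fillings can thus share a pair only if they agree; the remaining case, in
  -- which both are the one at `c₀`, is harmless.
  both-in-hole : ∀ {c c′} {x : Q c ⊎ H} {y : Q c ⊎ H} {x′ y′ : Q c′ ⊎ H} →
                 c ≡ c₀ ⊎ Outside x y → embed (just c) x ≡ embed (just c′) x′ →
                 embed (just c) y ≡ embed (just c′) y′ → c ≡ c₀ ⊎ c ≡ c′
  both-in-hole (inj₁ eq)    _   _   = inj₁ eq
  both-in-hole (inj₂ left)  eq₁ _   = inj₂ (group-≡ eq₁)
  both-in-hole (inj₂ right) _   eq₂ = inj₂ (group-≡ eq₂)

  piece-unique : ∀ i j {x y x′ y′} → Rel i x y → Rel j x′ y′ →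
                 embed i x ≡ embed j x′ → embed i y ≡ embed j y′ → i ≡ j
  piece-unique nothing  nothing  _ _ _ _ = refl
  piece-unique nothing  (just c) c≢c′ _ eq₁ eq₂ = contradiction (trans (group-≡′ eq₁) (sym (group-≡′ eq₂))) c≢c′
  piece-unique (just c) nothing  _ c≢c′ eq₁ eq₂ =
    contradiction (trans (group-≡′ (sym eq₁)) (sym (group-≡′ (sym eq₂)))) c≢c′
  piece-unique (just c) (just c′) (_ , o) (_ , o′) eq₁ eq₂
    with both-in-hole o eq₁ eq₂ | both-in-hole o′ (sym eq₁) (sym eq₂)
  ... | inj₂ refl | _         = refl
  ... | inj₁ _    | inj₂ refl = refl
  ... | inj₁ refl | inj₁ refl = refl

  fill : GDD k Q → (∀ c → Design (Q c ⊎ H) (Filling c)) → Design (Σ (Fin k) Q ⊎ H) _≢_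
  fill D F = union (λ { nothing → D ; (just c) → F c }) embed embed-injective into piece piece-unique

restrict : ∀ {P R S} → Design P R → (∀ {x y} → R x y → S x y) → (∀ {x y} → S x y → R x y) → Design P S
restrict D R⇒S S⇒R = transport D ↔-refl R⇒S S⇒R

open Fill using (fill)

fill-hole : ∀ {k Q H} → GDD (suc k) Q → Design (Q zero ⊎ H) _≢_ → (∀ c → Incomplete (Q (suc c)) H) →
            Design (Σ (Fin (suc k)) Q ⊎ H) _≢_
fill-hole D F₀ F = fill zero D λ where
  zero    → restrict F₀ (λ x≢y → x≢y , inj₁ refl) proj₁
  (suc c) → restrict (F c) (λ (x≢y , o) → x≢y , inj₂ o) λ { (x≢y , inj₂ o) → x≢y , o }

-- If the hole contains no pair of distinct points, a complete design is the same as an incomplete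
-- one, and no group has to be singled out.
fill-small : ∀ {k Q H} → (∀ {A} {x y : A ⊎ H} → x ≢ y → Outside x y) →
             GDD (suc k) Q → (∀ c → Design (Q c ⊎ H) _≢_) → Design (Σ (Fin (suc k)) Q ⊎ H) _≢_
fill-small outside D F = fill zero D (λ c → restrict (F c) (λ x≢y → x≢y , inj₂ (outside x≢y)) proj₁)

outside-≤1 : ∀ {h} → h ≤ 1 → ∀ {A : Set} {x y : A ⊎ Fin h} → x ≢ y → Outside x y
outside-≤1 _ {x = inj₁ _} _ = left
outside-≤1 _ {x = inj₂ _} {inj₁ _} _ = right
outside-≤1 (s≤s z≤n) {x = inj₂ zero} {inj₂ zero} x≢y = contradiction refl x≢y

-- Numbering the points of an assembled design

total : (k : ℕ) → (Fin k → ℕ) → ℕ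
total zero    s = 0
total (suc k) s = s zero + total k (s ∘ suc)

Σ-suc : ∀ {k} (Q : Fin (suc k) → Set) → Σ (Fin (suc k)) Q ↔ (Q zero ⊎ Σ (Fin k) (Q ∘ suc))
Σ-suc Q = mk↔ₛ′ (λ { (zero , q) → inj₁ q ; (suc c , q) → inj₂ (c , q) })
                (λ { (inj₁ q) → zero , q ; (inj₂ (c , q)) → suc c , q })
                (λ { (inj₁ _) → refl ; (inj₂ _) → refl })
                (λ { (zero , _) → refl ; (suc _ , _) → refl })

Σ↔Fin : ∀ k {Q : Fin k → Set} (s : Fin k → ℕ) → (∀ c → Q c ↔ Fin (s c)) → Σ (Fin k) Q ↔ Fin (total k s)
Σ↔Fin zero    s f = mk↔ₛ′ (λ ()) (λ ()) (λ ()) (λ ())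
Σ↔Fin (suc k) s f = ↔-trans (Σ-suc _) (↔-trans (f zero ⊎-↔ Σ↔Fin k (s ∘ suc) (f ∘ suc)) (↔-sym +↔⊎))

⊎↔Fin : ∀ {A : Set} {n h} → A ↔ Fin n → (A ⊎ Fin h) ↔ Fin (n + h)
⊎↔Fin f = ↔-trans (f ⊎-↔ ↔-refl) (↔-sym +↔⊎)

fromDD : ∀ {P v} → DD v → P ↔ Fin v → Design P _≢_
fromDD D f = transport D (↔-sym f)
  (λ x≢y eq → x≢y (trans (sym (strictlyInverseˡ _)) (trans (cong to eq) (strictlyInverseˡ _))))
  (λ x≢y eq → x≢y (trans (sym (strictlyInverseʳ _)) (trans (cong from eq) (strictlyInverseʳ _))))
  where open Inverse f

incomplete-cong : ∀ {A A′ H} → A ↔ A′ → Incomplete A H → Incomplete A′ H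
incomplete-cong f D = transport D (f ⊎-↔ ↔-refl)
  (λ { {inj₁ _} (x≢y , left) → (λ eq → x≢y (cancel eq)) , left
     ; {inj₂ _} {inj₁ _} (x≢y , right) → (λ eq → x≢y (cancel eq)) , right
     ; {inj₁ _} {inj₁ _} (x≢y , right) → (λ eq → x≢y (cancel eq)) , left })
  (λ { {inj₁ _} (x≢y , left) → (λ eq → x≢y (cancel′ eq)) , left
     ; {inj₂ _} {inj₁ _} (x≢y , right) → (λ eq → x≢y (cancel′ eq)) , right
     ; {inj₁ _} {inj₁ _} (x≢y , right) → (λ eq → x≢y (cancel′ eq)) , left })
  where
  open Inverse (f ⊎-↔ ↔-refl)
  cancel : ∀ {x y} → to x ≡ to y → x ≡ y
  cancel {x} {y} eq = trans (sym (strictlyInverseʳ x)) (trans (cong from eq) (strictlyInverseʳ y))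
  cancel′ : ∀ {x y} → from x ≡ from y → x ≡ y
  cancel′ {x} {y} eq = trans (sym (strictlyInverseˡ x)) (trans (cong to eq) (strictlyInverseˡ y))

fill-DD : ∀ {k} {Q : Fin (suc k) → Set} h (s : Fin (suc k) → ℕ) {h≤1 : True (h ≤? 1)} → (∀ c → Q c ↔ Fin (s c)) →
          GDD (suc k) Q → (∀ c → DD (s c + h)) → DD (total (suc k) s + h)
fill-DD h s {h≤1} f D F =
  toDD (fill-small (outside-≤1 (toWitness h≤1)) D (λ c → fromDD (F c) (⊎↔Fin (f c)))) (⊎↔Fin (Σ↔Fin _ s f))

fill-hole-DD : ∀ {k h} {Q : Fin (suc k) → Set} (s : Fin (suc k) → ℕ) → (∀ c → Q c ↔ Fin (s c)) →
               GDD (suc k) Q → DD (s zero + h) → (∀ c → Incomplete (Fin (s (suc c))) (Fin h)) →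
               DD (total (suc k) s + h)
fill-hole-DD s f D F₀ F = toDD (fill-hole D (fromDD F₀ (⊎↔Fin (f zero)))
  (λ c → incomplete-cong (↔-sym (f (suc c))) (F c))) (⊎↔Fin (Σ↔Fin _ s f))

-- From abstract blocks to a finite list of blocks

lookup-injective : ∀ {A : Set} {xs : List A} → Unique xs → ∀ i j →
                   List.lookup xs i ≡ List.lookup xs j → i ≡ j
lookup-injective (_ ∷ _)  zero    zero    _  = refl
lookup-injective (x∉ ∷ _) zero    (suc j) eq = contradiction eq (All.lookup x∉ (∈-lookup j))
lookup-injective (x∉ ∷ _) (suc i) zero    eq = contradiction (sym eq) (All.lookup x∉ (∈-lookup i))
lookup-injective (_ ∷ u)  (suc i) (suc j) eq = cong suc (lookup-injective u i j eq)

length≤2 : ∀ {A : Set} {P : A → Set} (xs : List A) → Unique xs → All P xs →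
           (∀ {x y z} → x ≢ y → x ≢ z → y ≢ z → P x → P y → P z → ⊥) → length xs ≤ 2
length≤2 []            _ _ _ = z≤n
length≤2 (_ ∷ [])      _ _ _ = s≤s z≤n
length≤2 (_ ∷ _ ∷ [])  _ _ _ = s≤s (s≤s z≤n)
length≤2 (_ ∷ _ ∷ _ ∷ _) ((x≢y ∷ x≢z ∷ _) ∷ (y≢z ∷ _) ∷ _) (px ∷ py ∷ pz ∷ _) none =
  ⊥-elim (none x≢y x≢z y≢z px py pz)

-- The blocks are enumerated by the ordered pairs formed by their first two points.
module Enumerate {v : ℕ} (D : DD v) where

  p₀ p₁ : Pos
  p₀ = zero
  p₁ = suc zero

  p₀<p₁ : p₀ <ᶠ p₁
  p₀<p₁ = s≤s z≤n

  Head : Fin v × Fin v → Set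
  Head (x , y) = Σ (Blk D) λ b → pt D b p₀ ≡ x × pt D b p₁ ≡ y

  pt-injective : ∀ b {i j} → pt D b i ≡ pt D b j → i ≡ j
  pt-injective b {i} {j} eq with i ≟ j
  ... | yes i≡j = i≡j
  ... | no  i≢j = contradiction eq (sound D b i≢j)

  -- Decidable although the type of blocks is arbitrary: the only candidate is the block that covers
  -- `(x , y)`, so it suffices to inspect its first two points.
  head? : ∀ xy → Dec (Head xy)
  head? (x , y) with x ≟ y
  ... | yes refl = no λ { (b , eq₀ , eq₁) → sound D b (<⇒≢ p₀<p₁) (trans eq₀ (sym eq₁)) }
  ... | no x≢y with cover D x≢y
  ... | b , i , j , i<j , eqᵢ , eqⱼ with pt D b p₀ ≟ x | pt D b p₁ ≟ y
  ... | yes eq₀ | yes eq₁ = yes (b , eq₀ , eq₁)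
  ... | no  neq | _       = no λ { (b′ , eq₀ , eq₁) → neq (trans (cong (λ z → pt D z p₀)
                              (unique D b b′ i<j p₀<p₁ (trans eqᵢ (sym eq₀)) (trans eqⱼ (sym eq₁)))) eq₀) }
  ... | _       | no neq  = no λ { (b′ , eq₀ , eq₁) → neq (trans (cong (λ z → pt D z p₁)
                              (unique D b b′ i<j p₀<p₁ (trans eqᵢ (sym eq₀)) (trans eqⱼ (sym eq₁)))) eq₁) }

  pairs heads : List (Fin v × Fin v)
  pairs = cartesianProduct (allFin v) (allFin v)
  heads = filter head? pairs

  heads-unique : Unique heads
  heads-unique = Unique.filter⁺ head? (Unique.cartesianProduct⁺ (Unique.allFin⁺ v) (Unique.allFin⁺ v))

  block : Fin (length heads) → Blk D
  block k = proj₁ (proj₂ (∈-filter⁻ head? {xs = pairs} (∈-lookup k)))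

  block-head : ∀ k → (pt D (block k) p₀ , pt D (block k) p₁) ≡ List.lookup heads k
  block-head k with proj₂ (∈-filter⁻ head? {xs = pairs} (∈-lookup k))
  ... | b , eq₀ , eq₁ = cong₂ _,_ eq₀ eq₁

  block-injective : ∀ {k k′} → block k ≡ block k′ → k ≡ k′
  block-injective {k} {k′} eq = lookup-injective heads-unique k k′
    (trans (sym (block-head k)) (trans (cong (λ b → pt D b p₀ , pt D b p₁) eq) (block-head k′)))

  index : ∀ b → Σ (Fin (length heads)) λ k → block k ≡ b
  index b = Any.index b∈ , unique D _ b p₀<p₁ p₀<p₁ (cong proj₁ eq) (cong proj₂ eq)
    where
    b∈ : (pt D b p₀ , pt D b p₁) ∈ heads
    b∈ = ∈-filter⁺ head? (∈-cartesianProduct⁺ (∈-allFin _) (∈-allFin _)) (b , refl , refl)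
    eq : (pt D (block (Any.index b∈)) p₀ , pt D (block (Any.index b∈)) p₁) ≡ (pt D b p₀ , pt D b p₁)
    eq = trans (block-head _) (sym (lookup-index b∈))

  vec : Fin (length heads) → Block v
  vec k = Vec.tabulate (pt D (block k))

  vec-lookup : ∀ k i → Vec.lookup (vec k) i ≡ pt D (block k) i
  vec-lookup k = lookup∘tabulate (pt D (block k))

  design : DirectedDesign v
  design = record
    { n        = length heads
    ; blocks   = vec
    ; distinct = λ k i j eq → pt-injective (block k)
                   (trans (sym (vec-lookup k i)) (trans eq (vec-lookup k j)))
    ; covered  = covered
    }
    where
    covered : ∀ x y → x ≢ y → Σ (Fin (length heads)) λ k → OccursIn x y (vec k) ×
              (∀ k′ → OccursIn x y (vec k′) → k′ ≡ k)
    covered x y x≢y with cover D x≢y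
    ... | b , i , j , i<j , eqᵢ , eqⱼ with index b
    ... | k , refl = k , (i , j , i<j , trans (vec-lookup k i) eqᵢ , trans (vec-lookup k j) eqⱼ) ,
      λ { k′ (i′ , j′ , i′<j′ , eqᵢ′ , eqⱼ′) → block-injective (unique D _ _ i′<j′ i<j
            (trans (sym (vec-lookup k′ i′)) (trans eqᵢ′ (sym eqᵢ)))
            (trans (sym (vec-lookup k′ j′)) (trans eqⱼ′ (sym eqⱼ)))) }

  superSimple : SuperSimple design
  superSimple k k′ k≢k′ = length≤2 (filter common? (allFin 5))
    (Unique.filter⁺ common? (Unique.allFin⁺ 5)) (all-filter common? (allFin 5)) no-triple
    where
    common? : ∀ i → Dec (Vec.lookup (vec k) i ∈ᵛ vec k′)
    common? i = ∈?-gen _≟_ (Vec.lookup (vec k) i) (vec k′)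
    position : ∀ {i} → Vec.lookup (vec k) i ∈ᵛ vec k′ → Σ Pos λ i′ → pt D (block k) i ≡ pt D (block k′) i′
    position {i} i∈ = VecAny.index i∈ ,
      trans (sym (vec-lookup k i)) (trans (VecAny.lookup-index i∈) (vec-lookup k′ _))
    no-triple : ∀ {x y z} → x ≢ y → x ≢ z → y ≢ z → Vec.lookup (vec k) x ∈ᵛ vec k′ →
                Vec.lookup (vec k) y ∈ᵛ vec k′ → Vec.lookup (vec k) z ∈ᵛ vec k′ → ⊥
    no-triple x≢y x≢z y≢z x∈ y∈ z∈ with position x∈ | position y∈ | position z∈
    ... | x′ , eqˣ | y′ , eqʸ | z′ , eqᶻ = k≢k′ (block-injective (simple D (block k) (block k′) x≢y x≢z y≢z
      (apart x≢y eqˣ eqʸ) (apart x≢z eqˣ eqᶻ) (apart y≢z eqʸ eqᶻ) eqˣ eqʸ eqᶻ))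
      where
      apart : ∀ {i j i′ j′} → i ≢ j → pt D (block k) i ≡ pt D (block k′) i′ →
              pt D (block k) j ≡ pt D (block k′) j′ → i′ ≢ j′
      apart i≢j eqᵢ eqⱼ refl = i≢j (pt-injective (block k) (trans eqᵢ (sym eqⱼ)))

toDirectedDesign : ∀ {v} → DD v → Σ (DirectedDesign v) SuperSimple
toDirectedDesign D = design , superSimple
  where open Enumerate D

-- Residues modulo n and their ring identities

-- The irrelevant bound makes equality of residues equality of their values, and lets the evaluated
-- checks run on built-in natural numbers instead of unary `Fin`.
record Z (n : ℕ) : Set where
  constructor mk
  field
    val    : ℕ
    .bound : val < n

open Z using (val)

val-injective : ∀ {n} {x y : Z n} → val x ≡ val y → x ≡ y
val-injective refl = refl

val<n : ∀ {n} (x : Z n) → val x < n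
val<n {n} (mk a a<n) = recompute (a <ⁿ? n) a<n

Z↔Fin : ∀ {n} → Z n ↔ Fin n
Z↔Fin = mk↔ₛ′ (λ x → fromℕ< (val<n x)) (λ i → mk (toℕ i) (toℕ<n i))
  (λ i → fromℕ<-toℕ i _) (λ x → val-injective (toℕ-fromℕ< _))

-- Subtraction of b is written as addition of ν b; an identity valid because ν = -1 is a semiring
-- identity up to a summand x + ν x.
module RingLemmas {c ℓ} (R : CommutativeSemiring c ℓ) where
  open CommutativeSemiring R using (Carrier; _≈_; 0#; +-congˡ; +-identityʳ)
    renaming (_+_ to infixl 6 _⊕_; _*_ to infixl 7 _⊗_; trans to ≈-trans; refl to ≈-refl)
  open import Algebra.Solver.Ring.NaturalCoefficients.Default R using (solve; _:+_; _:*_; _:=_)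

  private module Identities where
    difference-shift : ∀ ν a b s → (b ⊕ s) ⊕ ν ⊗ (a ⊕ s) ≈ (b ⊕ ν ⊗ a) ⊕ (s ⊕ ν ⊗ s)
    difference-shift = solve 4 (λ ν a b s →
      (b :+ s) :+ ν :* (a :+ s)
      := (b :+ ν :* a) :+ (s :+ ν :* s)) ≈-refl

    subtract-add : ∀ ν a b → (a ⊕ ν ⊗ b) ⊕ b ≈ a ⊕ (b ⊕ ν ⊗ b)
    subtract-add = solve 3 (λ ν a b →
      (a :+ ν :* b) :+ b
      := a :+ (b :+ ν :* b)) ≈-refl

    add-subtract : ∀ ν a b → (a ⊕ b) ⊕ ν ⊗ a ≈ b ⊕ (a ⊕ ν ⊗ a)
    add-subtract = solve 3 (λ ν a b →
      (a :+ b) :+ ν :* a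
      := b :+ (a :+ ν :* a)) ≈-refl

    cramer₁ : ∀ ν α β α′ β′ i u v →
      α ⊗ (i ⊗ (β′ ⊗ u ⊕ ν ⊗ (β ⊗ v))) ⊕ β ⊗ (i ⊗ (α ⊗ v ⊕ ν ⊗ (α′ ⊗ u)))
      ≈ ((α ⊗ β′ ⊕ ν ⊗ (α′ ⊗ β)) ⊗ i) ⊗ u ⊕ (α ⊗ β ⊗ i ⊗ v ⊕ ν ⊗ (α ⊗ β ⊗ i ⊗ v))
    cramer₁ = solve 8 (λ ν α β α′ β′ i u v →
      α :* (i :* (β′ :* u :+ ν :* (β :* v))) :+ β :* (i :* (α :* v :+ ν :* (α′ :* u)))
      := ((α :* β′ :+ ν :* (α′ :* β)) :* i) :* u :+ (α :* β :* i :* v :+ ν :* (α :* β :* i :* v))) ≈-refl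

    cramer₂ : ∀ ν α β α′ β′ i u v →
      α′ ⊗ (i ⊗ (β′ ⊗ u ⊕ ν ⊗ (β ⊗ v))) ⊕ β′ ⊗ (i ⊗ (α ⊗ v ⊕ ν ⊗ (α′ ⊗ u)))
      ≈ ((α ⊗ β′ ⊕ ν ⊗ (α′ ⊗ β)) ⊗ i) ⊗ v ⊕ (α′ ⊗ β′ ⊗ i ⊗ u ⊕ ν ⊗ (α′ ⊗ β′ ⊗ i ⊗ u))
    cramer₂ = solve 8 (λ ν α β α′ β′ i u v →
      α′ :* (i :* (β′ :* u :+ ν :* (β :* v))) :+ β′ :* (i :* (α :* v :+ ν :* (α′ :* u)))
      := ((α :* β′ :+ ν :* (α′ :* β)) :* i) :* v :+ (α′ :* β′ :* i :* u :+ ν :* (α′ :* β′ :* i :* u))) ≈-refl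

    eliminate₁ : ∀ ν α β α′ β′ i x y →
      i ⊗ (β′ ⊗ (α ⊗ x ⊕ β ⊗ y) ⊕ ν ⊗ (β ⊗ (α′ ⊗ x ⊕ β′ ⊗ y)))
      ≈ ((α ⊗ β′ ⊕ ν ⊗ (α′ ⊗ β)) ⊗ i) ⊗ x ⊕ (i ⊗ β ⊗ β′ ⊗ y ⊕ ν ⊗ (i ⊗ β ⊗ β′ ⊗ y))
    eliminate₁ = solve 8 (λ ν α β α′ β′ i x y →
      i :* (β′ :* (α :* x :+ β :* y) :+ ν :* (β :* (α′ :* x :+ β′ :* y)))
      := ((α :* β′ :+ ν :* (α′ :* β)) :* i) :* x :+ (i :* β :* β′ :* y :+ ν :* (i :* β :* β′ :* y))) ≈-refl

    eliminate₂ : ∀ ν α β α′ β′ i x y →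
      i ⊗ (α ⊗ (α′ ⊗ x ⊕ β′ ⊗ y) ⊕ ν ⊗ (α′ ⊗ (α ⊗ x ⊕ β ⊗ y)))
      ≈ ((α ⊗ β′ ⊕ ν ⊗ (α′ ⊗ β)) ⊗ i) ⊗ y ⊕ (i ⊗ α ⊗ α′ ⊗ x ⊕ ν ⊗ (i ⊗ α ⊗ α′ ⊗ x))
    eliminate₂ = solve 8 (λ ν α β α′ β′ i x y →
      i :* (α :* (α′ :* x :+ β′ :* y) :+ ν :* (α′ :* (α :* x :+ β :* y)))
      := ((α :* β′ :+ ν :* (α′ :* β)) :* i) :* y :+ (i :* α :* α′ :* x :+ ν :* (i :* α :* α′ :* x))) ≈-refl

    parabola₁ : ∀ ν x y a b →
      (x ⊕ ν ⊗ (a ⊗ b)) ⊕ a ⊗ (y ⊕ (a ⊕ b)) ≈ ((x ⊕ a ⊗ y) ⊕ a ⊗ a) ⊕ (a ⊗ b ⊕ ν ⊗ (a ⊗ b))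
    parabola₁ = solve 5 (λ ν x y a b →
      (x :+ ν :* (a :* b)) :+ a :* (y :+ (a :+ b)) := ((x :+ a :* y) :+ a :* a) :+ (a :* b :+ ν :* (a :* b))) ≈-refl

    parabola₂ : ∀ ν x y a b →
      (x ⊕ ν ⊗ (a ⊗ b)) ⊕ b ⊗ (y ⊕ (a ⊕ b)) ≈ ((x ⊕ b ⊗ y) ⊕ b ⊗ b) ⊕ (a ⊗ b ⊕ ν ⊗ (a ⊗ b))
    parabola₂ = solve 5 (λ ν x y a b →
      (x :+ ν :* (a :* b)) :+ b :* (y :+ (a :+ b)) := ((x :+ b :* y) :+ b :* b) :+ (a :* b :+ ν :* (a :* b))) ≈-refl

  shift-swap : ∀ ν a b c → c ⊕ (b ⊕ ν ⊗ a) ≈ (c ⊕ ν ⊗ a) ⊕ b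
  shift-swap = solve 4 (λ ν a b c →
    c :+ (b :+ ν :* a)
    := (c :+ ν :* a) :+ b) ≈-refl

  module Negative (ν : Carrier) (a+νa≈0 : ∀ a → a ⊕ ν ⊗ a ≈ 0#) where

    private
      drop : ∀ {a b c} → a ≈ b ⊕ (c ⊕ ν ⊗ c) → a ≈ b
      drop eq = ≈-trans eq (≈-trans (+-congˡ (a+νa≈0 _)) (+-identityʳ _))

    difference-shift : ∀ a b s → (b ⊕ s) ⊕ ν ⊗ (a ⊕ s) ≈ b ⊕ ν ⊗ a
    difference-shift a b s = drop (Identities.difference-shift ν a b s)

    subtract-add : ∀ a b → (a ⊕ ν ⊗ b) ⊕ b ≈ a
    subtract-add a b = drop (Identities.subtract-add ν a b)

    add-subtract : ∀ a b → (a ⊕ b) ⊕ ν ⊗ a ≈ b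
    add-subtract a b = drop (Identities.add-subtract ν a b)

    det : Carrier → Carrier → Carrier → Carrier → Carrier
    det α β α′ β′ = α ⊗ β′ ⊕ ν ⊗ (α′ ⊗ β)

    -- Cramer's rule, with `i` in the role of the inverse of the determinant. The two `cramer`
    -- identities show that the formulas solve the system, hence existence; the two `eliminate`
    -- identities recover the unknowns from the values, hence uniqueness.
    cramer₁ : ∀ α β α′ β′ i u v →
      α ⊗ (i ⊗ (β′ ⊗ u ⊕ ν ⊗ (β ⊗ v))) ⊕ β ⊗ (i ⊗ (α ⊗ v ⊕ ν ⊗ (α′ ⊗ u))) ≈ (det α β α′ β′ ⊗ i) ⊗ u
    cramer₁ α β α′ β′ i u v = drop (Identities.cramer₁ ν α β α′ β′ i u v)

    cramer₂ : ∀ α β α′ β′ i u v →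
      α′ ⊗ (i ⊗ (β′ ⊗ u ⊕ ν ⊗ (β ⊗ v))) ⊕ β′ ⊗ (i ⊗ (α ⊗ v ⊕ ν ⊗ (α′ ⊗ u))) ≈ (det α β α′ β′ ⊗ i) ⊗ v
    cramer₂ α β α′ β′ i u v = drop (Identities.cramer₂ ν α β α′ β′ i u v)

    eliminate₁ : ∀ α β α′ β′ i x y →
      i ⊗ (β′ ⊗ (α ⊗ x ⊕ β ⊗ y) ⊕ ν ⊗ (β ⊗ (α′ ⊗ x ⊕ β′ ⊗ y))) ≈ (det α β α′ β′ ⊗ i) ⊗ x
    eliminate₁ α β α′ β′ i x y = drop (Identities.eliminate₁ ν α β α′ β′ i x y)

    eliminate₂ : ∀ α β α′ β′ i x y →
      i ⊗ (α ⊗ (α′ ⊗ x ⊕ β′ ⊗ y) ⊕ ν ⊗ (α′ ⊗ (α ⊗ x ⊕ β ⊗ y))) ≈ (det α β α′ β′ ⊗ i) ⊗ y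
    eliminate₂ α β α′ β′ i x y = drop (Identities.eliminate₂ ν α β α′ β′ i x y)

    -- The line through the points of x + cy + c² at c = a and c = b.
    parabola₁ : ∀ x y a b → (x ⊕ ν ⊗ (a ⊗ b)) ⊕ a ⊗ (y ⊕ (a ⊕ b)) ≈ (x ⊕ a ⊗ y) ⊕ a ⊗ a
    parabola₁ x y a b = drop (Identities.parabola₁ ν x y a b)

    parabola₂ : ∀ x y a b → (x ⊕ ν ⊗ (a ⊗ b)) ⊕ b ⊗ (y ⊕ (a ⊕ b)) ≈ (x ⊕ b ⊗ y) ⊕ b ⊗ b
    parabola₂ x y a b = drop (Identities.parabola₂ ν x y a b)

module Residues (n : ℕ) ⦃ _ : NonZero n ⦄ where

  infixl 6 _+ᶻ_
  infixl 7 _*ᶻ_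

  ⟦_⟧ : ℕ → Z n
  ⟦ a ⟧ = mk (a % n) (m%n<n a n)

  _+ᶻ_ _*ᶻ_ : Z n → Z n → Z n
  x +ᶻ y = ⟦ val x + val y ⟧
  x *ᶻ y = ⟦ val x * val y ⟧

  ν : Z n
  ν = ⟦ pred n ⟧

  ⟦val⟧ : ∀ x → ⟦ val x ⟧ ≡ x
  ⟦val⟧ x = val-injective (m<n⇒m%n≡m (val<n x))

  ⟦+⟧ : ∀ a b → ⟦ a + b ⟧ ≡ ⟦ a ⟧ +ᶻ ⟦ b ⟧
  ⟦+⟧ a b = val-injective (%-distribˡ-+ a b n)

  ⟦*⟧ : ∀ a b → ⟦ a * b ⟧ ≡ ⟦ a ⟧ *ᶻ ⟦ b ⟧
  ⟦*⟧ a b = val-injective (%-distribˡ-* a b n)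

  +-assocᶻ : Associative _≡_ _+ᶻ_
  +-assocᶻ x y z = begin
    ⟦ val x + val y ⟧ +ᶻ z          ≡⟨ cong (⟦ val x + val y ⟧ +ᶻ_) (⟦val⟧ z) ⟨
    ⟦ val x + val y ⟧ +ᶻ ⟦ val z ⟧  ≡⟨ ⟦+⟧ (val x + val y) (val z) ⟨
    ⟦ val x + val y + val z ⟧       ≡⟨ cong ⟦_⟧ (+-assoc (val x) (val y) (val z)) ⟩
    ⟦ val x + (val y + val z) ⟧     ≡⟨ ⟦+⟧ (val x) (val y + val z) ⟩
    ⟦ val x ⟧ +ᶻ ⟦ val y + val z ⟧  ≡⟨ cong (_+ᶻ ⟦ val y + val z ⟧) (⟦val⟧ x) ⟩
    x +ᶻ ⟦ val y + val z ⟧          ∎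

  *-assocᶻ : Associative _≡_ _*ᶻ_
  *-assocᶻ x y z = begin
    ⟦ val x * val y ⟧ *ᶻ z          ≡⟨ cong (⟦ val x * val y ⟧ *ᶻ_) (⟦val⟧ z) ⟨
    ⟦ val x * val y ⟧ *ᶻ ⟦ val z ⟧  ≡⟨ ⟦*⟧ (val x * val y) (val z) ⟨
    ⟦ val x * val y * val z ⟧       ≡⟨ cong ⟦_⟧ (*-assoc (val x) (val y) (val z)) ⟩
    ⟦ val x * (val y * val z) ⟧     ≡⟨ ⟦*⟧ (val x) (val y * val z) ⟩
    ⟦ val x ⟧ *ᶻ ⟦ val y * val z ⟧  ≡⟨ cong (_*ᶻ ⟦ val y * val z ⟧) (⟦val⟧ x) ⟩
    x *ᶻ ⟦ val y * val z ⟧          ∎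

  *-distribˡ-+ᶻ : _DistributesOverˡ_ _≡_ _*ᶻ_ _+ᶻ_
  *-distribˡ-+ᶻ x y z = begin
    x *ᶻ ⟦ val y + val z ⟧                ≡⟨ cong (_*ᶻ ⟦ val y + val z ⟧) (⟦val⟧ x) ⟨
    ⟦ val x ⟧ *ᶻ ⟦ val y + val z ⟧        ≡⟨ ⟦*⟧ (val x) (val y + val z) ⟨
    ⟦ val x * (val y + val z) ⟧           ≡⟨ cong ⟦_⟧ (*-distribˡ-+ (val x) (val y) (val z)) ⟩
    ⟦ val x * val y + val x * val z ⟧     ≡⟨ ⟦+⟧ (val x * val y) (val x * val z) ⟩
    x *ᶻ y +ᶻ x *ᶻ z                      ∎

  +-commᶻ : Commutative _≡_ _+ᶻ_
  +-commᶻ x y = cong ⟦_⟧ (+-comm (val x) (val y))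

  *-commᶻ : Commutative _≡_ _*ᶻ_
  *-commᶻ x y = cong ⟦_⟧ (*-comm (val x) (val y))

  +-identityˡᶻ : LeftIdentity _≡_ ⟦ 0 ⟧ _+ᶻ_
  +-identityˡᶻ x = begin
    ⟦ 0 ⟧ +ᶻ x          ≡⟨ cong (⟦ 0 ⟧ +ᶻ_) (⟦val⟧ x) ⟨
    ⟦ 0 ⟧ +ᶻ ⟦ val x ⟧  ≡⟨ ⟦+⟧ 0 (val x) ⟨
    ⟦ val x ⟧           ≡⟨ ⟦val⟧ x ⟩
    x                   ∎

  *-identityˡᶻ : LeftIdentity _≡_ ⟦ 1 ⟧ _*ᶻ_
  *-identityˡᶻ x = begin
    ⟦ 1 ⟧ *ᶻ x          ≡⟨ cong (⟦ 1 ⟧ *ᶻ_) (⟦val⟧ x) ⟨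
    ⟦ 1 ⟧ *ᶻ ⟦ val x ⟧  ≡⟨ ⟦*⟧ 1 (val x) ⟨
    ⟦ 1 * val x ⟧       ≡⟨ cong ⟦_⟧ (*-identityˡ (val x)) ⟩
    ⟦ val x ⟧           ≡⟨ ⟦val⟧ x ⟩
    x                   ∎

  zeroˡᶻ : LeftZero _≡_ ⟦ 0 ⟧ _*ᶻ_
  zeroˡᶻ x = begin
    ⟦ 0 ⟧ *ᶻ x          ≡⟨ cong (⟦ 0 ⟧ *ᶻ_) (⟦val⟧ x) ⟨
    ⟦ 0 ⟧ *ᶻ ⟦ val x ⟧  ≡⟨ ⟦*⟧ 0 (val x) ⟨
    ⟦ 0 ⟧               ∎

  x+νx≡0 : ∀ x → x +ᶻ ν *ᶻ x ≡ ⟦ 0 ⟧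
  x+νx≡0 x = begin
    x +ᶻ ν *ᶻ x                            ≡⟨ cong (λ y → y +ᶻ ν *ᶻ y) (⟦val⟧ x) ⟨
    ⟦ val x ⟧ +ᶻ ⟦ pred n ⟧ *ᶻ ⟦ val x ⟧   ≡⟨ cong (⟦ val x ⟧ +ᶻ_) (⟦*⟧ (pred n) (val x)) ⟨
    ⟦ val x ⟧ +ᶻ ⟦ pred n * val x ⟧        ≡⟨ ⟦+⟧ (val x) (pred n * val x) ⟨
    ⟦ suc (pred n) * val x ⟧               ≡⟨ cong (λ k → ⟦ k * val x ⟧) (suc-pred n) ⟩
    ⟦ n * val x ⟧                          ≡⟨ cong ⟦_⟧ (*-comm n (val x)) ⟩
    ⟦ val x * n ⟧                          ≡⟨ val-injective (trans (m*n%n≡0 (val x) n) (sym (m<n⇒m%n≡m (>-nonZero⁻¹ n)))) ⟩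
    ⟦ 0 ⟧                                  ∎

  isCommutativeSemiring : IsCommutativeSemiring _≡_ _+ᶻ_ _*ᶻ_ ⟦ 0 ⟧ ⟦ 1 ⟧
  isCommutativeSemiring = record
      { isSemiring = record
        { isSemiringWithoutAnnihilatingZero = record
          { +-isCommutativeMonoid = record
            { isMonoid = record
              { isSemigroup = record
                { isMagma = record { isEquivalence = isEquivalence ; ∙-cong = cong₂ _+ᶻ_ }
                ; assoc = +-assocᶻ }
              ; identity = +-identityˡᶻ , λ x → trans (+-commᶻ x ⟦ 0 ⟧) (+-identityˡᶻ x) }
            ; comm = +-commᶻ }
          ; *-cong = cong₂ _*ᶻ_
          ; *-assoc = *-assocᶻ
          ; *-identity = *-identityˡᶻ , λ x → trans (*-commᶻ x ⟦ 1 ⟧) (*-identityˡᶻ x)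
          ; distrib = comm∧distrˡ⇒distr (cong₂ _+ᶻ_) *-commᶻ *-distribˡ-+ᶻ }
        ; zero = zeroˡᶻ , λ x → trans (*-commᶻ x ⟦ 0 ⟧) (zeroˡᶻ x) }
      ; *-comm = *-commᶻ }
    where open import Algebra.Consequences.Setoid (setoid (Z n))
            using (comm∧distrˡ⇒distr)

  infixl 6 _-ᶻ_
  _-ᶻ_ : Z n → Z n → Z n
  x -ᶻ y = x +ᶻ ν *ᶻ y

  commutativeSemiring : CommutativeSemiring _ _
  commutativeSemiring = record { isCommutativeSemiring = isCommutativeSemiring }

  private module Ring = RingLemmas commutativeSemiring
  open Ring.Negative ν x+νx≡0 public

  shift-to : ∀ a b → a +ᶻ (b -ᶻ a) ≡ b
  shift-to a b = trans (+-commᶻ a (b -ᶻ a)) (subtract-add b a)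

  difference-cancel : ∀ a b c d → c -ᶻ a ≡ d -ᶻ b → c +ᶻ (b -ᶻ a) ≡ d
  difference-cancel a b c d eq = trans (Ring.shift-swap ν a b c) (trans (cong (_+ᶻ b) eq) (subtract-add d b))

  +-cancelˡᶻ : ∀ a {s t} → a +ᶻ s ≡ a +ᶻ t → s ≡ t
  +-cancelˡᶻ a {s} {t} eq = trans (sym (add-subtract a s)) (trans (cong (_-ᶻ a) eq) (add-subtract a t))

-- Development of base blocks under a cyclic group, checked by evaluation

data Tree (A : Set) : Set where
  leaf : Tree A
  node : Tree A → ℕ → A → Tree A → Tree A

insert : ∀ {A} → ℕ → A → Tree A → Tree A
insert k a leaf = node leaf k a leaf
insert k a (node l k′ a′ r) =
  if k <ᵇ k′ then node (insert k a l) k′ a′ r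
  else if k′ <ᵇ k then node l k′ a′ (insert k a r)
  else node l k a r

search : ∀ {A} → ℕ → Tree A → Maybe A
search k leaf = nothing
search k (node l k′ a r) = if k <ᵇ k′ then search k l else if k′ <ᵇ k then search k r else just a

all : ∀ n → (Fin n → Bool) → Bool
all zero    p = true
all (suc n) p = p zero ∧ all n (p ∘ suc)

∧-true : ∀ {a b} → a ∧ b ≡ true → a ≡ true × b ≡ true
∧-true {true} {true} refl = refl , refl

all-sound : ∀ n p → all n p ≡ true → ∀ i → p i ≡ true
all-sound (suc n) p eq zero    = proj₁ (∧-true eq)
all-sound (suc n) p eq (suc i) = all-sound n (p ∘ suc) (proj₂ (∧-true {p zero} eq)) i

does-sound : ∀ {P : Set} (P? : Dec P) → does P? ≡ true → P
does-sound (yes p) _ = p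

does-complete : ∀ {P : Set} (P? : Dec P) → P → does P? ≡ true
does-complete (yes _) _ = refl
does-complete (no ¬p) p = contradiction p ¬p

does-refute : ∀ {P : Set} (P? : Dec P) → ¬ P → does P? ≡ false
does-refute (yes p) ¬p = contradiction p ¬p
does-refute (no _)  _  = refl

if-sound : ∀ {a b} → (if a then b else true) ≡ true → a ≡ true → b ≡ true
if-sound eq refl = eq

-- Designs developed from base blocks under ℤ/n, acting regularly on K orbits and fixing f further points.
module Cyclic (n K f : ℕ) ⦃ _ : NonZero n ⦄ where
  open Residues n

  data Point : Set where
    orb : Fin K → Z n → Point
    fix : Fin f → Point

  -- The orbit of an ordered pair of points.
  data Key : Set where
    oo : Fin K → Fin K → Z n → Key
    of : Fin K → Fin f → Key
    fo : Fin f → Fin K → Key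
    ff : Fin f → Fin f → Key

  shift : Z n → Point → Point
  shift s (orb o a) = orb o (a +ᶻ s)
  shift s (fix j)   = fix j

  key : Point → Point → Key
  key (orb o a) (orb o′ b) = oo o o′ (b -ᶻ a)
  key (orb o a) (fix j)    = of o j
  key (fix j)   (orb o a)  = fo j o
  key (fix j)   (fix j′)   = ff j j′

  key-shift : ∀ s x y → key (shift s x) (shift s y) ≡ key x y
  key-shift s (orb o a) (orb o′ b) = cong (oo o o′) (difference-shift a b s)
  key-shift s (orb _ _) (fix _)    = refl
  key-shift s (fix _)   (orb _ _)  = refl
  key-shift s (fix _)   (fix _)    = refl

  oo-injective : ∀ {o o′ d p p′ e} → oo o o′ d ≡ oo p p′ e → o ≡ p × o′ ≡ p′ × d ≡ e
  oo-injective refl = refl , refl , refl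

  -- The method of differences: the key is a complete invariant of the orbits of ordered pairs. The
  -- shift is read off from whichever point lies on an orbit.
  key-orbit : ∀ x y x′ y′ → key x y ≡ key x′ y′ → Σ (Z n) λ s → shift s x ≡ x′ × shift s y ≡ y′
  key-orbit (orb o a) (orb o′ b) (orb p c) (orb p′ d) eq with oo-injective eq
  ... | refl , refl , b-a≡d-c = c -ᶻ a , cong (orb p) (shift-to a c) ,
          cong (orb p′) (difference-cancel a c b d b-a≡d-c)
  key-orbit (orb o a) (fix j) (orb p c) (fix j′) refl = c -ᶻ a , cong (orb p) (shift-to a c) , refl
  key-orbit (fix j) (orb o b) (fix j′) (orb p d) refl = d -ᶻ b , refl , cong (orb p) (shift-to b d)
  -- Every shift fixes both points; zero is an arbitrary choice.
  key-orbit (fix j) (fix j′) (fix i) (fix i′) refl = ⟦ 0 ⟧ , refl , refl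
  key-orbit (orb _ _) (orb _ _) (orb _ _) (fix _) ()
  key-orbit (orb _ _) (orb _ _) (fix _) (orb _ _) ()
  key-orbit (orb _ _) (orb _ _) (fix _) (fix _) ()
  key-orbit (orb _ _) (fix _) (orb _ _) (orb _ _) ()
  key-orbit (orb _ _) (fix _) (fix _) (orb _ _) ()
  key-orbit (orb _ _) (fix _) (fix _) (fix _) ()
  key-orbit (fix _) (orb _ _) (orb _ _) (orb _ _) ()
  key-orbit (fix _) (orb _ _) (orb _ _) (fix _) ()
  key-orbit (fix _) (orb _ _) (fix _) (fix _) ()
  key-orbit (fix _) (fix _) (orb _ _) (orb _ _) ()
  key-orbit (fix _) (fix _) (orb _ _) (fix _) ()
  key-orbit (fix _) (fix _) (fix _) (orb _ _) ()

  Z-≟ : (x y : Z n) → Dec (x ≡ y)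
  Z-≟ x y = map′ val-injective (cong val) (val x ≟ⁿ val y)

  point-≟ : (x y : Point) → Dec (x ≡ y)
  point-≟ (orb o a) (orb p b) = map′ (λ { (refl , refl) → refl }) (λ { refl → refl , refl }) (o ≟ p ×-dec Z-≟ a b)
  point-≟ (orb _ _) (fix _)   = no λ ()
  point-≟ (fix _)   (orb _ _) = no λ ()
  point-≟ (fix i)   (fix j)   = map′ (cong fix) (λ { refl → refl }) (i ≟ j)

  key-≟ : (x y : Key) → Dec (x ≡ y)
  key-≟ (oo o p a) (oo o′ p′ b) = map′ (λ { (refl , refl , refl) → refl }) (λ { refl → refl , refl , refl })
                                    (o ≟ o′ ×-dec p ≟ p′ ×-dec Z-≟ a b)
  key-≟ (of o j) (of o′ j′) = map′ (λ { (refl , refl) → refl }) (λ { refl → refl , refl }) (o ≟ o′ ×-dec j ≟ j′)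
  key-≟ (fo j o) (fo j′ o′) = map′ (λ { (refl , refl) → refl }) (λ { refl → refl , refl }) (j ≟ j′ ×-dec o ≟ o′)
  key-≟ (ff i j) (ff i′ j′) = map′ (λ { (refl , refl) → refl }) (λ { refl → refl , refl }) (i ≟ i′ ×-dec j ≟ j′)
  key-≟ (oo _ _ _) (of _ _) = no λ ()
  key-≟ (oo _ _ _) (fo _ _) = no λ ()
  key-≟ (oo _ _ _) (ff _ _) = no λ ()
  key-≟ (of _ _) (oo _ _ _) = no λ ()
  key-≟ (of _ _) (fo _ _)   = no λ ()
  key-≟ (of _ _) (ff _ _)   = no λ ()
  key-≟ (fo _ _) (oo _ _ _) = no λ ()
  key-≟ (fo _ _) (of _ _)   = no λ ()
  key-≟ (fo _ _) (ff _ _)   = no λ ()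
  key-≟ (ff _ _) (oo _ _ _) = no λ ()
  key-≟ (ff _ _) (of _ _)   = no λ ()
  key-≟ (ff _ _) (fo _ _)   = no λ ()

  allBelow : (Z n → Bool) → ℕ → Bool
  allBelow p zero    = true
  allBelow p (suc k) = p ⟦ k ⟧ ∧ allBelow p k

  allBelow-sound : ∀ p m → allBelow p m ≡ true → ∀ {k} → k < m → p ⟦ k ⟧ ≡ true
  allBelow-sound p (suc m) eq {k} k<1+m with k ≟ⁿ m
  ... | yes refl = proj₁ (∧-true eq)
  ... | no  k≢m  = allBelow-sound p m (proj₂ (∧-true {p ⟦ m ⟧} eq)) (≤∧≢⇒< (≤-pred k<1+m) k≢m)

  allZ : (Z n → Bool) → Bool
  allZ p = allBelow p n

  allZ-sound : ∀ p → allZ p ≡ true → ∀ a → p a ≡ true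
  allZ-sound p eq a = subst (λ z → p z ≡ true) (⟦val⟧ a) (allBelow-sound p n eq (val<n a))

  fromOrbit : (Key → Bool) → Fin K → Bool
  fromOrbit p o = all K (λ o′ → allZ (p ∘ oo o o′)) ∧ all f (λ j → p (of o j) ∧ p (fo j o))

  allKeys : (Key → Bool) → Bool
  allKeys p = all K (fromOrbit p) ∧ all f (λ j → all f (p ∘ ff j))

  allKeys-sound : ∀ p → allKeys p ≡ true → ∀ κ → p κ ≡ true
  allKeys-sound p eq = go
    where
    orbit : ∀ o → fromOrbit p o ≡ true
    orbit = all-sound K (fromOrbit p) (proj₁ (∧-true eq))
    with-fixed : ∀ o j → p (of o j) ∧ p (fo j o) ≡ true
    with-fixed o = all-sound f (λ j → p (of o j) ∧ p (fo j o))
      (proj₂ (∧-true {all K (λ o′ → allZ (p ∘ oo o o′))} (orbit o)))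
    go : ∀ κ → p κ ≡ true
    go (oo o o′ d) = allZ-sound (p ∘ oo o o′)
      (all-sound K (λ o′ → allZ (p ∘ oo o o′)) (proj₁ (∧-true (orbit o))) o′) d
    go (of o j)  = proj₁ (∧-true (with-fixed o j))
    go (fo j o)  = proj₂ (∧-true {p (of o j)} (with-fixed o j))
    go (ff j j′) = all-sound f (p ∘ ff j) (all-sound f (λ j → all f (p ∘ ff j))
      (proj₂ (∧-true {all K (fromOrbit p)} eq)) j) j′

  -- Consecutive ranges of lengths `K * K * n`, `K * f` and `K * f`. The value at `ff` is a dummy:
  -- the check demands that pairs of fixed points be unrelated, so such a key is never looked up
  -- successfully as a covered pair.
  encode : Key → ℕ
  encode (oo o o′ d) = (toℕ o * K + toℕ o′) * n + val d
  encode (of o j)    = K * K * n + (toℕ o * f + toℕ j)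
  encode (fo j o)    = K * K * n + K * f + (toℕ j * K + toℕ o)
  encode (ff j j′)   = 0

  module _ {L : ℕ} where

    Base : Set
    Base = Vec (Vec Point 5) L

    Slot₂ Slot₃ : Set
    Slot₂ = Fin L × Pos × Pos
    Slot₃ = Fin L × Pos × Pos × Pos

    point : Base → Fin L → Pos → Point
    point bs k i = Vec.lookup (Vec.lookup bs k) i

    blockKey₂ : Vec Point 5 → Pos × Pos → Key
    blockKey₂ b (i , j) = key (Vec.lookup b i) (Vec.lookup b j)

    -- The third key follows from the first two unless the first point is fixed. In that case only
    -- the third records the difference of the other two points, and it keeps triples that are not
    -- translates apart.
    blockKey₃ : Vec Point 5 → Pos × Pos × Pos → Key × Key × Key
    blockKey₃ b (h , i , j) = blockKey₂ b (h , i) , blockKey₂ b (h , j) , blockKey₂ b (i , j)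

    key₂ : Base → Slot₂ → Key
    key₂ bs (k , s) = blockKey₂ (Vec.lookup bs k) s

    key₃ : Base → Slot₃ → Key × Key × Key
    key₃ bs (k , s) = blockKey₃ (Vec.lookup bs k) s

    encode₃ : Key × Key × Key → ℕ
    encode₃ (a , b , c) = (encode a * m + encode b) * m + encode c
      where m = K * K * n + K * f * 2

    positions₂ : List (Pos × Pos)
    positions₂ = List.filter (λ (i , j) → i <? j) (cartesianProduct (allFin 5) (allFin 5))

    -- All 60 ordered triples, not only the increasing ones: two blocks may carry the same three
    -- points in different orders, and the clash must still appear as a common key.
    positions₃ : List (Pos × Pos × Pos)
    positions₃ = List.filter (λ (h , i , j) → ¬? (h ≟ i) ×-dec ¬? (h ≟ j) ×-dec ¬? (i ≟ j))
                   (cartesianProduct (allFin 5) (cartesianProduct (allFin 5) (allFin 5)))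

    insertBlock : ∀ {S : Set} → (Vec Point 5 → S → ℕ) → List S → Fin L → Vec Point 5 → Tree (Fin L × S) → Tree (Fin L × S)
    insertBlock code []       k b t = t
    insertBlock code (s ∷ ss) k b t = insert (code b s) (k , s) (insertBlock code ss k b t)

    tabulateTree : ∀ {S : Set} → (Vec Point 5 → S → ℕ) → List S → List (Fin L) → Base → Tree (Fin L × S)
    tabulateTree code ss []       bs = leaf
    tabulateTree code ss (k ∷ ks) bs = insertBlock code ss k (Vec.lookup bs k) (tabulateTree code ss ks bs)

    table₂ : Base → Tree Slot₂
    table₂ = tabulateTree (λ b s → encode (blockKey₂ b s)) positions₂ (List.allFin L)

    table₃ : Base → Tree Slot₃
    table₃ = tabulateTree (λ b s → encode₃ (blockKey₃ b s)) positions₃ (List.allFin L)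

    index-≟ : (k k′ : Fin L) → Dec (k ≡ k′)
    index-≟ k k′ = map′ toℕ-injective (cong toℕ) (toℕ k ≟ⁿ toℕ k′)

    slot₂-≟ : (s t : Slot₂) → Dec (s ≡ t)
    slot₂-≟ = ≡-dec index-≟ (≡-dec _≟_ _≟_)

    slot₃-≟ : (s t : Slot₃) → Dec (s ≡ t)
    slot₃-≟ = ≡-dec index-≟ (≡-dec _≟_ (≡-dec _≟_ _≟_))

    is : ∀ {A : Set} → ((s t : A) → Dec (s ≡ t)) → Maybe A → A → Bool
    is _≟ᴬ_ nothing  t = false
    is _≟ᴬ_ (just s) t = does (s ≟ᴬ t)

    is-sound : ∀ {A : Set} (_≟ᴬ_ : (s t : A) → Dec (s ≡ t)) m t → is _≟ᴬ_ m t ≡ true → m ≡ just t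
    is-sound _≟ᴬ_ (just s) t eq = cong just (does-sound (s ≟ᴬ t) eq)

    -- The trees enter as arbitrary parameters. Every pair of positions in increasing order and
    -- every triple of distinct positions must be found under its own code; this yields `unique` and
    -- `simple`. Conversely, every related key must be found in `t₂` at a slot that really has this
    -- key; this yields `cover`.
    module Check (rel : Key → Bool) (bs : Base) (t₂ : Tree Slot₂) (t₃ : Tree Slot₃) where

      goodPair : Fin L → Vec Point 5 → Pos × Pos → Bool
      goodPair k b s@(i , j) =
        (if does (i ≟ j) then true else rel (blockKey₂ b s)) ∧
        (if does (i <? j) then is slot₂-≟ (search (encode (blockKey₂ b s)) t₂) (k , s) else true)

      goodTriple : Fin L → Vec Point 5 → Pos × Pos × Pos → Bool
      goodTriple k b s@(h , i , j) =
        if does (¬? (h ≟ i) ×-dec ¬? (h ≟ j) ×-dec ¬? (i ≟ j))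
        then is slot₃-≟ (search (encode₃ (blockKey₃ b s)) t₃) (k , s) else true

      goodSlot : Fin L → Vec Point 5 → Pos → Pos → Bool
      goodSlot k b h i = goodPair k b (h , i) ∧ all 5 λ j → goodTriple k b (h , i , j)

      goodBlock : Fin L → Vec Point 5 → Bool
      goodBlock k b = all 5 λ i → all 5 (goodSlot k b i)

      covers : Key → Maybe Slot₂ → Bool
      covers κ nothing              = false
      covers κ (just s@(k , i , j)) = does (i <? j) ∧ does (key-≟ (key₂ bs s) κ)

      covered : Key → Bool
      covered κ = if rel κ then covers κ (search (encode κ) t₂) else true

      check : Bool
      check = all L (λ k → goodBlock k (Vec.lookup bs k))
            ∧ allKeys covered ∧ all f (λ j → all f (λ j′ → not (rel (ff j j′))))

    module Sound (rel : Key → Bool) (bs : Base) (t₂ : Tree Slot₂) (t₃ : Tree Slot₃)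
                 (ok : Check.check rel bs t₂ t₃ ≡ true) where
      open Check rel bs t₂ t₃

      slot-ok : ∀ k i j → goodSlot k (Vec.lookup bs k) i j ≡ true
      slot-ok k i j = all-sound 5 (goodSlot k b i) (all-sound 5 (λ i → all 5 (goodSlot k b i))
        (all-sound L (λ k → goodBlock k (Vec.lookup bs k)) (proj₁ (∧-true ok)) k) i) j
        where b = Vec.lookup bs k

      pair-ok : ∀ k i j → goodPair k (Vec.lookup bs k) (i , j) ≡ true
      pair-ok k i j = proj₁ (∧-true {goodPair k (Vec.lookup bs k) (i , j)} (slot-ok k i j))

      triple-ok : ∀ k h i j → goodTriple k (Vec.lookup bs k) (h , i , j) ≡ true
      triple-ok k h i j = all-sound 5 (λ j → goodTriple k b (h , i , j))
        (proj₂ (∧-true {goodPair k b (h , i)} (slot-ok k h i))) j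
        where b = Vec.lookup bs k

      keys-ok : ∀ κ → covered κ ≡ true
      keys-ok = allKeys-sound covered (proj₁ (∧-true {allKeys covered} (proj₂ (∧-true {all L _} ok))))

      fixed-ok : ∀ j j′ → rel (ff j j′) ≡ false
      fixed-ok j j′ = not-true (all-sound f (not ∘ rel ∘ ff j) (all-sound f (λ j → all f (not ∘ rel ∘ ff j))
        (proj₂ (∧-true {allKeys covered} (proj₂ (∧-true {all L _} ok)))) j) j′)
        where
        not-true : ∀ {a} → not a ≡ true → a ≡ false
        not-true {false} _ = refl

      related : ∀ k {i j} → i ≢ j → rel (key₂ bs (k , i , j)) ≡ true
      related k {i} {j} i≢j with i ≟ j | pair-ok k i j
      ... | yes i≡j | _  = contradiction i≡j i≢j
      ... | no _    | ok′ = proj₁ (∧-true {rel _} ok′)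

      found₂ : ∀ k i j → i <ᶠ j → search (encode (key₂ bs (k , i , j))) t₂ ≡ just (k , i , j)
      found₂ k i j i<j = is-sound slot₂-≟ _ (k , i , j)
        (if-sound (proj₂ (∧-true {if does (i ≟ j) then true else _} (pair-ok k i j))) (does-complete (i <? j) i<j))

      found₃ : ∀ k h i j → h ≢ i → h ≢ j → i ≢ j → search (encode₃ (key₃ bs (k , h , i , j))) t₃ ≡ just (k , h , i , j)
      found₃ k h i j h≢i h≢j i≢j = is-sound slot₃-≟ _ (k , h , i , j)
        (if-sound (triple-ok k h i j) (does-complete (¬? (h ≟ i) ×-dec ¬? (h ≟ j) ×-dec ¬? (i ≟ j)) (h≢i , h≢j , i≢j)))

      find : ∀ κ → rel κ ≡ true → Σ Slot₂ λ (k , i , j) → i <ᶠ j × key₂ bs (k , i , j) ≡ κ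
      find κ r with search (encode κ) t₂ | if-sound (keys-ok κ) r
      ... | just s@(k , i , j) | eq = s , does-sound (i <? j) (proj₁ (∧-true eq)) ,
              does-sound (key-≟ (key₂ bs s) κ) (proj₂ (∧-true {does (i <? j)} eq))

      -- A related pair contains a point on an orbit, where the group acts regularly, so the images
      -- of the pair determine the shift. Hence every base block has `n` different translates.
      same-shift : ∀ x y s s′ → rel (key x y) ≡ true → shift s x ≡ shift s′ x → shift s y ≡ shift s′ y → s ≡ s′
      same-shift (orb o a) y         s s′ _ eq _  = +-cancelˡᶻ a (orb-injective eq)
        where
        orb-injective : ∀ {o b c} → orb o b ≡ orb o c → b ≡ c
        orb-injective refl = refl
      same-shift (fix j)   (orb o a) s s′ _ _  eq = +-cancelˡᶻ a (orb-injective eq)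
        where
        orb-injective : ∀ {o b c} → orb o b ≡ orb o c → b ≡ c
        orb-injective refl = refl
      same-shift (fix j)   (fix j′)  s s′ r _ _ with trans (sym r) (fixed-ok j j′)
      ... | ()

      key-≡ : ∀ s s′ {x y x′ y′} → shift s x ≡ shift s′ x′ → shift s y ≡ shift s′ y′ → key x y ≡ key x′ y′
      key-≡ s s′ {x} {y} {x′} {y′} eq₁ eq₂ =
        trans (sym (key-shift s x y)) (trans (cong₂ key eq₁ eq₂) (key-shift s′ x′ y′))

      develop : Design Point (λ x y → rel (key x y) ≡ true)
      develop .Blk = Fin L × Z n
      develop .pt (k , s) i = shift s (point bs k i)
      develop .sound (k , s) i≢j = trans (cong rel (key-shift s _ _)) (related k i≢j)
      develop .cover {x} {y} r with find (key x y) r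
      ... | (k , i , j) , i<j , eq with key-orbit _ _ x y eq
      ... | s , eq₁ , eq₂ = (k , s) , i , j , i<j , eq₁ , eq₂
      develop .unique (k , s) (k′ , s′) {i} {j} {i′} {j′} i<j i′<j′ eq₁ eq₂
        with trans (sym (found₂ k i j i<j)) (trans
               (cong (λ κ → search (encode κ) t₂) (key-≡ s s′ eq₁ eq₂)) (found₂ k′ i′ j′ i′<j′))
      ... | refl = cong (k ,_) (same-shift (point bs k i) (point bs k j) s s′ (related k (<⇒≢ i<j)) eq₁ eq₂)
      develop .simple (k , s) (k′ , s′) {h} {i} {j} {h′} {i′} {j′} h≢i h≢j i≢j h′≢i′ h′≢j′ i′≢j′ eq₁ eq₂ eq₃
        with trans (sym (found₃ k h i j h≢i h≢j i≢j)) (trans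
               (cong (λ κ → search (encode₃ κ) t₃) (cong₂ _,_ (key-≡ s s′ eq₁ eq₂)
                 (cong₂ _,_ (key-≡ s s′ eq₁ eq₃) (key-≡ s s′ eq₂ eq₃))))
               (found₃ k′ h′ i′ j′ h′≢i′ h′≢j′ i′≢j′))
      ... | refl = cong (k ,_) (same-shift (point bs k h) (point bs k i) s s′ (related k h≢i) eq₁ eq₂)

-- Explicit designs, designs with holes and group divisible designs

sizes : ∀ k → ℕ → ℕ → Fin (suc k) → ℕ
sizes k w h zero    = h
sizes k w h (suc _) = w

module CyclicDesign (n K f : ℕ) ⦃ _ : NonZero n ⦄ ⦃ _ : NonZero K ⦄ where
  open Residues n
  open Cyclic n K f public

  -- The a-th point of the o-th orbit is written o * n + a, the j-th fixed point K * n + j.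
  decode : ℕ → Point
  decode c with K * n ≤ᵇ c | c ∸ K * n <ⁿ? f
  ... | true | yes j<f = fix (fromℕ< j<f)
  ... | _    | _       = orb ((c / n) mod K) ⟦ c ⟧

  decodeBlocks : ∀ {L} → Vec (Vec ℕ 5) L → Base
  decodeBlocks = Vec.map (Vec.map decode)

  verify : ∀ {L} → (Key → Bool) → Base {L} → Bool
  verify rel bs = Check.check rel bs (table₂ bs) (table₃ bs)

  fromBase : ∀ {L} (rel : Key → Bool) (base : Vec (Vec ℕ 5) L) →
             verify rel (decodeBlocks base) ≡ true → Design Point (λ x y → rel (key x y) ≡ true)
  fromBase rel base = Sound.develop rel bs (table₂ bs) (table₃ bs)
    where bs = decodeBlocks base

  -- Pairs of fixed points are excluded, so the fixed points form the hole.
  distinct : Key → Bool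
  distinct (oo o o′ d) = not (does (o ≟ o′) ∧ does (Z-≟ d ⟦ 0 ⟧))
  distinct (of _ _)    = true
  distinct (fo _ _)    = true
  distinct (ff _ _)    = false

  split : Point ↔ ((Fin K × Z n) ⊎ Fin f)
  split = mk↔ₛ′ (λ { (orb o a) → inj₁ (o , a) ; (fix j) → inj₂ j })
                (λ { (inj₁ (o , a)) → orb o a ; (inj₂ j) → fix j })
                (λ { (inj₁ _) → refl ; (inj₂ _) → refl }) (λ { (orb _ _) → refl ; (fix _) → refl })

  distinct⇒ : ∀ {x y} → distinct (key x y) ≡ true →
              Inverse.to split x ≢ Inverse.to split y × Outside (Inverse.to split x) (Inverse.to split y)
  distinct⇒ {orb o a} {orb o′ b} eq = apart , left
    where
    apart : inj₁ (o , a) ≢ inj₁ (o′ , b)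
    apart refl rewrite does-complete (o ≟ o) refl | does-complete (Z-≟ (a -ᶻ a) ⟦ 0 ⟧) (x+νx≡0 a) = contradiction eq λ ()
  distinct⇒ {orb o a} {fix j}   eq = (λ ()) , left
  distinct⇒ {fix j}   {orb o a} eq = (λ ()) , right

  ⇒distinct : ∀ {x y} → x ≢ y × Outside x y → distinct (key (Inverse.from split x) (Inverse.from split y)) ≡ true
  ⇒distinct {inj₁ (o , a)} {inj₁ (o′ , b)} (x≢y , _) with o ≟ o′ | Z-≟ (b -ᶻ a) ⟦ 0 ⟧
  ... | no _     | _       = refl
  ... | yes _    | no b-a≢0 = cong not (does-refute (Z-≟ (b -ᶻ a) ⟦ 0 ⟧) b-a≢0)
  ... | yes refl | yes b-a≡0 = contradiction (cong (λ c → inj₁ (o , c)) (begin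
    a                  ≡⟨ +-identityˡᶻ a ⟨
    ⟦ 0 ⟧ +ᶻ a         ≡⟨ +-commᶻ ⟦ 0 ⟧ a ⟩
    a +ᶻ ⟦ 0 ⟧         ≡⟨ cong (a +ᶻ_) b-a≡0 ⟨
    a +ᶻ (b -ᶻ a)      ≡⟨ shift-to a b ⟩
    b                  ∎)) x≢y
  ⇒distinct {inj₁ _} {inj₂ _} _ = refl
  ⇒distinct {inj₂ _} {inj₁ _} _ = refl
  ⇒distinct {inj₂ _} {inj₂ _} (_ , ())

  incomplete : ∀ {L} (base : Vec (Vec ℕ 5) L) → verify distinct (decodeBlocks base) ≡ true →
               Incomplete (Fin (K * n)) (Fin f)
  incomplete base ok = incomplete-cong (↔-trans (↔-refl ×-↔ Z↔Fin) (↔-sym *↔×))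
    (transport (fromBase distinct base ok) split distinct⇒ ⇒distinct)

  dd : ∀ {L} {f≤1 : True (f ≤? 1)} (base : Vec (Vec ℕ 5) L) → verify distinct (decodeBlocks base) ≡ true → DD (K * n + f)
  dd {f≤1 = f≤1} base ok = toDD (restrict (incomplete base ok) proj₁
    (λ x≢y → x≢y , outside-≤1 (toWitness f≤1) x≢y)) (↔-sym +↔⊎)

  allPoints : (Point → Bool) → Bool
  allPoints p = all K (λ o → allZ (p ∘ orb o)) ∧ all f (p ∘ fix)

  allPoints-sound : ∀ p → allPoints p ≡ true → ∀ x → p x ≡ true
  allPoints-sound p eq (orb o a) = allZ-sound (p ∘ orb o)
    (all-sound K (λ o → allZ (p ∘ orb o)) (proj₁ (∧-true eq)) o) a
  allPoints-sound p eq (fix j) = all-sound f (p ∘ fix) (proj₂ (∧-true {all K (λ o → allZ (p ∘ orb o))} eq)) j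

  -- A GDD with groups of sizes s, among them e ≤ 1 groups of fixed points (numbered first).
  -- The other points are cut into strips of length q, which belong to g groups in turn.
  module Arrange {k : ℕ} (s : Fin k → ℕ) (e g q : ℕ) ⦃ _ : NonZero g ⦄ ⦃ _ : NonZero q ⦄ where

    group : Point → ℕ
    group (orb o a) = e + (toℕ o * n + val a) / q % g
    group (fix _)   = 0

    -- Reads the groups off the representative of the orbit that starts at residue 0. That this does
    -- not depend on the representative, i.e. that translations respect the partition into groups,
    -- is confirmed for all pairs of points by `goodPair`.
    rel : Key → Bool
    rel (oo o o′ d) = not (group (orb o ⟦ 0 ⟧) ≡ᵇ group (orb o′ d))
    rel (of _ _)    = true
    rel (fo _ _)    = true
    rel (ff _ _)    = false

    Place : Set
    Place = Σ (Fin k) (Fin ∘ s)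

    place : Place → Point
    place (c , p) with toℕ c <ᵇ e
    ... | true  = decode (K * n + toℕ p)
    ... | false = decode ((toℕ p / q * g + (toℕ c ∸ e)) * q + toℕ p % q)

    toPlace : ℕ → ℕ → Maybe Place
    toPlace c p with c <ⁿ? k
    ... | no _ = nothing
    ... | yes c<k with p <ⁿ? s (fromℕ< c<k)
    ...   | no _    = nothing
    ...   | yes p<s = just (fromℕ< c<k , fromℕ< p<s)

    unplace : Point → Maybe Place
    unplace (fix j)   = toPlace 0 (toℕ j)
    unplace (orb o a) = toPlace (e + code / q % g) (code / q / g * q + code % q)
      where code = toℕ o * n + val a

    same : Place → Maybe Place → Bool
    same (c , p) nothing          = false
    same (c , p) (just (c′ , p′)) = does (c ≟ c′) ∧ (toℕ p ≡ᵇ toℕ p′)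

    same-sound : ∀ x m → same x m ≡ true → m ≡ just x
    same-sound (c , p) (just (c′ , p′)) eq with c ≟ c′
    ... | yes refl = cong (λ p → just (c , p)) (sym (toℕ-injective (≡ᵇ⇒≡ (toℕ p) (toℕ p′) (subst T (sym eq) tt))))

    located : Point → Maybe Place → Bool
    located y nothing  = false
    located y (just x) = does (point-≟ (place x) y)

    goodPlace : (c : Fin k) → Fin (s c) → Bool
    goodPlace c p = same (c , p) (unplace (place (c , p))) ∧ (group (place (c , p)) ≡ᵇ toℕ c)

    goodPair : Point → Point → Bool
    goodPair x y = does (rel (key x y) ≟ᵇ not (group x ≡ᵇ group y))

    check : Bool
    check = all k (λ c → all (s c) (goodPlace c)) ∧ allPoints (λ y → located y (unplace y))
          ∧ allPoints (λ x → allPoints (goodPair x))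

    module Correct (ok : check ≡ true) where

      place-ok : ∀ c p → goodPlace c p ≡ true
      place-ok c = all-sound (s c) (goodPlace c) (all-sound k (λ c → all (s c) (goodPlace c)) (proj₁ (∧-true ok)) c)

      rest : allPoints (λ y → located y (unplace y)) ≡ true × allPoints (λ x → allPoints (goodPair x)) ≡ true
      rest = ∧-true (proj₂ (∧-true {all k (λ c → all (s c) (goodPlace c))} ok))

      rel-≡ : ∀ x y → rel (key x y) ≡ not (group x ≡ᵇ group y)
      rel-≡ x y = does-sound (rel (key x y) ≟ᵇ not (group x ≡ᵇ group y))
        (allPoints-sound (goodPair x) (allPoints-sound (λ x → allPoints (goodPair x)) (proj₂ rest) x) y)

      group-place : ∀ x → group (place x) ≡ toℕ (proj₁ x)
      group-place x@(c , p) = ≡ᵇ⇒≡ (group (place x)) (toℕ c)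
        (subst T (sym (proj₂ (∧-true {same x (unplace (place x))} (place-ok c p)))) tt)

      preimage : ∀ y → Σ Place λ x → unplace y ≡ just x × place x ≡ y
      preimage y with unplace y | allPoints-sound (λ y → located y (unplace y)) (proj₁ rest) y
      ... | just x | eq = x , refl , does-sound (point-≟ (place x) y) eq

      places : Point ↔ Place
      places = mk↔ₛ′ (proj₁ ∘ preimage) place inverse (λ y → proj₂ (proj₂ (preimage y)))
        where
        inverse : ∀ x → proj₁ (preimage (place x)) ≡ x
        inverse x@(c , p) = just-injective (trans (sym (proj₁ (proj₂ (preimage (place x)))))
          (same-sound x (unplace (place x)) (proj₁ (∧-true (place-ok c p)))))

      group-to : ∀ y → group y ≡ toℕ (proj₁ (proj₁ (preimage y)))
      group-to y = trans (cong group (sym (proj₂ (proj₂ (preimage y))))) (group-place (proj₁ (preimage y)))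

      arrange : Design Point (λ x y → rel (key x y) ≡ true) → GDD k (Fin ∘ s)
      arrange D = transport D places
        (λ {x} {y} r c≡c′ → contradiction (trans (sym r) (trans (rel-≡ x y) (cong not (≡⇒≡ᵇ-true
          (trans (group-to x) (trans (cong toℕ c≡c′) (sym (group-to y)))))))) λ ())
        (λ {x} {y} c≢c′ → trans (rel-≡ (place x) (place y)) (cong not (≢⇒≡ᵇ-false λ eq →
          c≢c′ (toℕ-injective (trans (sym (group-place x)) (trans eq (group-place y)))))))
        where
        ≡⇒≡ᵇ-true : ∀ {a b} → a ≡ b → (a ≡ᵇ b) ≡ true
        ≡⇒≡ᵇ-true {a} {b} = does-complete (a ≟ⁿ b)
        ≢⇒≡ᵇ-false : ∀ {a b} → a ≢ b → (a ≡ᵇ b) ≡ false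
        ≢⇒≡ᵇ-false {a} {b} = does-refute (a ≟ⁿ b)

  gdd : ∀ {k} (s : Fin k → ℕ) (e g q : ℕ) ⦃ _ : NonZero g ⦄ ⦃ _ : NonZero q ⦄ {L} (base : Vec (Vec ℕ 5) L) →
        Arrange.check s e g q ∧ verify (Arrange.rel s e g q) (decodeBlocks base) ≡ true → GDD k (Fin ∘ s)
  gdd s e g q base ok = Arrange.Correct.arrange s e g q (proj₁ (∧-true ok))
    (fromBase (Arrange.rel s e g q) base (proj₂ (∧-true {Arrange.check s e g q} ok)))

-- Transversal designs from lines and parabolas over a ring

-- Stated for abstract operations, so that sums and products of residues are never unfolded.
module LinearTD {A : Set} {_+ᶻ_ _*ᶻ_ : A → A → A} {0ᶻ 1ᶻ : A}
  (isCommutativeSemiring : IsCommutativeSemiring _≡_ _+ᶻ_ _*ᶻ_ 0ᶻ 1ᶻ)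
  (ν : A) (x+νx≡0 : ∀ x → x +ᶻ (ν *ᶻ x) ≡ 0ᶻ) {m : ℕ} (A↔Fin : A ↔ Fin m) where

  private
    infixl 6 _⊕_
    infixl 7 _⊗_
    _⊕_ _⊗_ : A → A → A
    _⊕_ = _+ᶻ_
    _⊗_ = _*ᶻ_

    semiring : CommutativeSemiring _ _
    semiring = record { isCommutativeSemiring = isCommutativeSemiring }

  module Ring = RingLemmas semiring
  open Ring.Negative ν x+νx≡0
  open CommutativeSemiring semiring using () renaming
    (*-identityˡ to ⊗-identityˡ; *-identityʳ to ⊗-identityʳ; +-identityˡ to ⊕-identityˡ; zeroˡ to ⊗-zeroˡ; +-comm to ⊕-comm)

  Unit : A → Set
  Unit a = Σ A λ i → a ⊗ i ≡ 1ᶻ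

  toFin : A → Fin m
  toFin = Inverse.to A↔Fin

  toFin-injective : ∀ {x y} → toFin x ≡ toFin y → x ≡ y
  toFin-injective {x} {y} eq = trans (sym (strictlyInverseʳ x)) (trans (cong from eq) (strictlyInverseʳ y))
    where open Inverse A↔Fin

  unit-cancel : ∀ {d i} → d ⊗ i ≡ 1ᶻ → ∀ u → d ⊗ i ⊗ u ≡ u
  unit-cancel eq u = trans (cong (_⊗ u) eq) (⊗-identityˡ u)

  ⊕-cancelˡ : ∀ a {s t} → a ⊕ s ≡ a ⊕ t → s ≡ t
  ⊕-cancelˡ a {s} {t} eq = trans (sym (add-subtract a s)) (trans (cong (_⊕ ν ⊗ a) eq) (add-subtract a t))

  module Forms {k} (α β : Fin k → A)
    (independent : ∀ {c c′} → c <ᶠ c′ → Unit (det (α c) (β c) (α c′) (β c′))) where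

    form : A × A → Fin k → A
    form (x , y) c = α c ⊗ x ⊕ β c ⊗ y

    form-injective< : ∀ {c c′} → c <ᶠ c′ → ∀ r r′ → form r c ≡ form r′ c → form r c′ ≡ form r′ c′ → r ≡ r′
    form-injective< {c} {c′} c<c′ (x , y) (x′ , y′) eq₁ eq₂ with independent c<c′
    ... | i , unit = cong₂ _,_
      (trans (sym (solve-x x y)) (trans (cong₂ (λ u v → i ⊗ (β c′ ⊗ u ⊕ ν ⊗ (β c ⊗ v))) eq₁ eq₂) (solve-x x′ y′)))
      (trans (sym (solve-y x y)) (trans (cong₂ (λ u v → i ⊗ (α c ⊗ v ⊕ ν ⊗ (α c′ ⊗ u))) eq₁ eq₂) (solve-y x′ y′)))
      where
      solve-x : ∀ x y → i ⊗ (β c′ ⊗ form (x , y) c ⊕ ν ⊗ (β c ⊗ form (x , y) c′)) ≡ x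
      solve-x x y = trans (eliminate₁ (α c) (β c) (α c′) (β c′) i x y) (unit-cancel unit x)
      solve-y : ∀ x y → i ⊗ (α c ⊗ form (x , y) c′ ⊕ ν ⊗ (α c′ ⊗ form (x , y) c)) ≡ y
      solve-y x y = trans (eliminate₂ (α c) (β c) (α c′) (β c′) i x y) (unit-cancel unit y)

    form-surjective< : ∀ {c c′} → c <ᶠ c′ → ∀ u v → Σ (A × A) λ r → form r c ≡ u × form r c′ ≡ v
    form-surjective< {c} {c′} c<c′ u v with independent c<c′
    ... | i , unit = (i ⊗ (β c′ ⊗ u ⊕ ν ⊗ (β c ⊗ v)) , i ⊗ (α c ⊗ v ⊕ ν ⊗ (α c′ ⊗ u))) ,
      trans (cramer₁ (α c) (β c) (α c′) (β c′) i u v) (unit-cancel unit u) ,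
      trans (cramer₂ (α c) (β c) (α c′) (β c′) i u v) (unit-cancel unit v)

    form-injective : ∀ {c c′} → c ≢ c′ → ∀ r r′ → form r c ≡ form r′ c → form r c′ ≡ form r′ c′ → r ≡ r′
    form-injective {c} {c′} c≢c′ r r′ eq₁ eq₂ with <-cmp c c′
    ... | tri< c<c′ _ _ = form-injective< c<c′ r r′ eq₁ eq₂
    ... | tri≈ _ c≡c′ _ = contradiction c≡c′ c≢c′
    ... | tri> _ _ c′<c = form-injective< c′<c r r′ eq₂ eq₁

    form-surjective : ∀ {c c′} → c ≢ c′ → ∀ u v → Σ (A × A) λ r → form r c ≡ u × form r c′ ≡ v
    form-surjective {c} {c′} c≢c′ u v with <-cmp c c′
    ... | tri< c<c′ _ _ = form-surjective< c<c′ u v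
    ... | tri≈ _ c≡c′ _ = contradiction c≡c′ c≢c′
    ... | tri> _ _ c′<c with form-surjective< c′<c v u
    ...   | r , eq₁ , eq₂ = r , eq₂ , eq₁

    linearTD : TD k m
    linearTD .Row = A × A
    linearTD .at r c = toFin (form r c)
    linearTD .join c≢c′ u v with form-surjective c≢c′ (Inverse.from A↔Fin u) (Inverse.from A↔Fin v)
    ... | r , eq₁ , eq₂ = r , trans (cong toFin eq₁) (Inverse.strictlyInverseˡ A↔Fin u)
                            , trans (cong toFin eq₂) (Inverse.strictlyInverseˡ A↔Fin v)
    linearTD .meet c≢c′ r r′ eq₁ eq₂ = form-injective c≢c′ r r′ (toFin-injective eq₁) (toFin-injective eq₂)

  -- Slopes 0, 1, 2, 3, 4 with invertible differences, and the slope ∞ as column zero.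
  module Slopes (slope : Fin 5 → A)
    (unit-difference : ∀ {c c′} → c <ᶠ c′ → Unit (slope c′ ⊕ ν ⊗ slope c)) where

    independent : ∀ {c c′ : Fin 5} → c <ᶠ c′ → Unit (det 1ᶻ (slope c) 1ᶻ (slope c′))
    independent {c} {c′} c<c′ = subst Unit
      (sym (cong₂ (λ x y → x ⊕ ν ⊗ y) (⊗-identityˡ (slope c′)) (⊗-identityˡ (slope c)))) (unit-difference c<c′)

    open Forms (λ _ → 1ᶻ) slope independent public using (form; form-injective; form-surjective)

    α β : Fin 6 → A
    α zero    = 0ᶻ
    α (suc c) = 1ᶻ
    β zero    = 1ᶻ
    β (suc c) = slope c

    ν⊗ν≡1 : ν ⊗ ν ≡ 1ᶻ
    ν⊗ν≡1 = ⊕-cancelˡ ν (trans (x+νx≡0 ν) (sym (begin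
      ν ⊕ 1ᶻ        ≡⟨ ⊕-comm ν 1ᶻ ⟩
      1ᶻ ⊕ ν        ≡⟨ cong (1ᶻ ⊕_) (⊗-identityʳ ν) ⟨
      1ᶻ ⊕ ν ⊗ 1ᶻ   ≡⟨ x+νx≡0 1ᶻ ⟩
      0ᶻ            ∎)))

    independent₆ : ∀ {c c′} → c <ᶠ c′ → Unit (det (α c) (β c) (α c′) (β c′))
    -- The slope ∞ against a finite slope has determinant -1, which is its own inverse.
    independent₆ {zero} {suc c′} _ = ν , (begin
      (0ᶻ ⊗ slope c′ ⊕ ν ⊗ (1ᶻ ⊗ 1ᶻ)) ⊗ ν   ≡⟨ cong₂ (λ x y → (x ⊕ ν ⊗ y) ⊗ ν) (⊗-zeroˡ (slope c′)) (⊗-identityˡ 1ᶻ) ⟩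
      (0ᶻ ⊕ ν ⊗ 1ᶻ) ⊗ ν                     ≡⟨ cong (_⊗ ν) (⊕-identityˡ (ν ⊗ 1ᶻ)) ⟩
      ν ⊗ 1ᶻ ⊗ ν                            ≡⟨ cong (_⊗ ν) (⊗-identityʳ ν) ⟩
      ν ⊗ ν                                 ≡⟨ ν⊗ν≡1 ⟩
      1ᶻ                                    ∎)
    independent₆ {suc c} {suc c′} (s≤s c<c′) = independent c<c′

    td₆ : TD 6 m
    td₆ = Forms.linearTD α β independent₆

    module Parabolas (slope-injective : ∀ {c c′} → slope c ≡ slope c′ → c ≡ c′) where

      curve : A × A → Fin 5 → A
      curve r c = form r c ⊕ slope c ⊗ slope c

      -- The points of the parabola at a and b lie on the line with direction y′ + (a + b), so a and this line determine b.
      line-meets-parabola : ∀ {a b c} → a ≢ b → a ≢ c → b ≢ c → ∀ r r′ →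
        form r a ≡ curve r′ a → form r b ≡ curve r′ b → form r c ≡ curve r′ c → ⊥
      line-meets-parabola {a} {b} {c} a≢b a≢c b≢c r r′@(x′ , y′) eqᵃ eqᵇ eqᶜ =
        b≢c (slope-injective (⊕-cancelˡ (slope a) (⊕-cancelˡ y′
          (trans (sym (second a≢b eqᵃ eqᵇ)) (second a≢c eqᵃ eqᶜ)))))
        where
        1* : ∀ x y z → x ⊕ y ≡ z → 1ᶻ ⊗ x ⊕ y ≡ z
        1* x y z eq = trans (cong (_⊕ y) (⊗-identityˡ x)) eq
        secant : Fin 5 → Fin 5 → A × A
        secant a b = x′ ⊕ ν ⊗ (slope a ⊗ slope b) , y′ ⊕ (slope a ⊕ slope b)
        curve-≡ : ∀ c → curve r′ c ≡ x′ ⊕ slope c ⊗ y′ ⊕ slope c ⊗ slope c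
        curve-≡ c = cong (λ z → z ⊕ slope c ⊗ y′ ⊕ slope c ⊗ slope c) (⊗-identityˡ x′)
        second : ∀ {a b} → a ≢ b → form r a ≡ curve r′ a → form r b ≡ curve r′ b →
                 proj₂ r ≡ y′ ⊕ (slope a ⊕ slope b)
        second {a} {b} a≢b eq₁ eq₂ = cong proj₂ (form-injective a≢b r (secant a b)
          (trans eq₁ (sym (1* _ _ _ (trans (parabola₁ x′ y′ (slope a) (slope b)) (sym (curve-≡ a))))))
          (trans eq₂ (sym (1* _ _ _ (trans (parabola₂ x′ y′ (slope a) (slope b)) (sym (curve-≡ b)))))))

      -- The lines, oriented forward, and the parabolas, oriented backward, form two TD(5, m).
      lines+parabolas : GDD 5 (λ _ → A)
      lines+parabolas = record
        { Blk    = Bool × A × A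
        ; pt     = point
        ; sound  = λ { (true , r) i≢j → i≢j ; (false , r) i≢j eq → i≢j (opposite-injective eq) }
        ; cover  = cover′
        ; unique = unique′
        ; simple = simple′
        }
        where
        point : Bool × A × A → Pos → Σ (Fin 5) (λ _ → A)
        point (true  , r) i = i , form r i
        point (false , r) i = opposite i , curve r (opposite i)

        opposite-injective : ∀ {i j : Pos} → opposite i ≡ opposite j → i ≡ j
        opposite-injective {i} {j} eq = trans (sym (opposite-involutive i)) (trans (cong opposite eq) (opposite-involutive j))

        opposite-< : ∀ {i j : Pos} → i <ᶠ j → opposite j <ᶠ opposite i
        opposite-< {i} {j} i<j = subst₂ _<_ (sym (opposite-prop j)) (sym (opposite-prop i))
          (∸-monoʳ-< (s≤s i<j) (toℕ<n j))

        cover′ : ∀ {x y} → proj₁ x ≢ proj₁ y → Σ (Bool × A × A) λ b → Σ Pos λ i → Σ Pos λ j →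
                 i <ᶠ j × point b i ≡ x × point b j ≡ y
        cover′ {c , u} {c′ , v} c≢c′ with <-cmp c c′
        ... | tri≈ _ c≡c′ _ = contradiction c≡c′ c≢c′
        ... | tri< c<c′ _ _ with form-surjective c≢c′ u v
        ...   | r , refl , refl = (true , r) , c , c′ , c<c′ , refl , refl
        cover′ {c , u} {c′ , v} c≢c′ | tri> _ _ c′<c
          -- A pair with descending groups belongs to a parabola. Subtracting the squares of the
          -- slopes from the prescribed values leaves a linear system.
          with form-surjective c≢c′ (u ⊕ ν ⊗ (slope c ⊗ slope c)) (v ⊕ ν ⊗ (slope c′ ⊗ slope c′))
        ... | r , eq₁ , eq₂ = (false , r) , opposite c , opposite c′ , opposite-< c′<c , back c eq₁ , back c′ eq₂
          where
          back : ∀ c {u} → form r c ≡ u ⊕ ν ⊗ (slope c ⊗ slope c) → point (false , r) (opposite c) ≡ (c , u)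
          back c {u} eq rewrite opposite-involutive c =
            cong (c ,_) (trans (cong (_⊕ slope c ⊗ slope c) eq) (subtract-add u (slope c ⊗ slope c)))

        same-parabola : ∀ r r′ {i j} → i ≢ j → curve r i ≡ curve r′ i → curve r j ≡ curve r′ j → r ≡ r′
        same-parabola r r′ i≢j eq₁ eq₂ = form-injective i≢j r r′ (⊕-cancelʳ _ eq₁) (⊕-cancelʳ _ eq₂)
          where
          ⊕-cancelʳ : ∀ a {s t} → s ⊕ a ≡ t ⊕ a → s ≡ t
          ⊕-cancelʳ a {s} {t} eq = ⊕-cancelˡ a (trans (⊕-comm a s) (trans eq (⊕-comm t a)))

        Σ-≡ : ∀ {c c′ : Fin 5} {u v : A} → _≡_ {A = Σ (Fin 5) (λ _ → A)} (c , u) (c′ , v) → c ≡ c′ × u ≡ v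
        Σ-≡ refl = refl , refl

        -- Groups ascend along a line and descend along a parabola, so a line and a parabola never
        -- cover the same ordered pair, although they cover the same unordered ones.
        reversed : ∀ {i j i′ j′ : Pos} → i <ᶠ j → i′ <ᶠ j′ → i ≡ opposite i′ → j ≡ opposite j′ → ⊥
        reversed i<j i′<j′ refl refl = <-asym i<j (opposite-< i′<j′)

        unique′ : ∀ b b′ {i j i′ j′} → i <ᶠ j → i′ <ᶠ j′ → point b i ≡ point b′ i′ → point b j ≡ point b′ j′ → b ≡ b′
        unique′ (true , r) (true , r′) i<j i′<j′ eq₁ eq₂ with Σ-≡ eq₁ | Σ-≡ eq₂
        ... | refl , e₁ | refl , e₂ = cong (true ,_) (form-injective (<⇒≢ i<j) r r′ e₁ e₂)
        unique′ (false , r) (false , r′) {i} {j} {i′} {j′} i<j i′<j′ eq₁ eq₂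
          with opposite-injective {i} {i′} (proj₁ (Σ-≡ eq₁)) | opposite-injective {j} {j′} (proj₁ (Σ-≡ eq₂))
        ... | refl | refl = cong (false ,_)
              (same-parabola r r′ (λ eq → <⇒≢ i<j (opposite-injective eq)) (proj₂ (Σ-≡ eq₁)) (proj₂ (Σ-≡ eq₂)))
        unique′ (true , r) (false , r′) i<j i′<j′ eq₁ eq₂ =
          ⊥-elim (reversed i<j i′<j′ (proj₁ (Σ-≡ eq₁)) (proj₁ (Σ-≡ eq₂)))
        unique′ (false , r) (true , r′) i<j i′<j′ eq₁ eq₂ =
          ⊥-elim (reversed i′<j′ i<j (sym (proj₁ (Σ-≡ eq₁))) (sym (proj₁ (Σ-≡ eq₂))))

        line≢parabola : ∀ r r′ {i j k i′ j′ k′} → i ≢ j → i ≢ k → j ≢ k →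
          point (true , r) i ≡ point (false , r′) i′ → point (true , r) j ≡ point (false , r′) j′ →
          point (true , r) k ≡ point (false , r′) k′ → ⊥
        line≢parabola r r′ i≢j i≢k j≢k eq₁ eq₂ eq₃ with Σ-≡ eq₁ | Σ-≡ eq₂ | Σ-≡ eq₃
        ... | refl , e₁ | refl , e₂ | refl , e₃ = line-meets-parabola i≢j i≢k j≢k r r′ e₁ e₂ e₃

        simple′ : ∀ b b′ {i j k i′ j′ k′} → i ≢ j → i ≢ k → j ≢ k → i′ ≢ j′ → i′ ≢ k′ → j′ ≢ k′ →
                  point b i ≡ point b′ i′ → point b j ≡ point b′ j′ → point b k ≡ point b′ k′ → b ≡ b′
        simple′ (true , r) (true , r′) i≢j _ _ _ _ _ eq₁ eq₂ _ with Σ-≡ eq₁ | Σ-≡ eq₂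
        ... | refl , e₁ | refl , e₂ = cong (true ,_) (form-injective i≢j r r′ e₁ e₂)
        simple′ (false , r) (false , r′) {i} {j} {_} {i′} {j′} i≢j _ _ _ _ _ eq₁ eq₂ _
          with opposite-injective {i} {i′} (proj₁ (Σ-≡ eq₁)) | opposite-injective {j} {j′} (proj₁ (Σ-≡ eq₂))
        ... | refl | refl = cong (false ,_)
              (same-parabola r r′ (λ eq → i≢j (opposite-injective eq)) (proj₂ (Σ-≡ eq₁)) (proj₂ (Σ-≡ eq₂)))
        simple′ (true , r) (false , r′) {i′ = i′} {j′} {k′} i≢j i≢k j≢k _ _ _ eq₁ eq₂ eq₃ =
          ⊥-elim (line≢parabola r r′ {i′ = i′} {j′} {k′} i≢j i≢k j≢k eq₁ eq₂ eq₃)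
        simple′ (false , r) (true , r′) {i} {j} {k} _ _ _ i≢j i≢k j≢k eq₁ eq₂ eq₃ =
          ⊥-elim (line≢parabola r′ r {i′ = i} {j} {k} i≢j i≢k j≢k (sym eq₁) (sym eq₂) (sym eq₃))

-- gcd(m, 6) = 1, witnessed by inverses of 2 and 3 modulo m.
record Coprime6 (m : ℕ) : Set where
  field
    half third third-quotient : ℕ
    2*half  : 2 * half ≡ 1 + 1 * m
    3*third : 3 * third ≡ 1 + third-quotient * m

module Modulo (m : ℕ) ⦃ _ : NonZero m ⦄ (coprime : Coprime6 m) where
  open Residues m
  open Coprime6 coprime
  open LinearTD isCommutativeSemiring ν x+νx≡0 Z↔Fin using (Unit; module Slopes)

  slope : Fin 5 → Z m
  slope c = ⟦ toℕ c ⟧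

  unit : ∀ a b k → a * b ≡ 1 + k * m → Unit ⟦ a ⟧
  unit a b k eq = ⟦ b ⟧ , trans (sym (⟦*⟧ a b)) (val-injective (trans (cong (_% m) eq) ([m+kn]%n≡m%n 1 k m)))

  unit-small : ∀ d → 1 ≤ d → d ≤ 4 → Unit ⟦ d ⟧
  unit-small 1 _ _ = unit 1 1 0 refl
  unit-small 2 _ _ = unit 2 half 1 2*half
  unit-small 3 _ _ = unit 3 third third-quotient 3*third
  unit-small 4 _ _ = unit 4 (half * half) (2 + m) (begin
    4 * (half * half)           ≡⟨ square half ⟩
    (2 * half) * (2 * half)     ≡⟨ cong₂ _*_ 2*half 2*half ⟩
    (1 + 1 * m) * (1 + 1 * m)   ≡⟨ expand m ⟩
    1 + (2 + m) * m             ∎)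
    where
    square : ∀ h → 4 * (h * h) ≡ (2 * h) * (2 * h)
    square = solve-∀
    expand : ∀ m → (1 + 1 * m) * (1 + 1 * m) ≡ 1 + (2 + m) * m
    expand = solve-∀
  unit-small (suc (suc (suc (suc (suc _))))) _ (s≤s (s≤s (s≤s (s≤s ()))))

  difference : ∀ a d → ⟦ a + d ⟧ +ᶻ ν *ᶻ ⟦ a ⟧ ≡ ⟦ d ⟧
  difference a d = trans (cong (_+ᶻ ν *ᶻ ⟦ a ⟧) (⟦+⟧ a d)) (add-subtract ⟦ a ⟧ ⟦ d ⟧)

  unit-difference : ∀ {c c′ : Fin 5} → c <ᶠ c′ → Unit (slope c′ +ᶻ ν *ᶻ slope c)
  unit-difference {c} {c′} c<c′ = subst Unit
    (trans (sym (difference (toℕ c) d)) (cong (λ a → ⟦ a ⟧ +ᶻ ν *ᶻ slope c) (m+[n∸m]≡n (<⇒≤ c<c′))))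
    (unit-small d (m<n⇒0<n∸m c<c′) (≤-trans (m∸n≤m (toℕ c′) (toℕ c)) (≤-pred (toℕ<n c′))))
    where d = toℕ c′ ∸ toℕ c

  -- Among the moduli coprime to 6 the bound excludes only m = 1, where all five slopes coincide.
  slope-injective : 5 ≤ m → ∀ {c c′} → slope c ≡ slope c′ → c ≡ c′
  slope-injective 5≤m {c} {c′} eq = toℕ-injective (trans (sym (small c)) (trans (cong val eq) (small c′)))
    where
    small : ∀ c → toℕ {5} c % m ≡ toℕ c
    small c = m<n⇒m%n≡m (≤-trans (toℕ<n c) 5≤m)

  open Slopes slope unit-difference public using (td₆; module Parabolas)

-- Inflation of a design, and difference matrices

regroup : ∀ {k} {Q Q′ : Fin k → Set} → (∀ c → Q c ↔ Q′ c) → GDD k Q → GDD k Q′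
regroup f D = transport D
  (mk↔ₛ′ (λ (c , q) → c , to (f c) q) (λ (c , q) → c , from (f c) q)
         (λ (c , q) → cong (c ,_) (strictlyInverseˡ (f c) q)) (λ (c , q) → cong (c ,_) (strictlyInverseʳ (f c) q)))
  (λ c≢c′ → c≢c′) (λ c≢c′ → c≢c′)
  where open Inverse

module Inflate {P : Set} {R : P → P → Set} {m : ℕ} (D : Design P R) (irreflexive : ∀ {x} → ¬ R x x) (T : TD 5 m) where

  pt-injective : ∀ b {i j} → pt D b i ≡ pt D b j → i ≡ j
  pt-injective b {i} {j} eq with i ≟ j
  ... | yes i≡j = i≡j
  ... | no  i≢j = contradiction (subst (R (pt D b i)) (sym eq) (sound D b i≢j)) irreflexive

  ,-≡ : ∀ {A B : Set} {a a′ : A} {b b′ : B} → (a , b) ≡ (a′ , b′) → a ≡ a′ × b ≡ b′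
  ,-≡ refl = refl , refl

  -- Column `i` of the TD lies over position `i` of the block, so the order inside a block is
  -- inherited. Blocks sharing three points project to blocks of `D` sharing three points; these are
  -- equal, and then two common points already determine the row.
  inflate : Design (P × Fin m) (λ x y → R (proj₁ x) (proj₁ y))
  inflate .Blk = Blk D × Row T
  inflate .pt (b , r) i = pt D b i , at T r i
  inflate .sound (b , _) = sound D b
  inflate .cover {_ , u} {_ , v} rel with cover D rel
  ... | b , i , j , i<j , refl , refl with join T (<⇒≢ i<j) u v
  ... | r , refl , refl = (b , r) , i , j , i<j , refl , refl
  inflate .unique (b , r) (b′ , r′) {i} {j} {i′} {j′} i<j i′<j′ eq₁ eq₂
    with unique D b b′ i<j i′<j′ (proj₁ (,-≡ eq₁)) (proj₁ (,-≡ eq₂))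
  ... | refl with pt-injective b (proj₁ (,-≡ eq₁)) | pt-injective b (proj₁ (,-≡ eq₂))
  ... | refl | refl = cong (b ,_) (meet T (<⇒≢ i<j) r r′ (proj₂ (,-≡ eq₁)) (proj₂ (,-≡ eq₂)))
  inflate .simple (b , r) (b′ , r′) i≢j i≢k j≢k i′≢j′ i′≢k′ j′≢k′ eq₁ eq₂ eq₃
    with simple D b b′ i≢j i≢k j≢k i′≢j′ i′≢k′ j′≢k′ (proj₁ (,-≡ eq₁)) (proj₁ (,-≡ eq₂)) (proj₁ (,-≡ eq₃))
  ... | refl with pt-injective b (proj₁ (,-≡ eq₁)) | pt-injective b (proj₁ (,-≡ eq₂))
  ... | refl | refl = cong (b ,_) (meet T i≢j r r′ (proj₂ (,-≡ eq₁)) (proj₂ (,-≡ eq₂)))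

inflate : ∀ {k m} {Q : Fin k → Set} → GDD k Q → TD 5 m → GDD k (λ c → Q c × Fin m)
inflate D T = transport (Inflate.inflate D (λ c≢c → c≢c refl) T)
  (mk↔ₛ′ (λ ((c , q) , a) → c , q , a) (λ (c , q , a) → (c , q) , a) (λ _ → refl) (λ _ → refl))
  (λ c≢c′ → c≢c′) (λ c≢c′ → c≢c′)

dropColumn : ∀ {k m} → TD (suc k) m → TD k m
dropColumn T = record
  { Row  = Row T
  ; at   = λ r c → at T r (suc c)
  ; join = λ c≢c′ → join T (λ eq → c≢c′ (suc-injective eq))
  ; meet = λ c≢c′ → meet T (λ eq → c≢c′ (suc-injective eq))
  }

-- The TD of a difference matrix over (ℤ/p)ᵈ, whose elements are written in base p.
module DifferenceMatrix (p d m j : ℕ) ⦃ _ : NonZero p ⦄ ⦃ _ : NonZero m ⦄ (matrix : Vec (Vec ℕ m) j) where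

  plus : ℕ → ℕ → ℕ → ℕ
  plus zero    x y = 0
  plus (suc e) x y = (x % p + y % p) % p + p * plus e (x / p) (y / p)

  -- Row `(x , y)` is column `y` of the matrix translated by `x`, preceded by `y` itself. If the
  -- difference of any two rows of the matrix is a permutation, any two of the `suc j` columns
  -- determine the row.
  entry : Fin m × Fin m → Fin (suc j) → Fin m
  entry (x , y) zero    = y
  entry (x , y) (suc s) = plus d (toℕ x) (Vec.lookup (Vec.lookup matrix s) y) mod m

  Query : Set
  Query = Fin (suc j) × Fin (suc j) × Fin m × Fin m

  -- Multiplication by a constant near the golden section of the modulus keeps the search tree balanced.
  code : Query → ℕ
  code (c , c′ , u , v) = (((toℕ c * suc j + toℕ c′) * m + toℕ u) * m + toℕ v) * 618033 % 1000003

  query : Fin (suc j) → Fin (suc j) → Fin m × Fin m → Query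
  query c c′ r = c , c′ , entry r c , entry r c′

  rows : List (Fin m × Fin m)
  rows = cartesianProduct (List.allFin m) (List.allFin m)

  insertAll : List ((Fin (suc j) × Fin (suc j)) × Fin m × Fin m) → Tree (Fin m × Fin m)
  insertAll [] = leaf
  insertAll (((c , c′) , r) ∷ qs) = insert (code (query c c′ r)) r (insertAll qs)

  table : Tree (Fin m × Fin m)
  table = insertAll (cartesianProduct (cartesianProduct (List.allFin (suc j)) (List.allFin (suc j))) rows)

  row-≟ : (r r′ : Fin m × Fin m) → Dec (r ≡ r′)
  row-≟ = ≡-dec _≟_ _≟_

  -- Success of `meets` means that a row is recovered from its entries in two columns, hence
  -- uniqueness; success of `joins` means that each prescribed pair of entries has a row, hence
  -- existence.
  module Check (t : Tree (Fin m × Fin m)) where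

    meets : Fin (suc j) → Fin (suc j) → Fin m × Fin m → Maybe (Fin m × Fin m) → Bool
    meets c c′ r nothing   = false
    meets c c′ r (just r′) = does (row-≟ r′ r)

    joins : Fin (suc j) → Fin (suc j) → Fin m → Fin m → Maybe (Fin m × Fin m) → Bool
    joins c c′ u v nothing  = false
    joins c c′ u v (just r) = does (entry r c ≟ u ×-dec entry r c′ ≟ v)

    good : Fin (suc j) → Fin (suc j) → Fin m → Fin m → Bool
    good c c′ x y = if does (c ≟ c′) then true else
      meets c c′ (x , y) (search (code (query c c′ (x , y))) t) ∧ joins c c′ x y (search (code (c , c′ , x , y)) t)

    check : Bool
    check = all (suc j) λ c → all (suc j) λ c′ → all m λ x → all m λ y → good c c′ x y

  verify : Bool
  verify = Check.check table

  module Sound (t : Tree (Fin m × Fin m)) (ok : Check.check t ≡ true) where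
    open Check t

    good-ok : ∀ c c′ x y → good c c′ x y ≡ true
    good-ok c c′ x y = all-sound m (good c c′ x) (all-sound m (λ x → all m (good c c′ x))
      (all-sound (suc j) (λ c′ → all m λ x → all m (good c c′ x))
        (all-sound (suc j) (λ c → all (suc j) λ c′ → all m λ x → all m (good c c′ x)) ok c) c′) x) y

    both : ∀ {c c′} → c ≢ c′ → ∀ x y →
           meets c c′ (x , y) (search (code (query c c′ (x , y))) t) ≡ true ×
           joins c c′ x y (search (code (c , c′ , x , y)) t) ≡ true
    both {c} {c′} c≢c′ x y with c ≟ c′ | good-ok c c′ x y
    ... | yes c≡c′ | _  = contradiction c≡c′ c≢c′
    ... | no _     | eq = ∧-true eq

    found : ∀ {c c′} r m → meets c c′ r m ≡ true → m ≡ just r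
    found r (just r′) eq = cong just (does-sound (row-≟ r′ r) eq)

    td : TD (suc j) m
    td .Row = Fin m × Fin m
    td .at  = entry
    td .join {c} {c′} c≢c′ u v with search (code (c , c′ , u , v)) t | proj₂ (both c≢c′ u v)
    ... | just r | eq = r , does-sound (entry r c ≟ u ×-dec entry r c′ ≟ v) eq
    td .meet {c} {c′} c≢c′ r@(x , y) r′@(x′ , y′) eq₁ eq₂ = just-injective (begin
      just r                            ≡⟨ found {c} {c′} r _ (proj₁ (both c≢c′ x y)) ⟨
      search (code (query c c′ r)) t    ≡⟨ cong₂ (λ u v → search (code (c , c′ , u , v)) t) eq₁ eq₂ ⟩
      search (code (query c c′ r′)) t   ≡⟨ found {c} {c′} r′ _ (proj₁ (both c≢c′ x′ y′)) ⟩
      just r′                           ∎)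

  fromMatrix : verify ≡ true → TD (suc j) m
  fromMatrix = Sound.td table

-- Truncated and inflated transversal designs

Ingredient : ℕ → ℕ → Set₁
Ingredient w h = GDD 6 (Fin ∘ sizes 5 w h)

-- A row through a point of weight 0 involves only five groups; an empty sixth group lets it be
-- treated like all other rows.
addEmpty : ∀ {w} → GDD 5 (λ _ → Fin w) → Ingredient w 0
addEmpty {w} D = transport D shift-groups
  (λ { c≢c′ refl → c≢c′ refl }) (λ { {suc _ , _} {suc _ , _} c≢c′ refl → c≢c′ refl })
  where
  shift-groups : Σ (Fin 5) (λ _ → Fin w) ↔ Σ (Fin 6) (Fin ∘ sizes 5 w 0)
  shift-groups = mk↔ₛ′ shift unshift (λ { (suc c , p) → refl }) (λ _ → refl)
    where
    shift : Σ (Fin 5) (λ _ → Fin w) → Σ (Fin 6) (Fin ∘ sizes 5 w 0)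
    shift (c , p) = suc c , p
    unshift : Σ (Fin 6) (Fin ∘ sizes 5 w 0) → Σ (Fin 5) (λ _ → Fin w)
    unshift (suc c , p) = c , p

fromEqualSizes : ∀ {k w} → GDD (suc k) (Fin ∘ sizes k w w) → GDD (suc k) (λ _ → Fin w)
fromEqualSizes = regroup λ { zero → ↔-refl ; (suc _) → ↔-refl }

equalSizes : ∀ {w} → GDD 6 (λ _ → Fin w) → Ingredient w w
equalSizes = regroup λ { zero → ↔-refl ; (suc _) → ↔-refl }

module Truncate {m : ℕ} (T : TD 6 m) (w : ℕ) (h : Fin m → ℕ) where

  weight : Fin 6 → Fin m → ℕ
  weight zero    = h
  weight (suc _) = λ _ → w

  truncate : (∀ a → Ingredient w (h a)) → GDD 6 (λ c → Σ (Fin m) λ a → Fin (weight c a))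
  truncate D = wilson T weight λ r → regroup (λ { zero → ↔-refl ; (suc _) → ↔-refl }) (D (at T r zero))

  groupSize : Fin 6 → ℕ
  groupSize zero    = total m h
  groupSize (suc _) = m * w

  group↔Fin : ∀ c → (Σ (Fin m) λ a → Fin (weight c a)) ↔ Fin (groupSize c)
  group↔Fin zero    = Σ↔Fin m h (λ _ → ↔-refl)
  group↔Fin (suc _) = ↔-sym *↔×

open Truncate using (truncate; groupSize; group↔Fin)

steps : ℕ → ℕ → ℕ → ℕ → (m : ℕ) → Fin m → ℕ
steps zero    zero    x y _       _       = 0
steps (suc p) q       x y _       zero    = x
steps (suc p) q       x y (suc m) (suc a) = steps p q x y m a
steps zero    (suc q) x y _       zero    = y
steps zero    (suc q) x y (suc m) (suc a) = steps zero q x y m a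

total-steps : ∀ p q x y m → p + q ≤ m → total m (steps p q x y m) ≡ p * x + q * y
total-steps (suc p) q       x y (suc m) (s≤s le) = trans (cong (x +_) (total-steps p q x y m le)) (sym (+-assoc x (p * x) (q * y)))
total-steps zero    (suc q) x y (suc m) (s≤s le) = cong (y +_) (total-steps zero q x y m le)
total-steps zero    zero    x y zero    _        = refl
total-steps zero    zero    x y (suc m) _        = total-steps zero zero x y m z≤n

steps-elim : ∀ (P : ℕ → Set₁) p q x y m → P x → P y → P 0 → ∀ a → P (steps p q x y m a)
steps-elim P (suc p) q       x y (suc m) px py p0 zero    = px
steps-elim P (suc p) q       x y (suc m) px py p0 (suc a) = steps-elim P p q x y m px py p0 a
steps-elim P zero    (suc q) x y (suc m) px py p0 zero    = py
steps-elim P zero    (suc q) x y (suc m) px py p0 (suc a) = steps-elim P zero q x y m px py p0 a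
steps-elim P zero    zero    x y (suc m) px py p0 a       = p0

truncated-TD : ∀ {m} → TD 6 m → ∀ w (h : Fin m → ℕ) → (∀ a → Ingredient w (h a)) →
               DD (m * w + 1) → DD (total m h + 1) → DD (total m h + 5 * (m * w) + 1)
truncated-TD T w h D E F = fill-DD 1 (groupSize T w h) (group↔Fin T w h) (truncate T w h D) λ where
  zero    → F
  (suc _) → E

truncated-TD-steps : ∀ {m} → TD 6 m → ∀ w {x y} p q → p + q ≤ m →
  Ingredient w x → Ingredient w y → Ingredient w 0 →
  DD (m * w + 1) → DD (p * x + q * y + 1) → DD (p * x + q * y + 5 * (m * w) + 1)
truncated-TD-steps {m} T w {x} {y} p q p+q≤m D₁ D₂ D₀ E F =
  subst (λ t → DD (t + 5 * (m * w) + 1)) (total-steps p q x y m p+q≤m)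
    (truncated-TD T w (steps p q x y m) (steps-elim (Ingredient w) p q x y m D₁ D₂ D₀) E
      (subst (λ t → DD (t + 1)) (sym (total-steps p q x y m p+q≤m)) F))

-- The truncated group is the one filled completely, and it alone covers the pairs of the `h` new
-- points.
truncated-TD-hole : ∀ {m} → TD 6 m → ∀ w h (g : Fin m → ℕ) → (∀ a → Ingredient w (g a)) →
  Incomplete (Fin (m * w)) (Fin h) → DD (total m g + h) → DD (total m g + 5 * (m * w) + h)
truncated-TD-hole T w h g D E F =
  fill-hole-DD (groupSize T w g) (group↔Fin T w g) (truncate T w g D) F λ _ → E

inflated : ∀ {k m} w h {h≤1 : True (h ≤? 1)} → GDD (suc k) (λ _ → Fin w) → TD 5 m →
           DD (w * m + h) → DD (total (suc k) (λ _ → w * m) + h)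
inflated w h {h≤1} D T E = fill-DD h _ {h≤1} (λ _ → ↔-sym *↔×) (inflate D T) (λ _ → E)

inflated-hole : ∀ {k m} w h → GDD (suc k) (λ _ → Fin w) → TD 5 m → DD (w * m + h) →
                Incomplete (Fin (w * m)) (Fin h) → DD (total (suc k) (λ _ → w * m) + h)
inflated-hole w h D T F E = fill-hole-DD _ (λ _ → ↔-sym *↔×) (inflate D T) F (λ _ → E)

fill-uniform : ∀ {k w} h {h≤1 : True (h ≤? 1)} → GDD (suc k) (λ _ → Fin w) → DD (w + h) → DD (total (suc k) (λ _ → w) + h)
fill-uniform h {h≤1} D E = fill-DD h _ {h≤1} (λ _ → ↔-refl) D (λ _ → E)

dd-1 : DD 1
dd-1 = record
  { Blk = ⊥ ; pt = λ () ; sound = λ ()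
  ; cover = λ { {zero} {zero} x≢y → contradiction refl x≢y }
  ; unique = λ () ; simple = λ () }

td₆ : ∀ {m} ⦃ _ : NonZero m ⦄ → Coprime6 m → TD 6 m
td₆ {m} coprime = Modulo.td₆ m coprime

twoTD : ∀ {m} ⦃ _ : NonZero m ⦄ → Coprime6 m → {5≤m : True (5 ≤? m)} → GDD 5 (λ _ → Fin m)
twoTD {m} coprime {5≤m} = regroup (λ _ → Z↔Fin) (Modulo.Parabolas.lines+parabolas m coprime (Modulo.slope-injective m coprime (toWitness 5≤m)))

coprime₁ : ∀ j → Coprime6 (1 + j * 6)
coprime₁ j = record { half = 1 + j * 3 ; third = 1 + j * 4 ; third-quotient = 2 ; 2*half = half j ; 3*third = third j }
  where
  half : ∀ j → 2 * (1 + j * 3) ≡ 1 + 1 * (1 + j * 6)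
  half = solve-∀
  third : ∀ j → 3 * (1 + j * 4) ≡ 1 + 2 * (1 + j * 6)
  third = solve-∀

coprime₅ : ∀ j → Coprime6 (5 + j * 6)
coprime₅ j = record { half = 3 + j * 3 ; third = 2 + j * 2 ; third-quotient = 1 ; 2*half = half j ; 3*third = third j }
  where
  half : ∀ j → 2 * (3 + j * 3) ≡ 1 + 1 * (5 + j * 6)
  half = solve-∀
  third : ∀ j → 3 * (2 + j * 2) ≡ 1 + 1 * (5 + j * 6)
  third = solve-∀

-- Difference matrices of orders 4, 8, 9, 15 and 16

-- The multiplication table of the field with 4 elements, polynomials in x being coded by their
-- digits. The matrices of orders 8, 9 and 16 consist of the multiples by the elements coded 0 to 4,
-- with x³ = x + 1, x² = x + 1 and x⁴ = x + 1 respectively. A difference of two rows is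
-- multiplication by a nonzero element, hence a permutation.
matrix-5-4 : Vec (Vec ℕ 4) 4
matrix-5-4 =
  (0 ∷ 0 ∷ 0 ∷ 0 ∷ []) ∷
  (0 ∷ 1 ∷ 2 ∷ 3 ∷ []) ∷
  (0 ∷ 2 ∷ 3 ∷ 1 ∷ []) ∷
  (0 ∷ 3 ∷ 1 ∷ 2 ∷ []) ∷
  []

td-5-4 : TD 5 4
td-5-4 = DifferenceMatrix.fromMatrix 2 2 4 4 matrix-5-4 refl

matrix-6-8 : Vec (Vec ℕ 8) 5
matrix-6-8 =
  (0 ∷ 0 ∷ 0 ∷ 0 ∷ 0 ∷ 0 ∷ 0 ∷ 0 ∷ []) ∷
  (0 ∷ 1 ∷ 2 ∷ 3 ∷ 4 ∷ 5 ∷ 6 ∷ 7 ∷ []) ∷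
  (0 ∷ 2 ∷ 4 ∷ 6 ∷ 3 ∷ 1 ∷ 7 ∷ 5 ∷ []) ∷
  (0 ∷ 3 ∷ 6 ∷ 5 ∷ 7 ∷ 4 ∷ 1 ∷ 2 ∷ []) ∷
  (0 ∷ 4 ∷ 3 ∷ 7 ∷ 6 ∷ 2 ∷ 5 ∷ 1 ∷ []) ∷
  []

td-6-8 : TD 6 8
td-6-8 = DifferenceMatrix.fromMatrix 2 3 8 5 matrix-6-8 refl

matrix-6-9 : Vec (Vec ℕ 9) 5
matrix-6-9 =
  (0 ∷ 0 ∷ 0 ∷ 0 ∷ 0 ∷ 0 ∷ 0 ∷ 0 ∷ 0 ∷ []) ∷
  (0 ∷ 1 ∷ 2 ∷ 3 ∷ 4 ∷ 5 ∷ 6 ∷ 7 ∷ 8 ∷ []) ∷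
  (0 ∷ 2 ∷ 1 ∷ 6 ∷ 8 ∷ 7 ∷ 3 ∷ 5 ∷ 4 ∷ []) ∷
  (0 ∷ 3 ∷ 6 ∷ 4 ∷ 7 ∷ 1 ∷ 8 ∷ 2 ∷ 5 ∷ []) ∷
  (0 ∷ 4 ∷ 8 ∷ 7 ∷ 2 ∷ 3 ∷ 5 ∷ 6 ∷ 1 ∷ []) ∷
  []

td-6-9 : TD 6 9
td-6-9 = DifferenceMatrix.fromMatrix 3 2 9 5 matrix-6-9 refl

-- No field has order 15; this is a difference matrix over ℤ/15. Its rows are odd functions of the
-- column index modulo 15.
matrix-6-15 : Vec (Vec ℕ 15) 5
matrix-6-15 =
  (0 ∷ 0 ∷ 0 ∷ 0 ∷ 0 ∷ 0 ∷ 0 ∷ 0 ∷ 0 ∷ 0 ∷ 0 ∷ 0 ∷ 0 ∷ 0 ∷ 0 ∷ []) ∷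
  (0 ∷ 1 ∷ 2 ∷ 3 ∷ 4 ∷ 5 ∷ 6 ∷ 7 ∷ 8 ∷ 9 ∷ 10 ∷ 11 ∷ 12 ∷ 13 ∷ 14 ∷ []) ∷
  (0 ∷ 2 ∷ 5 ∷ 7 ∷ 9 ∷ 12 ∷ 4 ∷ 1 ∷ 14 ∷ 11 ∷ 3 ∷ 6 ∷ 8 ∷ 10 ∷ 13 ∷ []) ∷
  (0 ∷ 6 ∷ 3 ∷ 14 ∷ 10 ∷ 7 ∷ 13 ∷ 4 ∷ 11 ∷ 2 ∷ 8 ∷ 5 ∷ 1 ∷ 12 ∷ 9 ∷ []) ∷
  (0 ∷ 10 ∷ 6 ∷ 1 ∷ 11 ∷ 2 ∷ 7 ∷ 12 ∷ 3 ∷ 8 ∷ 13 ∷ 4 ∷ 14 ∷ 9 ∷ 5 ∷ []) ∷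
  []

td-6-15 : TD 6 15
td-6-15 = DifferenceMatrix.fromMatrix 15 1 15 5 matrix-6-15 refl

matrix-6-16 : Vec (Vec ℕ 16) 5
matrix-6-16 =
  (0 ∷ 0 ∷ 0 ∷ 0 ∷ 0 ∷ 0 ∷ 0 ∷ 0 ∷ 0 ∷ 0 ∷ 0 ∷ 0 ∷ 0 ∷ 0 ∷ 0 ∷ 0 ∷ []) ∷
  (0 ∷ 1 ∷ 2 ∷ 3 ∷ 4 ∷ 5 ∷ 6 ∷ 7 ∷ 8 ∷ 9 ∷ 10 ∷ 11 ∷ 12 ∷ 13 ∷ 14 ∷ 15 ∷ []) ∷
  (0 ∷ 2 ∷ 4 ∷ 6 ∷ 8 ∷ 10 ∷ 12 ∷ 14 ∷ 3 ∷ 1 ∷ 7 ∷ 5 ∷ 11 ∷ 9 ∷ 15 ∷ 13 ∷ []) ∷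
  (0 ∷ 3 ∷ 6 ∷ 5 ∷ 12 ∷ 15 ∷ 10 ∷ 9 ∷ 11 ∷ 8 ∷ 13 ∷ 14 ∷ 7 ∷ 4 ∷ 1 ∷ 2 ∷ []) ∷
  (0 ∷ 4 ∷ 8 ∷ 12 ∷ 3 ∷ 7 ∷ 11 ∷ 15 ∷ 6 ∷ 2 ∷ 14 ∷ 10 ∷ 5 ∷ 1 ∷ 13 ∷ 9 ∷ []) ∷
  []

td-6-16 : TD 6 16
td-6-16 = DifferenceMatrix.fromMatrix 2 4 16 5 matrix-6-16 refl

-- Base blocks of the explicit designs

⟨_,_,_,_,_⟩ : ℕ → ℕ → ℕ → ℕ → ℕ → Vec ℕ 5
⟨ a , b , c , d , e ⟩ = a ∷ b ∷ c ∷ d ∷ e ∷ []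

-- gdd-w-k has type wᵏ, gdd-w-k-h has type wᵏh¹, and incomplete-v is a design on v points with a hole of size 5.

base-4-5 : Vec (Vec ℕ 5) 32
base-4-5 =
  ⟨ 0 , 1 , 2 , 3 , 4 ⟩ ∷ ⟨ 5 , 1 , 7 , 13 , 19 ⟩ ∷ ⟨ 10 , 1 , 12 , 18 , 9 ⟩ ∷ ⟨ 15 , 1 , 17 , 8 , 14 ⟩ ∷
  ⟨ 0 , 6 , 7 , 8 , 9 ⟩ ∷ ⟨ 5 , 6 , 2 , 18 , 14 ⟩ ∷ ⟨ 10 , 6 , 17 , 13 , 4 ⟩ ∷ ⟨ 15 , 6 , 12 , 3 , 19 ⟩ ∷
  ⟨ 0 , 11 , 12 , 13 , 14 ⟩ ∷ ⟨ 5 , 11 , 17 , 3 , 9 ⟩ ∷ ⟨ 10 , 11 , 2 , 8 , 19 ⟩ ∷ ⟨ 15 , 11 , 7 , 18 , 4 ⟩ ∷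
  ⟨ 0 , 16 , 17 , 18 , 19 ⟩ ∷ ⟨ 5 , 16 , 12 , 8 , 4 ⟩ ∷ ⟨ 10 , 16 , 7 , 3 , 14 ⟩ ∷ ⟨ 15 , 16 , 2 , 13 , 9 ⟩ ∷
  ⟨ 14 , 18 , 7 , 1 , 0 ⟩ ∷ ⟨ 9 , 8 , 2 , 1 , 5 ⟩ ∷ ⟨ 19 , 3 , 17 , 1 , 10 ⟩ ∷ ⟨ 4 , 13 , 12 , 1 , 15 ⟩ ∷
  ⟨ 19 , 13 , 2 , 6 , 0 ⟩ ∷ ⟨ 4 , 3 , 7 , 6 , 5 ⟩ ∷ ⟨ 14 , 8 , 12 , 6 , 10 ⟩ ∷ ⟨ 9 , 18 , 17 , 6 , 15 ⟩ ∷
  ⟨ 4 , 8 , 17 , 11 , 0 ⟩ ∷ ⟨ 19 , 18 , 12 , 11 , 5 ⟩ ∷ ⟨ 9 , 13 , 7 , 11 , 10 ⟩ ∷ ⟨ 14 , 3 , 2 , 11 , 15 ⟩ ∷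
  ⟨ 9 , 3 , 12 , 16 , 0 ⟩ ∷ ⟨ 14 , 13 , 17 , 16 , 5 ⟩ ∷ ⟨ 4 , 18 , 2 , 16 , 10 ⟩ ∷ ⟨ 19 , 8 , 7 , 16 , 15 ⟩ ∷ []

-- Lines and parabolas again, now over the field with 4 elements and with slope ∞ as the first
-- group: 16 lines listed forward, 16 curves x + cy + c² listed backward. Squaring is injective in
-- characteristic 2, so a line and a curve that agree at ∞ meet in only one further point.
gdd-4-5 : GDD 5 (λ _ → Fin 4)
gdd-4-5 = CyclicDesign.gdd 1 20 0 (λ _ → 4) 0 5 1 base-4-5 refl

base-4-5-2 : Vec (Vec ℕ 5) 8
base-4-5-2 =
  ⟨ 0 , 3 , 17 , 9 , 16 ⟩ ∷ ⟨ 13 , 19 , 20 , 11 , 15 ⟩ ∷ ⟨ 8 , 1 , 9 , 10 , 12 ⟩ ∷ ⟨ 13 , 4 , 21 , 12 , 1 ⟩ ∷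
  ⟨ 12 , 15 , 13 , 9 , 6 ⟩ ∷ ⟨ 18 , 16 , 0 , 12 , 4 ⟩ ∷ ⟨ 6 , 2 , 20 , 9 , 3 ⟩ ∷ ⟨ 7 , 18 , 21 , 6 , 15 ⟩ ∷ []

gdd-4-5-2 : GDD 6 (Fin ∘ sizes 5 4 2)
gdd-4-5-2 = CyclicDesign.gdd 5 4 2 (sizes 5 4 2) 1 5 1 base-4-5-2 refl

base-4-6 : Vec (Vec ℕ 5) 2
base-4-6 =
  ⟨ 7 , 3 , 6 , 20 , 4 ⟩ ∷ ⟨ 8 , 12 , 17 , 3 , 19 ⟩ ∷ []

gdd-4-6 : GDD 6 (λ _ → Fin 4)
gdd-4-6 = CyclicDesign.gdd 24 1 0 (λ _ → 4) 0 6 1 base-4-6 refl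

base-10-5 : Vec (Vec ℕ 5) 40
base-10-5 =
  ⟨ 31 , 42 , 19 , 0 , 43 ⟩ ∷ ⟨ 45 , 17 , 28 , 36 , 29 ⟩ ∷ ⟨ 13 , 20 , 14 , 36 , 42 ⟩ ∷
  ⟨ 40 , 4 , 7 , 16 , 23 ⟩ ∷ ⟨ 33 , 22 , 24 , 20 , 1 ⟩ ∷ ⟨ 1 , 49 , 23 , 32 , 5 ⟩ ∷
  ⟨ 5 , 46 , 24 , 27 , 23 ⟩ ∷ ⟨ 12 , 10 , 16 , 48 , 14 ⟩ ∷ ⟨ 43 , 27 , 31 , 24 , 30 ⟩ ∷
  ⟨ 6 , 0 , 4 , 38 , 2 ⟩ ∷ ⟨ 2 , 10 , 31 , 34 , 28 ⟩ ∷ ⟨ 44 , 35 , 26 , 7 , 43 ⟩ ∷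
  ⟨ 24 , 38 , 12 , 15 , 46 ⟩ ∷ ⟨ 21 , 9 , 28 , 25 , 47 ⟩ ∷ ⟨ 31 , 10 , 33 , 47 , 29 ⟩ ∷
  ⟨ 22 , 39 , 46 , 8 , 45 ⟩ ∷ ⟨ 42 , 21 , 13 , 40 , 39 ⟩ ∷ ⟨ 22 , 19 , 13 , 30 , 6 ⟩ ∷
  ⟨ 5 , 9 , 43 , 11 , 7 ⟩ ∷ ⟨ 17 , 14 , 1 , 25 , 8 ⟩ ∷ ⟨ 7 , 38 , 25 , 11 , 4 ⟩ ∷
  ⟨ 27 , 16 , 19 , 20 , 18 ⟩ ∷ ⟨ 37 , 26 , 14 , 38 , 20 ⟩ ∷ ⟨ 7 , 8 , 30 , 19 , 36 ⟩ ∷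
  ⟨ 28 , 4 , 41 , 10 , 27 ⟩ ∷ ⟨ 48 , 17 , 34 , 6 , 30 ⟩ ∷ ⟨ 25 , 31 , 2 , 14 , 3 ⟩ ∷
  ⟨ 26 , 29 , 8 , 47 , 40 ⟩ ∷ ⟨ 25 , 32 , 18 , 36 , 39 ⟩ ∷ ⟨ 49 , 43 , 46 , 17 , 0 ⟩ ∷
  ⟨ 1 , 19 , 40 , 22 , 28 ⟩ ∷ ⟨ 45 , 3 , 9 , 12 , 21 ⟩ ∷ ⟨ 49 , 40 , 38 , 1 , 47 ⟩ ∷
  ⟨ 16 , 3 , 44 , 17 , 45 ⟩ ∷ ⟨ 36 , 22 , 43 , 40 , 34 ⟩ ∷ ⟨ 38 , 35 , 6 , 32 , 19 ⟩ ∷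
  ⟨ 4 , 48 , 36 , 32 , 35 ⟩ ∷ ⟨ 18 , 32 , 14 , 40 , 6 ⟩ ∷ ⟨ 38 , 14 , 22 , 0 , 16 ⟩ ∷
  ⟨ 32 , 49 , 41 , 45 , 13 ⟩ ∷ []

-- The group ℤ/5 has ten orbits and permutes the five groups of points cyclically.
gdd-10-5 : GDD 5 (λ _ → Fin 10)
gdd-10-5 = CyclicDesign.gdd 5 10 0 (λ _ → 10) 0 5 1 base-10-5 refl

base-10-5-4 : Vec (Vec ℕ 5) 48
base-10-5-4 =
  ⟨ 11 , 29 , 52 , 23 , 32 ⟩ ∷ ⟨ 28 , 19 , 10 , 36 , 37 ⟩ ∷ ⟨ 44 , 30 , 27 , 6 , 43 ⟩ ∷
  ⟨ 2 , 25 , 21 , 13 , 19 ⟩ ∷ ⟨ 21 , 38 , 32 , 0 , 50 ⟩ ∷ ⟨ 30 , 46 , 42 , 39 , 52 ⟩ ∷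
  ⟨ 49 , 18 , 21 , 5 , 51 ⟩ ∷ ⟨ 47 , 3 , 4 , 1 , 40 ⟩ ∷ ⟨ 44 , 50 , 22 , 48 , 26 ⟩ ∷
  ⟨ 26 , 43 , 40 , 24 , 32 ⟩ ∷ ⟨ 47 , 46 , 30 , 14 , 38 ⟩ ∷ ⟨ 53 , 23 , 4 , 11 , 25 ⟩ ∷
  ⟨ 14 , 50 , 37 , 40 , 1 ⟩ ∷ ⟨ 37 , 35 , 6 , 3 , 39 ⟩ ∷ ⟨ 45 , 53 , 16 , 9 , 32 ⟩ ∷
  ⟨ 3 , 27 , 45 , 46 , 24 ⟩ ∷ ⟨ 37 , 21 , 9 , 10 , 18 ⟩ ∷ ⟨ 14 , 8 , 10 , 46 , 32 ⟩ ∷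
  ⟨ 41 , 19 , 35 , 23 , 42 ⟩ ∷ ⟨ 36 , 15 , 33 , 27 , 53 ⟩ ∷ ⟨ 3 , 52 , 19 , 5 , 47 ⟩ ∷
  ⟨ 10 , 7 , 21 , 24 , 23 ⟩ ∷ ⟨ 43 , 27 , 51 , 31 , 49 ⟩ ∷ ⟨ 28 , 27 , 5 , 1 , 39 ⟩ ∷
  ⟨ 51 , 11 , 15 , 44 , 2 ⟩ ∷ ⟨ 34 , 46 , 35 , 27 , 48 ⟩ ∷ ⟨ 43 , 12 , 11 , 45 , 14 ⟩ ∷
  ⟨ 3 , 37 , 30 , 11 , 51 ⟩ ∷ ⟨ 4 , 5 , 36 , 13 , 32 ⟩ ∷ ⟨ 9 , 7 , 48 , 6 , 40 ⟩ ∷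
  ⟨ 31 , 30 , 22 , 13 , 9 ⟩ ∷ ⟨ 15 , 41 , 18 , 17 , 49 ⟩ ∷ ⟨ 22 , 53 , 38 , 45 , 44 ⟩ ∷
  ⟨ 46 , 19 , 50 , 8 , 12 ⟩ ∷ ⟨ 39 , 16 , 43 , 10 , 17 ⟩ ∷ ⟨ 52 , 28 , 12 , 41 , 0 ⟩ ∷
  ⟨ 1 , 32 , 9 , 28 , 15 ⟩ ∷ ⟨ 14 , 3 , 41 , 7 , 53 ⟩ ∷ ⟨ 51 , 38 , 6 , 24 , 27 ⟩ ∷
  ⟨ 19 , 25 , 11 , 27 , 28 ⟩ ∷ ⟨ 42 , 5 , 6 , 28 , 4 ⟩ ∷ ⟨ 1 , 23 , 47 , 19 , 0 ⟩ ∷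
  ⟨ 23 , 9 , 17 , 52 , 36 ⟩ ∷ ⟨ 22 , 34 , 40 , 43 , 36 ⟩ ∷ ⟨ 37 , 48 , 24 , 46 , 25 ⟩ ∷
  ⟨ 31 , 18 , 24 , 2 , 20 ⟩ ∷ ⟨ 29 , 5 , 50 , 17 , 31 ⟩ ∷ ⟨ 31 , 33 , 17 , 0 , 34 ⟩ ∷ []

gdd-10-5-4 : GDD 6 (Fin ∘ sizes 5 10 4)
gdd-10-5-4 = CyclicDesign.gdd 5 10 4 (sizes 5 10 4) 1 5 1 base-10-5-4 refl

base-10-6 : Vec (Vec ℕ 5) 5
base-10-6 =
  ⟨ 53 , 51 , 46 , 0 , 25 ⟩ ∷ ⟨ 1 , 34 , 20 , 30 , 21 ⟩ ∷ ⟨ 3 , 43 , 47 , 24 , 46 ⟩ ∷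
  ⟨ 17 , 6 , 44 , 19 , 34 ⟩ ∷ ⟨ 58 , 43 , 9 , 14 , 6 ⟩ ∷ []

gdd-10-6 : GDD 6 (λ _ → Fin 10)
gdd-10-6 = CyclicDesign.gdd 60 1 0 (λ _ → 10) 0 6 1 base-10-6 refl

base-8-5-4 : Vec (Vec ℕ 5) 32
base-8-5-4 =
  ⟨ 14 , 27 , 8 , 16 , 41 ⟩ ∷ ⟨ 27 , 42 , 23 , 6 , 15 ⟩ ∷ ⟨ 41 , 20 , 4 , 16 , 13 ⟩ ∷
  ⟨ 29 , 38 , 37 , 10 , 26 ⟩ ∷ ⟨ 34 , 26 , 17 , 38 , 40 ⟩ ∷ ⟨ 19 , 15 , 32 , 6 , 8 ⟩ ∷
  ⟨ 0 , 24 , 33 , 36 , 41 ⟩ ∷ ⟨ 10 , 16 , 32 , 18 , 14 ⟩ ∷ ⟨ 40 , 4 , 33 , 26 , 20 ⟩ ∷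
  ⟨ 42 , 31 , 10 , 4 , 37 ⟩ ∷ ⟨ 4 , 38 , 6 , 43 , 17 ⟩ ∷ ⟨ 20 , 11 , 32 , 43 , 28 ⟩ ∷
  ⟨ 36 , 32 , 39 , 10 , 33 ⟩ ∷ ⟨ 26 , 27 , 9 , 33 , 30 ⟩ ∷ ⟨ 6 , 5 , 14 , 28 , 12 ⟩ ∷
  ⟨ 1 , 38 , 5 , 42 , 29 ⟩ ∷ ⟨ 36 , 37 , 3 , 0 , 19 ⟩ ∷ ⟨ 10 , 12 , 36 , 24 , 23 ⟩ ∷
  ⟨ 22 , 16 , 15 , 24 , 38 ⟩ ∷ ⟨ 21 , 7 , 5 , 4 , 3 ⟩ ∷ ⟨ 19 , 17 , 26 , 25 , 3 ⟩ ∷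
  ⟨ 34 , 18 , 0 , 32 , 1 ⟩ ∷ ⟨ 23 , 4 , 12 , 5 , 40 ⟩ ∷ ⟨ 40 , 13 , 36 , 5 , 17 ⟩ ∷
  ⟨ 43 , 12 , 0 , 31 , 8 ⟩ ∷ ⟨ 41 , 39 , 32 , 5 , 26 ⟩ ∷ ⟨ 7 , 30 , 23 , 21 , 34 ⟩ ∷
  ⟨ 31 , 18 , 20 , 12 , 42 ⟩ ∷ ⟨ 27 , 19 , 43 , 20 , 38 ⟩ ∷ ⟨ 25 , 1 , 12 , 13 , 4 ⟩ ∷
  ⟨ 7 , 8 , 39 , 36 , 20 ⟩ ∷ ⟨ 2 , 24 , 28 , 20 , 26 ⟩ ∷ []

gdd-8-5-4 : GDD 6 (Fin ∘ sizes 5 8 4)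
gdd-8-5-4 = CyclicDesign.gdd 5 8 4 (sizes 5 8 4) 1 5 1 base-8-5-4 refl

base-8-6 : Vec (Vec ℕ 5) 4
base-8-6 =
  ⟨ 30 , 15 , 1 , 4 , 14 ⟩ ∷ ⟨ 22 , 42 , 43 , 39 , 2 ⟩ ∷ ⟨ 2 , 31 , 29 , 45 , 6 ⟩ ∷
  ⟨ 31 , 21 , 36 , 23 , 14 ⟩ ∷ []

gdd-8-6 : GDD 6 (λ _ → Fin 8)
gdd-8-6 = CyclicDesign.gdd 48 1 0 (λ _ → 8) 0 6 1 base-8-6 refl

base-6-6 : Vec (Vec ℕ 5) 3
base-6-6 =
  ⟨ 23 , 14 , 13 , 27 , 24 ⟩ ∷ ⟨ 31 , 2 , 33 , 17 , 0 ⟩ ∷ ⟨ 35 , 8 , 31 , 24 , 16 ⟩ ∷ []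

gdd-6-6 : GDD 6 (λ _ → Fin 6)
gdd-6-6 = CyclicDesign.gdd 36 1 0 (λ _ → 6) 0 6 1 base-6-6 refl

base-5-7 : Vec (Vec ℕ 5) 3
base-5-7 =
  ⟨ 23 , 26 , 18 , 6 , 17 ⟩ ∷ ⟨ 22 , 11 , 27 , 12 , 24 ⟩ ∷ ⟨ 14 , 12 , 22 , 31 , 18 ⟩ ∷ []

gdd-5-7 : GDD 7 (λ _ → Fin 5)
gdd-5-7 = CyclicDesign.gdd 35 1 0 (λ _ → 5) 0 7 1 base-5-7 refl

base-4-10 : Vec (Vec ℕ 5) 8
base-4-10 =
  ⟨ 30 , 1 , 37 , 23 , 15 ⟩ ∷ ⟨ 27 , 35 , 33 , 14 , 22 ⟩ ∷ ⟨ 8 , 2 , 6 , 27 , 7 ⟩ ∷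
  ⟨ 2 , 32 , 38 , 8 , 18 ⟩ ∷ ⟨ 13 , 26 , 36 , 16 , 18 ⟩ ∷ ⟨ 21 , 17 , 14 , 7 , 9 ⟩ ∷
  ⟨ 1 , 34 , 18 , 30 , 33 ⟩ ∷ ⟨ 18 , 13 , 39 , 19 , 2 ⟩ ∷ []

gdd-4-10 : GDD 10 (Fin ∘ sizes 9 4 4)
gdd-4-10 = CyclicDesign.gdd 18 2 4 (sizes 9 4 4) 1 9 1 base-4-10 refl

base-8-5-10 : Vec (Vec ℕ 5) 52
base-8-5-10 =
  ⟨ 17 , 23 , 48 , 9 , 4 ⟩ ∷ ⟨ 1 , 5 , 9 , 17 , 13 ⟩ ∷ ⟨ 25 , 18 , 12 , 1 , 46 ⟩ ∷
  ⟨ 44 , 15 , 11 , 38 , 20 ⟩ ∷ ⟨ 36 , 3 , 8 , 13 , 42 ⟩ ∷ ⟨ 10 , 44 , 27 , 0 , 19 ⟩ ∷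
  ⟨ 22 , 44 , 34 , 5 , 29 ⟩ ∷ ⟨ 2 , 30 , 40 , 13 , 7 ⟩ ∷ ⟨ 21 , 26 , 32 , 10 , 45 ⟩ ∷
  ⟨ 36 , 5 , 2 , 15 , 44 ⟩ ∷ ⟨ 45 , 28 , 25 , 0 , 38 ⟩ ∷ ⟨ 37 , 22 , 13 , 41 , 30 ⟩ ∷
  ⟨ 22 , 42 , 36 , 10 , 25 ⟩ ∷ ⟨ 42 , 12 , 19 , 5 , 30 ⟩ ∷ ⟨ 30 , 17 , 1 , 24 , 41 ⟩ ∷
  ⟨ 4 , 11 , 48 , 2 , 35 ⟩ ∷ ⟨ 17 , 35 , 25 , 22 , 49 ⟩ ∷ ⟨ 8 , 41 , 15 , 1 , 26 ⟩ ∷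
  ⟨ 27 , 18 , 42 , 22 , 35 ⟩ ∷ ⟨ 46 , 10 , 32 , 17 , 2 ⟩ ∷ ⟨ 13 , 4 , 18 , 43 , 21 ⟩ ∷
  ⟨ 48 , 22 , 28 , 14 , 39 ⟩ ∷ ⟨ 34 , 30 , 38 , 22 , 26 ⟩ ∷ ⟨ 9 , 38 , 43 , 32 , 5 ⟩ ∷
  ⟨ 47 , 12 , 10 , 26 , 22 ⟩ ∷ ⟨ 43 , 1 , 38 , 30 , 25 ⟩ ∷ ⟨ 45 , 20 , 16 , 11 , 13 ⟩ ∷
  ⟨ 19 , 7 , 14 , 29 , 45 ⟩ ∷ ⟨ 9 , 23 , 39 , 7 , 46 ⟩ ∷ ⟨ 34 , 31 , 46 , 20 , 6 ⟩ ∷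
  ⟨ 12 , 47 , 4 , 3 , 38 ⟩ ∷ ⟨ 24 , 31 , 22 , 43 , 12 ⟩ ∷ ⟨ 13 , 25 , 29 , 48 , 19 ⟩ ∷
  ⟨ 1 , 49 , 31 , 35 , 19 ⟩ ∷ ⟨ 35 , 0 , 43 , 17 , 10 ⟩ ∷ ⟨ 4 , 33 , 31 , 42 , 0 ⟩ ∷
  ⟨ 32 , 6 , 41 , 38 , 21 ⟩ ∷ ⟨ 13 , 40 , 20 , 17 , 26 ⟩ ∷ ⟨ 16 , 2 , 29 , 5 , 47 ⟩ ∷
  ⟨ 28 , 49 , 6 , 22 , 37 ⟩ ∷ ⟨ 27 , 9 , 34 , 37 , 47 ⟩ ∷ ⟨ 21 , 47 , 30 , 19 , 35 ⟩ ∷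
  ⟨ 49 , 25 , 15 , 3 , 10 ⟩ ∷ ⟨ 16 , 26 , 28 , 35 , 44 ⟩ ∷ ⟨ 41 , 6 , 34 , 17 , 11 ⟩ ∷
  ⟨ 2 , 38 , 33 , 48 , 24 ⟩ ∷ ⟨ 38 , 2 , 45 , 4 , 34 ⟩ ∷ ⟨ 39 , 40 , 30 , 32 , 0 ⟩ ∷
  ⟨ 46 , 24 , 39 , 29 , 13 ⟩ ∷ ⟨ 8 , 5 , 23 , 18 , 40 ⟩ ∷ ⟨ 32 , 25 , 40 , 37 , 8 ⟩ ∷
  ⟨ 5 , 14 , 38 , 11 , 49 ⟩ ∷ []

-- Here ℤ/4 maps every group to itself: strips of length 4 are whole orbits, and each group of size
-- 8 consists of two of them.
gdd-8-5-10 : GDD 6 (Fin ∘ sizes 5 8 10)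
gdd-8-5-10 = CyclicDesign.gdd 4 10 10 (sizes 5 8 10) 1 5 4 base-8-5-10 refl

base-10-17-24 : Vec (Vec ℕ 5) 208
base-10-17-24 =
  ⟨ 49 , 79 , 89 , 153 , 16 ⟩ ∷ ⟨ 81 , 168 , 180 , 99 , 75 ⟩ ∷ ⟨ 104 , 158 , 154 , 45 , 25 ⟩ ∷
  ⟨ 91 , 38 , 35 , 139 , 15 ⟩ ∷ ⟨ 192 , 9 , 163 , 47 , 127 ⟩ ∷ ⟨ 162 , 154 , 6 , 75 , 131 ⟩ ∷
  ⟨ 163 , 173 , 57 , 153 , 151 ⟩ ∷ ⟨ 97 , 147 , 137 , 26 , 10 ⟩ ∷ ⟨ 79 , 64 , 3 , 178 , 76 ⟩ ∷
  ⟨ 114 , 82 , 175 , 49 , 74 ⟩ ∷ ⟨ 15 , 125 , 7 , 67 , 106 ⟩ ∷ ⟨ 49 , 106 , 172 , 113 , 95 ⟩ ∷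
  ⟨ 91 , 166 , 88 , 102 , 111 ⟩ ∷ ⟨ 20 , 180 , 61 , 127 , 31 ⟩ ∷ ⟨ 186 , 42 , 74 , 169 , 17 ⟩ ∷
  ⟨ 23 , 18 , 14 , 10 , 148 ⟩ ∷ ⟨ 109 , 64 , 169 , 56 , 31 ⟩ ∷ ⟨ 187 , 81 , 124 , 29 , 161 ⟩ ∷
  ⟨ 117 , 4 , 65 , 144 , 10 ⟩ ∷ ⟨ 97 , 121 , 186 , 95 , 122 ⟩ ∷ ⟨ 140 , 117 , 176 , 156 , 142 ⟩ ∷
  ⟨ 106 , 119 , 63 , 164 , 98 ⟩ ∷ ⟨ 169 , 108 , 96 , 153 , 38 ⟩ ∷ ⟨ 51 , 24 , 132 , 138 , 77 ⟩ ∷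
  ⟨ 91 , 176 , 98 , 67 , 126 ⟩ ∷ ⟨ 11 , 126 , 66 , 180 , 12 ⟩ ∷ ⟨ 3 , 85 , 82 , 185 , 90 ⟩ ∷
  ⟨ 65 , 72 , 101 , 5 , 95 ⟩ ∷ ⟨ 6 , 156 , 164 , 73 , 119 ⟩ ∷ ⟨ 62 , 17 , 190 , 66 , 26 ⟩ ∷
  ⟨ 153 , 91 , 128 , 41 , 193 ⟩ ∷ ⟨ 164 , 4 , 27 , 75 , 105 ⟩ ∷ ⟨ 71 , 112 , 142 , 117 , 18 ⟩ ∷
  ⟨ 38 , 29 , 166 , 74 , 186 ⟩ ∷ ⟨ 120 , 38 , 85 , 114 , 134 ⟩ ∷ ⟨ 136 , 38 , 64 , 122 , 148 ⟩ ∷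
  ⟨ 42 , 56 , 166 , 0 , 117 ⟩ ∷ ⟨ 135 , 178 , 30 , 94 , 123 ⟩ ∷ ⟨ 150 , 172 , 50 , 155 , 142 ⟩ ∷
  ⟨ 5 , 59 , 166 , 168 , 69 ⟩ ∷ ⟨ 192 , 117 , 82 , 20 , 148 ⟩ ∷ ⟨ 114 , 28 , 58 , 53 , 48 ⟩ ∷
  ⟨ 148 , 96 , 31 , 141 , 13 ⟩ ∷ ⟨ 55 , 94 , 107 , 146 , 24 ⟩ ∷ ⟨ 47 , 1 , 189 , 37 , 15 ⟩ ∷
  ⟨ 6 , 172 , 129 , 53 , 5 ⟩ ∷ ⟨ 95 , 84 , 20 , 179 , 86 ⟩ ∷ ⟨ 146 , 51 , 16 , 120 , 92 ⟩ ∷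
  ⟨ 25 , 145 , 134 , 106 , 191 ⟩ ∷ ⟨ 54 , 45 , 133 , 69 , 84 ⟩ ∷ ⟨ 132 , 65 , 181 , 128 , 114 ⟩ ∷
  ⟨ 189 , 122 , 85 , 80 , 141 ⟩ ∷ ⟨ 13 , 110 , 120 , 150 , 79 ⟩ ∷ ⟨ 77 , 147 , 18 , 98 , 141 ⟩ ∷
  ⟨ 61 , 179 , 59 , 84 , 141 ⟩ ∷ ⟨ 81 , 130 , 27 , 0 , 20 ⟩ ∷ ⟨ 124 , 2 , 174 , 14 , 84 ⟩ ∷
  ⟨ 116 , 5 , 169 , 97 , 190 ⟩ ∷ ⟨ 55 , 171 , 145 , 83 , 57 ⟩ ∷ ⟨ 165 , 94 , 90 , 8 , 64 ⟩ ∷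
  ⟨ 113 , 34 , 90 , 180 , 106 ⟩ ∷ ⟨ 147 , 106 , 15 , 56 , 9 ⟩ ∷ ⟨ 70 , 51 , 170 , 10 , 73 ⟩ ∷
  ⟨ 161 , 177 , 120 , 152 , 155 ⟩ ∷ ⟨ 191 , 116 , 27 , 145 , 122 ⟩ ∷ ⟨ 4 , 100 , 20 , 45 , 41 ⟩ ∷
  ⟨ 36 , 122 , 61 , 142 , 147 ⟩ ∷ ⟨ 145 , 108 , 88 , 181 , 87 ⟩ ∷ ⟨ 21 , 35 , 112 , 160 , 164 ⟩ ∷
  ⟨ 8 , 139 , 84 , 47 , 53 ⟩ ∷ ⟨ 81 , 134 , 33 , 23 , 9 ⟩ ∷ ⟨ 111 , 44 , 23 , 184 , 50 ⟩ ∷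
  ⟨ 50 , 182 , 41 , 94 , 22 ⟩ ∷ ⟨ 137 , 161 , 171 , 158 , 17 ⟩ ∷ ⟨ 72 , 73 , 166 , 67 , 61 ⟩ ∷
  ⟨ 22 , 118 , 91 , 178 , 116 ⟩ ∷ ⟨ 0 , 74 , 88 , 177 , 100 ⟩ ∷ ⟨ 29 , 164 , 83 , 104 , 1 ⟩ ∷
  ⟨ 190 , 114 , 4 , 163 , 99 ⟩ ∷ ⟨ 103 , 132 , 158 , 182 , 106 ⟩ ∷ ⟨ 110 , 147 , 20 , 77 , 192 ⟩ ∷
  ⟨ 101 , 10 , 28 , 37 , 41 ⟩ ∷ ⟨ 39 , 26 , 176 , 108 , 50 ⟩ ∷ ⟨ 12 , 136 , 41 , 72 , 52 ⟩ ∷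
  ⟨ 39 , 170 , 154 , 34 , 54 ⟩ ∷ ⟨ 58 , 38 , 12 , 169 , 116 ⟩ ∷ ⟨ 148 , 81 , 121 , 71 , 40 ⟩ ∷
  ⟨ 73 , 132 , 23 , 163 , 187 ⟩ ∷ ⟨ 188 , 43 , 97 , 5 , 150 ⟩ ∷ ⟨ 134 , 73 , 37 , 152 , 190 ⟩ ∷
  ⟨ 86 , 29 , 129 , 14 , 162 ⟩ ∷ ⟨ 74 , 116 , 193 , 79 , 105 ⟩ ∷ ⟨ 54 , 183 , 64 , 48 , 111 ⟩ ∷
  ⟨ 81 , 97 , 164 , 172 , 70 ⟩ ∷ ⟨ 20 , 173 , 79 , 1 , 23 ⟩ ∷ ⟨ 108 , 177 , 9 , 112 , 70 ⟩ ∷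
  ⟨ 150 , 54 , 100 , 104 , 17 ⟩ ∷ ⟨ 37 , 178 , 56 , 160 , 42 ⟩ ∷ ⟨ 147 , 182 , 74 , 166 , 143 ⟩ ∷
  ⟨ 95 , 46 , 49 , 149 , 1 ⟩ ∷ ⟨ 98 , 101 , 83 , 82 , 142 ⟩ ∷ ⟨ 75 , 57 , 127 , 184 , 71 ⟩ ∷
  ⟨ 128 , 44 , 179 , 115 , 122 ⟩ ∷ ⟨ 190 , 146 , 72 , 130 , 40 ⟩ ∷ ⟨ 58 , 1 , 147 , 112 , 186 ⟩ ∷
  ⟨ 11 , 109 , 187 , 14 , 103 ⟩ ∷ ⟨ 67 , 42 , 69 , 124 , 71 ⟩ ∷ ⟨ 69 , 123 , 155 , 118 , 44 ⟩ ∷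
  ⟨ 68 , 157 , 118 , 64 , 188 ⟩ ∷ ⟨ 161 , 143 , 96 , 175 , 166 ⟩ ∷ ⟨ 122 , 25 , 52 , 172 , 31 ⟩ ∷
  ⟨ 157 , 53 , 112 , 31 , 189 ⟩ ∷ ⟨ 132 , 63 , 173 , 119 , 116 ⟩ ∷ ⟨ 68 , 6 , 38 , 173 , 39 ⟩ ∷
  ⟨ 86 , 90 , 2 , 65 , 168 ⟩ ∷ ⟨ 134 , 161 , 40 , 85 , 132 ⟩ ∷ ⟨ 87 , 150 , 135 , 75 , 189 ⟩ ∷
  ⟨ 139 , 73 , 145 , 30 , 86 ⟩ ∷ ⟨ 150 , 160 , 179 , 163 , 32 ⟩ ∷ ⟨ 19 , 101 , 102 , 80 , 103 ⟩ ∷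
  ⟨ 36 , 181 , 74 , 0 , 35 ⟩ ∷ ⟨ 68 , 16 , 58 , 90 , 96 ⟩ ∷ ⟨ 104 , 64 , 55 , 163 , 29 ⟩ ∷
  ⟨ 132 , 33 , 170 , 88 , 127 ⟩ ∷ ⟨ 61 , 149 , 67 , 48 , 46 ⟩ ∷ ⟨ 39 , 132 , 61 , 177 , 60 ⟩ ∷
  ⟨ 17 , 12 , 151 , 40 , 107 ⟩ ∷ ⟨ 78 , 105 , 50 , 141 , 98 ⟩ ∷ ⟨ 83 , 58 , 17 , 130 , 141 ⟩ ∷
  ⟨ 92 , 163 , 183 , 147 , 158 ⟩ ∷ ⟨ 63 , 13 , 138 , 130 , 90 ⟩ ∷ ⟨ 0 , 32 , 75 , 181 , 29 ⟩ ∷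
  ⟨ 117 , 185 , 113 , 70 , 12 ⟩ ∷ ⟨ 0 , 184 , 162 , 30 , 7 ⟩ ∷ ⟨ 64 , 95 , 192 , 97 , 60 ⟩ ∷
  ⟨ 97 , 104 , 170 , 30 , 106 ⟩ ∷ ⟨ 114 , 135 , 158 , 88 , 55 ⟩ ∷ ⟨ 154 , 10 , 176 , 3 , 31 ⟩ ∷
  ⟨ 153 , 135 , 12 , 93 , 31 ⟩ ∷ ⟨ 54 , 43 , 175 , 61 , 116 ⟩ ∷ ⟨ 36 , 106 , 22 , 60 , 65 ⟩ ∷
  ⟨ 124 , 175 , 3 , 132 , 146 ⟩ ∷ ⟨ 138 , 163 , 178 , 139 , 16 ⟩ ∷ ⟨ 43 , 45 , 33 , 163 , 21 ⟩ ∷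
  ⟨ 33 , 160 , 35 , 51 , 122 ⟩ ∷ ⟨ 80 , 87 , 42 , 159 , 7 ⟩ ∷ ⟨ 109 , 73 , 38 , 183 , 81 ⟩ ∷
  ⟨ 139 , 108 , 94 , 173 , 95 ⟩ ∷ ⟨ 160 , 15 , 70 , 158 , 63 ⟩ ∷ ⟨ 33 , 131 , 188 , 130 , 24 ⟩ ∷
  ⟨ 129 , 13 , 0 , 122 , 168 ⟩ ∷ ⟨ 23 , 185 , 152 , 45 , 27 ⟩ ∷ ⟨ 29 , 138 , 177 , 41 , 25 ⟩ ∷
  ⟨ 44 , 77 , 191 , 37 , 72 ⟩ ∷ ⟨ 189 , 62 , 33 , 105 , 162 ⟩ ∷ ⟨ 79 , 9 , 123 , 116 , 144 ⟩ ∷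
  ⟨ 16 , 155 , 191 , 88 , 65 ⟩ ∷ ⟨ 54 , 99 , 191 , 168 , 1 ⟩ ∷ ⟨ 105 , 143 , 113 , 131 , 121 ⟩ ∷
  ⟨ 135 , 99 , 159 , 120 , 42 ⟩ ∷ ⟨ 166 , 181 , 159 , 144 , 51 ⟩ ∷ ⟨ 142 , 19 , 37 , 135 , 96 ⟩ ∷
  ⟨ 96 , 73 , 18 , 171 , 88 ⟩ ∷ ⟨ 186 , 140 , 59 , 14 , 107 ⟩ ∷ ⟨ 135 , 171 , 124 , 49 , 114 ⟩ ∷
  ⟨ 25 , 41 , 130 , 140 , 101 ⟩ ∷ ⟨ 90 , 21 , 61 , 182 , 58 ⟩ ∷ ⟨ 90 , 184 , 63 , 100 , 123 ⟩ ∷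
  ⟨ 29 , 109 , 0 , 150 , 40 ⟩ ∷ ⟨ 83 , 131 , 167 , 40 , 102 ⟩ ∷ ⟨ 15 , 65 , 126 , 6 , 111 ⟩ ∷
  ⟨ 36 , 63 , 187 , 141 , 86 ⟩ ∷ ⟨ 133 , 145 , 183 , 125 , 16 ⟩ ∷ ⟨ 10 , 20 , 175 , 94 , 18 ⟩ ∷
  ⟨ 13 , 20 , 183 , 99 , 22 ⟩ ∷ ⟨ 103 , 5 , 179 , 47 , 3 ⟩ ∷ ⟨ 115 , 174 , 120 , 162 , 112 ⟩ ∷
  ⟨ 188 , 83 , 118 , 164 , 53 ⟩ ∷ ⟨ 145 , 154 , 12 , 170 , 144 ⟩ ∷ ⟨ 146 , 108 , 32 , 81 , 103 ⟩ ∷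
  ⟨ 103 , 14 , 40 , 171 , 16 ⟩ ∷ ⟨ 95 , 158 , 157 , 34 , 117 ⟩ ∷ ⟨ 99 , 146 , 187 , 54 , 47 ⟩ ∷
  ⟨ 154 , 146 , 185 , 160 , 127 ⟩ ∷ ⟨ 129 , 136 , 84 , 40 , 77 ⟩ ∷ ⟨ 28 , 115 , 99 , 69 , 114 ⟩ ∷
  ⟨ 88 , 40 , 10 , 137 , 188 ⟩ ∷ ⟨ 43 , 174 , 35 , 101 , 20 ⟩ ∷ ⟨ 139 , 180 , 35 , 168 , 147 ⟩ ∷
  ⟨ 132 , 17 , 67 , 49 , 162 ⟩ ∷ ⟨ 77 , 6 , 182 , 122 , 11 ⟩ ∷ ⟨ 193 , 36 , 162 , 119 , 88 ⟩ ∷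
  ⟨ 61 , 29 , 167 , 87 , 79 ⟩ ∷ ⟨ 24 , 60 , 85 , 76 , 158 ⟩ ∷ ⟨ 144 , 162 , 184 , 116 , 142 ⟩ ∷
  ⟨ 24 , 23 , 127 , 165 , 79 ⟩ ∷ ⟨ 12 , 164 , 42 , 132 , 192 ⟩ ∷ ⟨ 27 , 94 , 55 , 174 , 58 ⟩ ∷
  ⟨ 150 , 114 , 147 , 129 , 67 ⟩ ∷ ⟨ 75 , 125 , 59 , 176 , 79 ⟩ ∷ ⟨ 152 , 167 , 72 , 174 , 139 ⟩ ∷
  ⟨ 151 , 102 , 121 , 137 , 64 ⟩ ∷ ⟨ 61 , 49 , 126 , 185 , 62 ⟩ ∷ ⟨ 109 , 120 , 49 , 87 , 123 ⟩ ∷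
  ⟨ 90 , 117 , 36 , 76 , 149 ⟩ ∷ ⟨ 193 , 26 , 55 , 148 , 6 ⟩ ∷ ⟨ 24 , 155 , 125 , 25 , 71 ⟩ ∷
  ⟨ 13 , 27 , 143 , 66 , 193 ⟩ ∷ []

-- Tailored to 195 = 17 · 10 + 24 + 1: with one new point the groups have sizes 11 and 25.
gdd-10-17-24 : GDD 18 (Fin ∘ sizes 17 10 24)
gdd-10-17-24 = CyclicDesign.gdd 17 10 24 (sizes 17 10 24) 1 17 1 base-10-17-24 refl

base-10-17 : Vec (Vec ℕ 5) 32
base-10-17 =
  ⟨ 152 , 39 , 92 , 136 , 6 ⟩ ∷ ⟨ 105 , 121 , 12 , 123 , 116 ⟩ ∷ ⟨ 167 , 9 , 45 , 40 , 155 ⟩ ∷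
  ⟨ 32 , 80 , 4 , 50 , 109 ⟩ ∷ ⟨ 36 , 71 , 5 , 85 , 83 ⟩ ∷ ⟨ 6 , 28 , 4 , 29 , 158 ⟩ ∷
  ⟨ 108 , 12 , 50 , 87 , 93 ⟩ ∷ ⟨ 130 , 13 , 26 , 76 , 40 ⟩ ∷ ⟨ 36 , 123 , 75 , 16 , 86 ⟩ ∷
  ⟨ 128 , 25 , 158 , 167 , 17 ⟩ ∷ ⟨ 43 , 122 , 50 , 58 , 47 ⟩ ∷ ⟨ 140 , 121 , 22 , 111 , 108 ⟩ ∷
  ⟨ 82 , 136 , 100 , 146 , 98 ⟩ ∷ ⟨ 128 , 133 , 127 , 84 , 160 ⟩ ∷ ⟨ 55 , 28 , 102 , 13 , 7 ⟩ ∷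
  ⟨ 42 , 29 , 120 , 135 , 124 ⟩ ∷ ⟨ 51 , 53 , 124 , 143 , 89 ⟩ ∷ ⟨ 70 , 58 , 26 , 1 , 110 ⟩ ∷
  ⟨ 39 , 79 , 38 , 151 , 94 ⟩ ∷ ⟨ 92 , 115 , 0 , 45 , 69 ⟩ ∷ ⟨ 71 , 104 , 133 , 28 , 159 ⟩ ∷
  ⟨ 124 , 93 , 169 , 136 , 55 ⟩ ∷ ⟨ 44 , 102 , 160 , 40 , 50 ⟩ ∷ ⟨ 156 , 95 , 91 , 133 , 12 ⟩ ∷
  ⟨ 131 , 87 , 152 , 144 , 78 ⟩ ∷ ⟨ 47 , 164 , 167 , 76 , 67 ⟩ ∷ ⟨ 20 , 127 , 128 , 103 , 2 ⟩ ∷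
  ⟨ 87 , 123 , 60 , 7 , 158 ⟩ ∷ ⟨ 80 , 83 , 57 , 28 , 122 ⟩ ∷ ⟨ 90 , 130 , 104 , 112 , 6 ⟩ ∷
  ⟨ 142 , 149 , 71 , 7 , 82 ⟩ ∷ ⟨ 57 , 120 , 38 , 98 , 43 ⟩ ∷ []

gdd-10-17 : GDD 17 (λ _ → Fin 10)
gdd-10-17 = CyclicDesign.gdd 85 2 0 (λ _ → 10) 0 17 1 base-10-17 refl

base-i21 : Vec (Vec ℕ 5) 40
base-i21 =
  ⟨ 0 , 1 , 12 , 13 , 16 ⟩ ∷ ⟨ 0 , 2 , 4 , 6 , 17 ⟩ ∷ ⟨ 0 , 3 , 9 , 10 , 18 ⟩ ∷ ⟨ 0 , 5 , 11 , 14 , 19 ⟩ ∷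
  ⟨ 0 , 7 , 8 , 15 , 20 ⟩ ∷ ⟨ 1 , 2 , 8 , 11 , 18 ⟩ ∷ ⟨ 1 , 3 , 5 , 7 , 17 ⟩ ∷ ⟨ 1 , 4 , 10 , 15 , 19 ⟩ ∷
  ⟨ 1 , 6 , 9 , 14 , 20 ⟩ ∷ ⟨ 2 , 3 , 14 , 15 , 16 ⟩ ∷ ⟨ 2 , 5 , 10 , 13 , 20 ⟩ ∷ ⟨ 2 , 7 , 9 , 12 , 19 ⟩ ∷
  ⟨ 3 , 4 , 11 , 12 , 20 ⟩ ∷ ⟨ 3 , 6 , 8 , 13 , 19 ⟩ ∷ ⟨ 4 , 5 , 8 , 9 , 16 ⟩ ∷ ⟨ 4 , 7 , 13 , 14 , 18 ⟩ ∷
  ⟨ 5 , 6 , 12 , 15 , 18 ⟩ ∷ ⟨ 6 , 7 , 10 , 11 , 16 ⟩ ∷ ⟨ 8 , 10 , 12 , 14 , 17 ⟩ ∷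
  ⟨ 9 , 11 , 13 , 15 , 17 ⟩ ∷ ⟨ 16 , 6 , 5 , 2 , 1 ⟩ ∷ ⟨ 16 , 7 , 4 , 3 , 0 ⟩ ∷ ⟨ 16 , 14 , 13 , 10 , 9 ⟩ ∷
  ⟨ 16 , 15 , 12 , 11 , 8 ⟩ ∷ ⟨ 17 , 9 , 8 , 3 , 2 ⟩ ∷ ⟨ 17 , 11 , 10 , 1 , 0 ⟩ ∷ ⟨ 17 , 13 , 12 , 7 , 6 ⟩ ∷
  ⟨ 17 , 15 , 14 , 5 , 4 ⟩ ∷ ⟨ 18 , 12 , 9 , 4 , 1 ⟩ ∷ ⟨ 18 , 13 , 8 , 5 , 0 ⟩ ∷ ⟨ 18 , 14 , 11 , 6 , 3 ⟩ ∷
  ⟨ 18 , 15 , 10 , 7 , 2 ⟩ ∷ ⟨ 19 , 12 , 10 , 5 , 3 ⟩ ∷ ⟨ 19 , 13 , 11 , 4 , 2 ⟩ ∷ ⟨ 19 , 14 , 8 , 7 , 1 ⟩ ∷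
  ⟨ 19 , 15 , 9 , 6 , 0 ⟩ ∷ ⟨ 20 , 10 , 8 , 6 , 4 ⟩ ∷ ⟨ 20 , 11 , 9 , 7 , 5 ⟩ ∷ ⟨ 20 , 14 , 12 , 2 , 0 ⟩ ∷
  ⟨ 20 , 15 , 13 , 3 , 1 ⟩ ∷ []

-- Two projective planes of order 4 with a common line, the hole, whose points are numbered last.
-- One plane lists its other 20 lines in ascending order, the second in descending order.
incomplete-21 : Incomplete (Fin 16) (Fin 5)
incomplete-21 = CyclicDesign.incomplete 1 16 5 base-i21 refl

base-i41 : Vec (Vec ℕ 5) 9
base-i41 =
  ⟨ 7 , 12 , 32 , 14 , 10 ⟩ ∷ ⟨ 35 , 1 , 36 , 11 , 23 ⟩ ∷ ⟨ 8 , 34 , 39 , 2 , 19 ⟩ ∷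
  ⟨ 14 , 5 , 20 , 9 , 19 ⟩ ∷ ⟨ 32 , 12 , 38 , 21 , 11 ⟩ ∷ ⟨ 10 , 29 , 37 , 31 , 16 ⟩ ∷
  ⟨ 25 , 16 , 13 , 29 , 6 ⟩ ∷ ⟨ 18 , 10 , 40 , 28 , 11 ⟩ ∷ ⟨ 22 , 18 , 23 , 34 , 31 ⟩ ∷ []

incomplete-41 : Incomplete (Fin 36) (Fin 5)
incomplete-41 = CyclicDesign.incomplete 18 2 5 base-i41 refl

base-11 : Vec (Vec ℕ 5) 1
base-11 =
  ⟨ 2 , 4 , 3 , 8 , 0 ⟩ ∷ []

-- For v ≡ 1 modulo 10 the v(v - 1)/10 blocks split into (v - 1)/10 full orbits under ℤ/v.
dd-11 : DD 11
dd-11 = CyclicDesign.dd 11 1 0 base-11 refl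

base-21 : Vec (Vec ℕ 5) 2
base-21 =
  ⟨ 4 , 14 , 2 , 1 , 8 ⟩ ∷ ⟨ 16 , 19 , 0 , 11 , 12 ⟩ ∷ []

dd-21 : DD 21
dd-21 = CyclicDesign.dd 21 1 0 base-21 refl

base-25 : Vec (Vec ℕ 5) 5
base-25 =
  ⟨ 19 , 4 , 5 , 2 , 15 ⟩ ∷ ⟨ 10 , 17 , 24 , 1 , 18 ⟩ ∷ ⟨ 1 , 16 , 3 , 8 , 7 ⟩ ∷ ⟨ 16 , 9 , 5 , 23 , 21 ⟩ ∷
  ⟨ 21 , 13 , 15 , 3 , 12 ⟩ ∷ []

-- For v ≡ 5 modulo 10 the number v(v - 1)/10 of blocks is no multiple of v, so ℤ/v cannot serve.
-- The group of order (v - 1)/2, with two orbits and one fixed point, leaves v/5 base blocks.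
dd-25 : DD 25
dd-25 = CyclicDesign.dd 12 2 1 base-25 refl

base-31 : Vec (Vec ℕ 5) 3
base-31 =
  ⟨ 25 , 7 , 29 , 23 , 22 ⟩ ∷ ⟨ 3 , 24 , 10 , 30 , 11 ⟩ ∷ ⟨ 1 , 4 , 27 , 6 , 15 ⟩ ∷ []

dd-31 : DD 31
dd-31 = CyclicDesign.dd 31 1 0 base-31 refl

base-35 : Vec (Vec ℕ 5) 7
base-35 =
  ⟨ 6 , 8 , 25 , 17 , 3 ⟩ ∷ ⟨ 12 , 5 , 4 , 26 , 20 ⟩ ∷ ⟨ 17 , 4 , 34 , 22 , 7 ⟩ ∷
  ⟨ 24 , 17 , 25 , 20 , 13 ⟩ ∷ ⟨ 28 , 3 , 26 , 8 , 9 ⟩ ∷ ⟨ 25 , 2 , 32 , 29 , 31 ⟩ ∷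
  ⟨ 2 , 15 , 22 , 6 , 13 ⟩ ∷ []

dd-35 : DD 35
dd-35 = CyclicDesign.dd 17 2 1 base-35 refl

base-41 : Vec (Vec ℕ 5) 4
base-41 =
  ⟨ 33 , 23 , 35 , 18 , 9 ⟩ ∷ ⟨ 30 , 19 , 27 , 26 , 40 ⟩ ∷ ⟨ 22 , 14 , 15 , 33 , 20 ⟩ ∷
  ⟨ 9 , 31 , 25 , 34 , 13 ⟩ ∷ []

dd-41 : DD 41
dd-41 = CyclicDesign.dd 41 1 0 base-41 refl

base-45 : Vec (Vec ℕ 5) 9
base-45 =
  ⟨ 42 , 21 , 44 , 28 , 19 ⟩ ∷ ⟨ 37 , 34 , 17 , 28 , 21 ⟩ ∷ ⟨ 13 , 14 , 10 , 19 , 21 ⟩ ∷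
  ⟨ 26 , 40 , 15 , 14 , 38 ⟩ ∷ ⟨ 16 , 11 , 26 , 28 , 4 ⟩ ∷ ⟨ 9 , 40 , 0 , 12 , 25 ⟩ ∷
  ⟨ 9 , 1 , 23 , 28 , 29 ⟩ ∷ ⟨ 19 , 23 , 40 , 27 , 13 ⟩ ∷ ⟨ 29 , 25 , 40 , 10 , 28 ⟩ ∷ []

dd-45 : DD 45
dd-45 = CyclicDesign.dd 22 2 1 base-45 refl

base-55 : Vec (Vec ℕ 5) 11
base-55 =
  ⟨ 52 , 3 , 4 , 15 , 13 ⟩ ∷ ⟨ 49 , 9 , 32 , 4 , 48 ⟩ ∷ ⟨ 30 , 19 , 54 , 11 , 27 ⟩ ∷
  ⟨ 23 , 51 , 26 , 45 , 47 ⟩ ∷ ⟨ 21 , 50 , 41 , 14 , 0 ⟩ ∷ ⟨ 24 , 29 , 23 , 12 , 14 ⟩ ∷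
  ⟨ 43 , 19 , 30 , 0 , 23 ⟩ ∷ ⟨ 19 , 24 , 33 , 50 , 34 ⟩ ∷ ⟨ 7 , 14 , 32 , 1 , 41 ⟩ ∷
  ⟨ 37 , 43 , 11 , 8 , 41 ⟩ ∷ ⟨ 31 , 34 , 46 , 53 , 39 ⟩ ∷ []

dd-55 : DD 55
dd-55 = CyclicDesign.dd 27 2 1 base-55 refl

base-65 : Vec (Vec ℕ 5) 13
base-65 =
  ⟨ 35 , 29 , 41 , 15 , 58 ⟩ ∷ ⟨ 45 , 20 , 64 , 23 , 44 ⟩ ∷ ⟨ 36 , 28 , 50 , 8 , 1 ⟩ ∷
  ⟨ 45 , 37 , 0 , 58 , 55 ⟩ ∷ ⟨ 19 , 1 , 0 , 16 , 33 ⟩ ∷ ⟨ 22 , 38 , 58 , 63 , 42 ⟩ ∷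
  ⟨ 59 , 61 , 25 , 20 , 29 ⟩ ∷ ⟨ 52 , 55 , 8 , 50 , 31 ⟩ ∷ ⟨ 2 , 39 , 23 , 10 , 8 ⟩ ∷
  ⟨ 25 , 3 , 38 , 50 , 27 ⟩ ∷ ⟨ 22 , 10 , 40 , 41 , 49 ⟩ ∷ ⟨ 53 , 49 , 36 , 3 , 43 ⟩ ∷
  ⟨ 2 , 28 , 24 , 62 , 3 ⟩ ∷ []

dd-65 : DD 65
dd-65 = CyclicDesign.dd 32 2 1 base-65 refl

base-71 : Vec (Vec ℕ 5) 7
base-71 =
  ⟨ 49 , 48 , 1 , 23 , 12 ⟩ ∷ ⟨ 43 , 8 , 33 , 47 , 39 ⟩ ∷ ⟨ 41 , 20 , 29 , 61 , 23 ⟩ ∷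
  ⟨ 55 , 1 , 39 , 52 , 57 ⟩ ∷ ⟨ 24 , 43 , 15 , 1 , 2 ⟩ ∷ ⟨ 15 , 27 , 67 , 22 , 43 ⟩ ∷
  ⟨ 70 , 36 , 9 , 63 , 7 ⟩ ∷ []

dd-71 : DD 71
dd-71 = CyclicDesign.dd 71 1 0 base-71 refl

base-75 : Vec (Vec ℕ 5) 15
base-75 =
  ⟨ 43 , 4 , 2 , 64 , 27 ⟩ ∷ ⟨ 5 , 35 , 36 , 9 , 37 ⟩ ∷ ⟨ 11 , 54 , 26 , 35 , 6 ⟩ ∷
  ⟨ 6 , 39 , 74 , 9 , 50 ⟩ ∷ ⟨ 33 , 18 , 64 , 9 , 1 ⟩ ∷ ⟨ 71 , 33 , 52 , 44 , 12 ⟩ ∷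
  ⟨ 62 , 39 , 69 , 15 , 12 ⟩ ∷ ⟨ 62 , 20 , 27 , 26 , 16 ⟩ ∷ ⟨ 57 , 42 , 28 , 45 , 44 ⟩ ∷
  ⟨ 69 , 47 , 24 , 44 , 45 ⟩ ∷ ⟨ 57 , 13 , 43 , 37 , 63 ⟩ ∷ ⟨ 23 , 59 , 41 , 7 , 49 ⟩ ∷
  ⟨ 20 , 55 , 22 , 34 , 71 ⟩ ∷ ⟨ 40 , 34 , 15 , 44 , 49 ⟩ ∷ ⟨ 49 , 18 , 0 , 45 , 40 ⟩ ∷ []

dd-75 : DD 75
dd-75 = CyclicDesign.dd 37 2 1 base-75 refl

base-81 : Vec (Vec ℕ 5) 8
base-81 =
  ⟨ 16 , 76 , 27 , 75 , 46 ⟩ ∷ ⟨ 80 , 8 , 55 , 1 , 23 ⟩ ∷ ⟨ 27 , 9 , 43 , 32 , 53 ⟩ ∷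
  ⟨ 34 , 71 , 74 , 28 , 32 ⟩ ∷ ⟨ 62 , 47 , 53 , 54 , 27 ⟩ ∷ ⟨ 0 , 50 , 68 , 64 , 45 ⟩ ∷
  ⟨ 16 , 57 , 4 , 47 , 33 ⟩ ∷ ⟨ 31 , 44 , 56 , 28 , 64 ⟩ ∷ []

dd-81 : DD 81
dd-81 = CyclicDesign.dd 81 1 0 base-81 refl

base-85 : Vec (Vec ℕ 5) 17
base-85 =
  ⟨ 77 , 65 , 28 , 31 , 29 ⟩ ∷ ⟨ 61 , 34 , 26 , 10 , 21 ⟩ ∷ ⟨ 67 , 26 , 22 , 5 , 60 ⟩ ∷
  ⟨ 33 , 64 , 84 , 11 , 54 ⟩ ∷ ⟨ 27 , 59 , 1 , 79 , 37 ⟩ ∷ ⟨ 28 , 43 , 13 , 74 , 55 ⟩ ∷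
  ⟨ 36 , 0 , 77 , 33 , 59 ⟩ ∷ ⟨ 37 , 66 , 53 , 10 , 70 ⟩ ∷ ⟨ 4 , 23 , 71 , 3 , 43 ⟩ ∷
  ⟨ 79 , 53 , 24 , 71 , 32 ⟩ ∷ ⟨ 70 , 55 , 32 , 76 , 3 ⟩ ∷ ⟨ 68 , 40 , 2 , 51 , 52 ⟩ ∷
  ⟨ 78 , 64 , 58 , 4 , 55 ⟩ ∷ ⟨ 39 , 21 , 9 , 2 , 11 ⟩ ∷ ⟨ 78 , 80 , 47 , 43 , 46 ⟩ ∷
  ⟨ 54 , 4 , 35 , 21 , 49 ⟩ ∷ ⟨ 26 , 50 , 48 , 33 , 63 ⟩ ∷ []

dd-85 : DD 85
dd-85 = CyclicDesign.dd 42 2 1 base-85 refl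

base-91 : Vec (Vec ℕ 5) 9
base-91 =
  ⟨ 12 , 56 , 14 , 1 , 71 ⟩ ∷ ⟨ 26 , 30 , 40 , 88 , 21 ⟩ ∷ ⟨ 28 , 41 , 61 , 5 , 31 ⟩ ∷
  ⟨ 83 , 33 , 19 , 84 , 11 ⟩ ∷ ⟨ 58 , 4 , 13 , 10 , 89 ⟩ ∷ ⟨ 53 , 33 , 65 , 49 , 87 ⟩ ∷
  ⟨ 68 , 6 , 51 , 79 , 27 ⟩ ∷ ⟨ 7 , 60 , 59 , 67 , 32 ⟩ ∷ ⟨ 57 , 50 , 80 , 55 , 6 ⟩ ∷ []

dd-91 : DD 91
dd-91 = CyclicDesign.dd 91 1 0 base-91 refl

base-95 : Vec (Vec ℕ 5) 19
base-95 =
  ⟨ 62 , 64 , 92 , 34 , 44 ⟩ ∷ ⟨ 52 , 0 , 73 , 28 , 20 ⟩ ∷ ⟨ 58 , 11 , 82 , 32 , 91 ⟩ ∷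
  ⟨ 47 , 31 , 25 , 62 , 37 ⟩ ∷ ⟨ 27 , 20 , 65 , 78 , 68 ⟩ ∷ ⟨ 31 , 61 , 94 , 83 , 19 ⟩ ∷
  ⟨ 6 , 81 , 69 , 63 , 30 ⟩ ∷ ⟨ 22 , 61 , 62 , 54 , 27 ⟩ ∷ ⟨ 26 , 8 , 22 , 11 , 9 ⟩ ∷
  ⟨ 24 , 71 , 47 , 3 , 85 ⟩ ∷ ⟨ 26 , 81 , 80 , 21 , 88 ⟩ ∷ ⟨ 42 , 13 , 46 , 10 , 12 ⟩ ∷
  ⟨ 18 , 8 , 84 , 82 , 54 ⟩ ∷ ⟨ 39 , 30 , 48 , 8 , 52 ⟩ ∷ ⟨ 10 , 52 , 29 , 78 , 37 ⟩ ∷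
  ⟨ 55 , 80 , 91 , 75 , 60 ⟩ ∷ ⟨ 51 , 13 , 22 , 44 , 47 ⟩ ∷ ⟨ 56 , 0 , 90 , 53 , 7 ⟩ ∷
  ⟨ 86 , 51 , 57 , 20 , 43 ⟩ ∷ []

dd-95 : DD 95
dd-95 = CyclicDesign.dd 47 2 1 base-95 refl

base-105 : Vec (Vec ℕ 5) 21
base-105 =
  ⟨ 32 , 40 , 0 , 46 , 65 ⟩ ∷ ⟨ 6 , 97 , 19 , 60 , 9 ⟩ ∷ ⟨ 51 , 93 , 80 , 101 , 37 ⟩ ∷
  ⟨ 103 , 22 , 65 , 41 , 10 ⟩ ∷ ⟨ 35 , 10 , 66 , 73 , 99 ⟩ ∷ ⟨ 84 , 83 , 0 , 37 , 9 ⟩ ∷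
  ⟨ 71 , 33 , 67 , 84 , 90 ⟩ ∷ ⟨ 91 , 63 , 46 , 5 , 101 ⟩ ∷ ⟨ 91 , 41 , 67 , 25 , 4 ⟩ ∷
  ⟨ 8 , 24 , 90 , 92 , 31 ⟩ ∷ ⟨ 71 , 66 , 69 , 101 , 60 ⟩ ∷ ⟨ 103 , 71 , 80 , 50 , 32 ⟩ ∷
  ⟨ 44 , 91 , 104 , 103 , 2 ⟩ ∷ ⟨ 50 , 24 , 2 , 20 , 49 ⟩ ∷ ⟨ 14 , 75 , 60 , 3 , 76 ⟩ ∷
  ⟨ 101 , 16 , 33 , 9 , 85 ⟩ ∷ ⟨ 75 , 93 , 23 , 97 , 72 ⟩ ∷ ⟨ 90 , 23 , 25 , 95 , 83 ⟩ ∷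
  ⟨ 68 , 8 , 43 , 40 , 41 ⟩ ∷ ⟨ 41 , 86 , 76 , 32 , 68 ⟩ ∷ ⟨ 43 , 30 , 35 , 58 , 83 ⟩ ∷ []

dd-105 : DD 105
dd-105 = CyclicDesign.dd 52 2 1 base-105 refl

base-115 : Vec (Vec ℕ 5) 23
base-115 =
  ⟨ 103 , 81 , 83 , 21 , 20 ⟩ ∷ ⟨ 68 , 96 , 19 , 31 , 82 ⟩ ∷ ⟨ 55 , 26 , 95 , 53 , 2 ⟩ ∷
  ⟨ 73 , 76 , 83 , 17 , 58 ⟩ ∷ ⟨ 80 , 6 , 41 , 64 , 76 ⟩ ∷ ⟨ 24 , 17 , 3 , 102 , 34 ⟩ ∷
  ⟨ 60 , 71 , 84 , 27 , 79 ⟩ ∷ ⟨ 112 , 54 , 109 , 102 , 70 ⟩ ∷ ⟨ 93 , 82 , 12 , 69 , 74 ⟩ ∷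
  ⟨ 9 , 70 , 20 , 29 , 96 ⟩ ∷ ⟨ 47 , 29 , 79 , 44 , 52 ⟩ ∷ ⟨ 40 , 47 , 4 , 30 , 76 ⟩ ∷
  ⟨ 28 , 3 , 94 , 93 , 47 ⟩ ∷ ⟨ 20 , 108 , 114 , 8 , 91 ⟩ ∷ ⟨ 110 , 39 , 82 , 59 , 76 ⟩ ∷
  ⟨ 109 , 40 , 100 , 79 , 24 ⟩ ∷ ⟨ 91 , 43 , 11 , 24 , 92 ⟩ ∷ ⟨ 85 , 107 , 105 , 53 , 54 ⟩ ∷
  ⟨ 31 , 3 , 105 , 33 , 27 ⟩ ∷ ⟨ 2 , 20 , 84 , 5 , 54 ⟩ ∷ ⟨ 57 , 12 , 66 , 28 , 87 ⟩ ∷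
  ⟨ 92 , 52 , 108 , 17 , 96 ⟩ ∷ ⟨ 2 , 112 , 48 , 39 , 86 ⟩ ∷ []

dd-115 : DD 115
dd-115 = CyclicDesign.dd 57 2 1 base-115 refl

base-131 : Vec (Vec ℕ 5) 13
base-131 =
  ⟨ 40 , 59 , 60 , 3 , 24 ⟩ ∷ ⟨ 89 , 117 , 37 , 119 , 11 ⟩ ∷ ⟨ 123 , 128 , 7 , 39 , 111 ⟩ ∷
  ⟨ 38 , 62 , 15 , 4 , 74 ⟩ ∷ ⟨ 87 , 1 , 126 , 32 , 130 ⟩ ∷ ⟨ 61 , 125 , 122 , 60 , 117 ⟩ ∷
  ⟨ 114 , 93 , 54 , 50 , 100 ⟩ ∷ ⟨ 105 , 81 , 28 , 8 , 37 ⟩ ∷ ⟨ 15 , 96 , 42 , 33 , 55 ⟩ ∷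
  ⟨ 74 , 126 , 3 , 44 , 88 ⟩ ∷ ⟨ 28 , 76 , 31 , 93 , 0 ⟩ ∷ ⟨ 9 , 89 , 122 , 115 , 100 ⟩ ∷
  ⟨ 27 , 17 , 129 , 33 , 116 ⟩ ∷ []

dd-131 : DD 131
dd-131 = CyclicDesign.dd 131 1 0 base-131 refl

base-135 : Vec (Vec ℕ 5) 27
base-135 =
  ⟨ 66 , 71 , 88 , 20 , 12 ⟩ ∷ ⟨ 67 , 99 , 124 , 132 , 105 ⟩ ∷ ⟨ 105 , 92 , 26 , 96 , 25 ⟩ ∷
  ⟨ 112 , 111 , 50 , 91 , 22 ⟩ ∷ ⟨ 65 , 30 , 115 , 89 , 126 ⟩ ∷ ⟨ 120 , 63 , 33 , 13 , 18 ⟩ ∷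
  ⟨ 62 , 46 , 98 , 28 , 76 ⟩ ∷ ⟨ 69 , 28 , 51 , 40 , 54 ⟩ ∷ ⟨ 64 , 28 , 99 , 85 , 4 ⟩ ∷
  ⟨ 44 , 35 , 113 , 69 , 118 ⟩ ∷ ⟨ 129 , 97 , 72 , 131 , 91 ⟩ ∷ ⟨ 45 , 78 , 134 , 121 , 20 ⟩ ∷
  ⟨ 99 , 13 , 51 , 53 , 11 ⟩ ∷ ⟨ 2 , 86 , 37 , 112 , 75 ⟩ ∷ ⟨ 90 , 126 , 75 , 48 , 87 ⟩ ∷
  ⟨ 19 , 81 , 65 , 6 , 131 ⟩ ∷ ⟨ 16 , 71 , 17 , 84 , 80 ⟩ ∷ ⟨ 64 , 84 , 54 , 77 , 60 ⟩ ∷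
  ⟨ 8 , 73 , 117 , 17 , 68 ⟩ ∷ ⟨ 34 , 64 , 17 , 12 , 111 ⟩ ∷ ⟨ 87 , 40 , 50 , 94 , 44 ⟩ ∷
  ⟨ 98 , 99 , 119 , 26 , 54 ⟩ ∷ ⟨ 5 , 21 , 103 , 39 , 125 ⟩ ∷ ⟨ 129 , 37 , 93 , 77 , 132 ⟩ ∷
  ⟨ 110 , 11 , 124 , 47 , 4 ⟩ ∷ ⟨ 84 , 29 , 108 , 48 , 10 ⟩ ∷ ⟨ 5 , 49 , 98 , 60 , 46 ⟩ ∷ []

dd-135 : DD 135
dd-135 = CyclicDesign.dd 67 2 1 base-135 refl

base-141 : Vec (Vec ℕ 5) 14
base-141 =
  ⟨ 23 , 93 , 10 , 63 , 137 ⟩ ∷ ⟨ 61 , 63 , 52 , 108 , 79 ⟩ ∷ ⟨ 95 , 108 , 109 , 117 , 18 ⟩ ∷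
  ⟨ 13 , 130 , 85 , 54 , 90 ⟩ ∷ ⟨ 57 , 133 , 60 , 72 , 40 ⟩ ∷ ⟨ 43 , 98 , 0 , 63 , 122 ⟩ ∷
  ⟨ 11 , 110 , 77 , 116 , 36 ⟩ ∷ ⟨ 5 , 128 , 4 , 138 , 91 ⟩ ∷ ⟨ 70 , 60 , 7 , 2 , 122 ⟩ ∷
  ⟨ 126 , 31 , 120 , 69 , 54 ⟩ ∷ ⟨ 39 , 110 , 136 , 88 , 76 ⟩ ∷ ⟨ 10 , 31 , 113 , 29 , 64 ⟩ ∷
  ⟨ 89 , 43 , 39 , 73 , 50 ⟩ ∷ ⟨ 29 , 114 , 4 , 1 , 33 ⟩ ∷ []

dd-141 : DD 141
dd-141 = CyclicDesign.dd 141 1 0 base-141 refl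

base-151 : Vec (Vec ℕ 5) 15
base-151 =
  ⟨ 86 , 71 , 5 , 136 , 84 ⟩ ∷ ⟨ 10 , 123 , 132 , 54 , 27 ⟩ ∷ ⟨ 143 , 86 , 69 , 87 , 24 ⟩ ∷
  ⟨ 142 , 95 , 111 , 67 , 58 ⟩ ∷ ⟨ 8 , 138 , 38 , 27 , 34 ⟩ ∷ ⟨ 65 , 139 , 42 , 71 , 143 ⟩ ∷
  ⟨ 92 , 87 , 150 , 74 , 33 ⟩ ∷ ⟨ 122 , 6 , 147 , 121 , 39 ⟩ ∷ ⟨ 73 , 13 , 51 , 65 , 122 ⟩ ∷
  ⟨ 150 , 131 , 60 , 21 , 83 ⟩ ∷ ⟨ 14 , 59 , 125 , 70 , 101 ⟩ ∷ ⟨ 143 , 140 , 4 , 148 , 97 ⟩ ∷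
  ⟨ 64 , 101 , 128 , 67 , 103 ⟩ ∷ ⟨ 12 , 71 , 36 , 22 , 6 ⟩ ∷ ⟨ 80 , 47 , 100 , 68 , 128 ⟩ ∷ []

dd-151 : DD 151
dd-151 = CyclicDesign.dd 151 1 0 base-151 refl

base-161 : Vec (Vec ℕ 5) 16
base-161 =
  ⟨ 103 , 104 , 21 , 127 , 78 ⟩ ∷ ⟨ 60 , 68 , 98 , 64 , 44 ⟩ ∷ ⟨ 31 , 111 , 83 , 10 , 75 ⟩ ∷
  ⟨ 1 , 156 , 51 , 72 , 109 ⟩ ∷ ⟨ 100 , 119 , 39 , 42 , 12 ⟩ ∷ ⟨ 155 , 66 , 49 , 55 , 117 ⟩ ∷
  ⟨ 142 , 99 , 40 , 68 , 27 ⟩ ∷ ⟨ 105 , 91 , 26 , 154 , 90 ⟩ ∷ ⟨ 112 , 147 , 159 , 27 , 18 ⟩ ∷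
  ⟨ 141 , 50 , 151 , 148 , 119 ⟩ ∷ ⟨ 38 , 81 , 74 , 69 , 83 ⟩ ∷ ⟨ 52 , 118 , 145 , 78 , 100 ⟩ ∷
  ⟨ 65 , 148 , 3 , 78 , 21 ⟩ ∷ ⟨ 21 , 54 , 2 , 140 , 19 ⟩ ∷ ⟨ 43 , 133 , 158 , 148 , 82 ⟩ ∷
  ⟨ 81 , 33 , 44 , 155 , 86 ⟩ ∷ []

dd-161 : DD 161
dd-161 = CyclicDesign.dd 161 1 0 base-161 refl

base-181 : Vec (Vec ℕ 5) 18
base-181 =
  ⟨ 156 , 146 , 175 , 76 , 29 ⟩ ∷ ⟨ 31 , 100 , 162 , 126 , 153 ⟩ ∷ ⟨ 147 , 91 , 45 , 84 , 142 ⟩ ∷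
  ⟨ 62 , 167 , 38 , 134 , 178 ⟩ ∷ ⟨ 74 , 86 , 178 , 70 , 88 ⟩ ∷ ⟨ 132 , 140 , 180 , 119 , 174 ⟩ ∷
  ⟨ 165 , 153 , 61 , 169 , 151 ⟩ ∷ ⟨ 3 , 115 , 53 , 89 , 62 ⟩ ∷ ⟨ 121 , 131 , 102 , 20 , 67 ⟩ ∷
  ⟨ 40 , 32 , 173 , 53 , 179 ⟩ ∷ ⟨ 160 , 66 , 159 , 9 , 46 ⟩ ∷ ⟨ 132 , 27 , 156 , 60 , 16 ⟩ ∷
  ⟨ 16 , 180 , 59 , 44 , 82 ⟩ ∷ ⟨ 144 , 57 , 145 , 114 , 77 ⟩ ∷ ⟨ 109 , 34 , 31 , 9 , 141 ⟩ ∷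
  ⟨ 42 , 59 , 180 , 14 , 157 ⟩ ∷ ⟨ 93 , 168 , 171 , 12 , 61 ⟩ ∷ ⟨ 43 , 99 , 145 , 106 , 48 ⟩ ∷ []

dd-181 : DD 181
dd-181 = CyclicDesign.dd 181 1 0 base-181 refl

base-191 : Vec (Vec ℕ 5) 19
base-191 =
  ⟨ 177 , 144 , 40 , 126 , 71 ⟩ ∷ ⟨ 82 , 155 , 12 , 62 , 46 ⟩ ∷ ⟨ 51 , 48 , 70 , 75 , 182 ⟩ ∷
  ⟨ 3 , 24 , 12 , 5 , 44 ⟩ ∷ ⟨ 174 , 63 , 182 , 124 , 130 ⟩ ∷ ⟨ 5 , 16 , 54 , 183 , 122 ⟩ ∷
  ⟨ 135 , 97 , 110 , 15 , 0 ⟩ ∷ ⟨ 183 , 38 , 68 , 34 , 108 ⟩ ∷ ⟨ 170 , 129 , 173 , 92 , 83 ⟩ ∷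
  ⟨ 67 , 24 , 151 , 50 , 103 ⟩ ∷ ⟨ 76 , 9 , 101 , 165 , 7 ⟩ ∷ ⟨ 120 , 112 , 135 , 106 , 67 ⟩ ∷
  ⟨ 172 , 188 , 125 , 59 , 162 ⟩ ∷ ⟨ 98 , 68 , 167 , 127 , 145 ⟩ ∷ ⟨ 146 , 92 , 104 , 27 , 147 ⟩ ∷
  ⟨ 62 , 150 , 61 , 34 , 127 ⟩ ∷ ⟨ 84 , 94 , 129 , 98 , 189 ⟩ ∷ ⟨ 116 , 57 , 8 , 36 , 25 ⟩ ∷
  ⟨ 119 , 176 , 36 , 171 , 43 ⟩ ∷ []

dd-191 : DD 191
dd-191 = CyclicDesign.dd 191 1 0 base-191 refl

base-211 : Vec (Vec ℕ 5) 21
base-211 =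
  ⟨ 115 , 176 , 136 , 117 , 153 ⟩ ∷ ⟨ 119 , 167 , 34 , 22 , 173 ⟩ ∷ ⟨ 10 , 188 , 81 , 144 , 51 ⟩ ∷
  ⟨ 33 , 134 , 162 , 144 , 6 ⟩ ∷ ⟨ 59 , 35 , 117 , 14 , 196 ⟩ ∷ ⟨ 208 , 129 , 205 , 40 , 27 ⟩ ∷
  ⟨ 51 , 192 , 25 , 131 , 43 ⟩ ∷ ⟨ 185 , 197 , 31 , 116 , 169 ⟩ ∷ ⟨ 55 , 188 , 132 , 41 , 125 ⟩ ∷
  ⟨ 205 , 118 , 66 , 185 , 9 ⟩ ∷ ⟨ 37 , 61 , 20 , 27 , 173 ⟩ ∷ ⟨ 177 , 123 , 25 , 52 , 57 ⟩ ∷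
  ⟨ 78 , 40 , 130 , 115 , 138 ⟩ ∷ ⟨ 202 , 149 , 163 , 41 , 138 ⟩ ∷ ⟨ 74 , 70 , 27 , 162 , 201 ⟩ ∷
  ⟨ 154 , 145 , 196 , 165 , 194 ⟩ ∷ ⟨ 131 , 7 , 196 , 16 , 41 ⟩ ∷ ⟨ 121 , 27 , 189 , 143 , 190 ⟩ ∷
  ⟨ 172 , 104 , 185 , 130 , 68 ⟩ ∷ ⟨ 191 , 105 , 108 , 124 , 73 ⟩ ∷ ⟨ 88 , 193 , 188 , 92 , 187 ⟩ ∷ []

dd-211 : DD 211
dd-211 = CyclicDesign.dd 211 1 0 base-211 refl

base-311 : Vec (Vec ℕ 5) 31
base-311 =
  ⟨ 170 , 37 , 108 , 93 , 289 ⟩ ∷ ⟨ 188 , 296 , 124 , 0 , 300 ⟩ ∷ ⟨ 26 , 230 , 294 , 140 , 87 ⟩ ∷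
  ⟨ 285 , 294 , 16 , 191 , 281 ⟩ ∷ ⟨ 178 , 269 , 170 , 189 , 206 ⟩ ∷ ⟨ 167 , 192 , 29 , 116 , 161 ⟩ ∷
  ⟨ 191 , 290 , 23 , 80 , 139 ⟩ ∷ ⟨ 99 , 115 , 161 , 1 , 70 ⟩ ∷ ⟨ 123 , 244 , 247 , 21 , 176 ⟩ ∷
  ⟨ 154 , 32 , 67 , 34 , 193 ⟩ ∷ ⟨ 261 , 67 , 299 , 1 , 81 ⟩ ∷ ⟨ 107 , 34 , 71 , 137 , 10 ⟩ ∷
  ⟨ 188 , 171 , 172 , 267 , 31 ⟩ ∷ ⟨ 302 , 101 , 219 , 75 , 106 ⟩ ∷ ⟨ 43 , 4 , 215 , 297 , 53 ⟩ ∷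
  ⟨ 238 , 1 , 245 , 74 , 137 ⟩ ∷ ⟨ 137 , 275 , 270 , 243 , 293 ⟩ ∷ ⟨ 73 , 252 , 70 , 159 , 300 ⟩ ∷
  ⟨ 62 , 4 , 226 , 184 , 206 ⟩ ∷ ⟨ 37 , 294 , 12 , 293 , 3 ⟩ ∷ ⟨ 9 , 171 , 143 , 183 , 248 ⟩ ∷
  ⟨ 215 , 97 , 2 , 239 , 291 ⟩ ∷ ⟨ 241 , 273 , 203 , 163 , 115 ⟩ ∷ ⟨ 291 , 72 , 7 , 132 , 297 ⟩ ∷
  ⟨ 230 , 186 , 256 , 65 , 174 ⟩ ∷ ⟨ 196 , 149 , 100 , 15 , 307 ⟩ ∷ ⟨ 283 , 27 , 246 , 13 , 85 ⟩ ∷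
  ⟨ 291 , 231 , 299 , 125 , 115 ⟩ ∷ ⟨ 214 , 72 , 308 , 179 , 31 ⟩ ∷ ⟨ 77 , 243 , 131 , 174 , 124 ⟩ ∷
  ⟨ 99 , 201 , 199 , 76 , 282 ⟩ ∷ []

dd-311 : DD 311
dd-311 = CyclicDesign.dd 311 1 0 base-311 refl

-- Small orders from the recursions

-- A single point of weight 2 makes sizes of the sixth group such as 10, 30, 34 and 54 possible,
-- which are not multiples of 4.
truncate-4 : ∀ {m} → TD 6 m → ∀ p q {p+q≤m : True (p + q ≤? m)} →
  DD (m * 4 + 1) → DD (p * 4 + q * 2 + 1) → DD (p * 4 + q * 2 + 5 * (m * 4) + 1)
truncate-4 T p q {p+q≤m} =
  truncated-TD-steps T 4 p q (toWitness p+q≤m) (equalSizes gdd-4-6) gdd-4-5-2 (addEmpty gdd-4-5)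

truncate-10-≤ : ∀ {m} → TD 6 m → ∀ p q → p + q ≤ m →
  DD (m * 10 + 1) → DD (p * 4 + q * 10 + 1) → DD (p * 4 + q * 10 + 5 * (m * 10) + 1)
truncate-10-≤ T p q p+q≤m =
  truncated-TD-steps T 10 p q p+q≤m gdd-10-5-4 (equalSizes gdd-10-6) (addEmpty gdd-10-5)

truncate-10 : ∀ {m} → TD 6 m → ∀ p q {p+q≤m : True (p + q ≤? m)} →
  DD (m * 10 + 1) → DD (p * 4 + q * 10 + 1) → DD (p * 4 + q * 10 + 5 * (m * 10) + 1)
truncate-10 T p q {p+q≤m} = truncate-10-≤ T p q (toWitness p+q≤m)

dd-51 : DD 51
dd-51 = fill-uniform 1 gdd-10-5 dd-11

dd-61 : DD 61
dd-61 = fill-uniform 1 gdd-10-6 dd-11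

dd-101 : DD 101
dd-101 = truncate-4 (td₆ (coprime₅ 0)) 0 0 dd-21 dd-1

dd-111 : DD 111
dd-111 = truncate-4 (td₆ (coprime₅ 0)) 2 1 dd-21 dd-11

dd-121 : DD 121
dd-121 = truncate-4 (td₆ (coprime₅ 0)) 5 0 dd-21 dd-21

dd-125 : DD 125
dd-125 = fill-uniform 0 (twoTD (coprime₁ 4)) dd-25

dd-145 : DD 145
dd-145 = inflated 6 1 gdd-6-6 td-5-4 dd-25

dd-155 : DD 155
dd-155 = fill-uniform 0 (twoTD (coprime₁ 5)) dd-31

dd-165 : DD 165
dd-165 = inflated-hole 4 5 (fromEqualSizes gdd-4-10) td-5-4 dd-21 incomplete-21

dd-171 : DD 171
dd-171 = fill-uniform 1 gdd-10-17 dd-11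

dd-175 : DD 175
dd-175 = fill-uniform 0 (twoTD (coprime₅ 5)) dd-35

dd-185 : DD 185
dd-185 = inflated-hole 4 5 gdd-4-5 (dropColumn td-6-9) dd-41 incomplete-41

dd-195 : DD 195
dd-195 = fill-DD 1 (sizes 17 10 24) (λ _ → ↔-refl) gdd-10-17-24 λ { zero → dd-25 ; (suc _) → dd-11 }

dd-201 : DD 201
dd-201 = inflated 5 1 (twoTD (coprime₅ 0)) (dropColumn td-6-8) dd-41

dd-205 : DD 205
dd-205 = fill-uniform 0 (twoTD (coprime₅ 6)) dd-41

dd-215 : DD 215
dd-215 = truncated-TD-hole td-6-9 4 5 (steps 7 1 4 2 9)
  (steps-elim (Ingredient 4) 7 1 4 2 9 (equalSizes gdd-4-6) gdd-4-5-2 (addEmpty gdd-4-5)) incomplete-41 dd-35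

dd-221 : DD 221
dd-221 = truncate-4 (td₆ (coprime₅ 1)) 0 0 dd-45 dd-1

dd-225 : DD 225
dd-225 = inflated 5 0 (twoTD (coprime₅ 0)) (dropColumn td-6-9) dd-45

dd-231 : DD 231
dd-231 = truncate-4 (td₆ (coprime₅ 1)) 2 1 dd-45 dd-11

-- The sum is 34, so that 235 = 5 · 40 + 34 + 1, and the groups are completed to orders 41 and 35.
weights-235 : Fin 5 → ℕ
weights-235 = Vec.lookup (10 ∷ 8 ∷ 8 ∷ 4 ∷ 4 ∷ [])

ingredients-235 : ∀ a → Ingredient 8 (weights-235 a)
ingredients-235 zero                         = gdd-8-5-10
ingredients-235 (suc zero)                   = equalSizes gdd-8-6
ingredients-235 (suc (suc zero))             = equalSizes gdd-8-6
ingredients-235 (suc (suc (suc zero)))       = gdd-8-5-4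
ingredients-235 (suc (suc (suc (suc zero)))) = gdd-8-5-4

dd-235 : DD 235
dd-235 = truncated-TD (td₆ (coprime₅ 0)) 8 weights-235 ingredients-235 dd-41 dd-35

dd-241 : DD 241
dd-241 = truncate-4 (td₆ (coprime₅ 1)) 5 0 dd-45 dd-21

dd-245 : DD 245
dd-245 = truncate-4 (td₆ (coprime₅ 1)) 6 0 dd-45 dd-25

dd-251 : DD 251
dd-251 = truncate-10 (td₆ (coprime₅ 0)) 0 0 dd-51 dd-1

dd-255 : DD 255
dd-255 = truncate-4 (td₆ (coprime₅ 1)) 8 1 dd-45 dd-35

dd-261 : DD 261
dd-261 = truncate-10 (td₆ (coprime₅ 0)) 0 1 dd-51 dd-11

dd-265 : DD 265
dd-265 = truncate-4 (td₆ (coprime₅ 1)) 11 0 dd-45 dd-45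

-- The boundary case t = m. It is open to the residue 1 only, because the residue 5 reserves one
-- point of the sixth group for weight 4.
dd-301 : DD 301
dd-301 = truncate-10 (td₆ (coprime₅ 0)) 0 5 dd-51 dd-51

dd-305 : DD 305
dd-305 = fill-uniform 0 (twoTD (coprime₁ 10)) dd-61

dd-315 : DD 315
dd-315 = inflated 5 0 gdd-5-7 (dropColumn td-6-9) dd-45

dd-321 : DD 321
dd-321 = truncate-4 td-6-15 5 0 dd-61 dd-21

dd-325 : DD 325
dd-325 = truncate-4 td-6-15 6 0 dd-61 dd-25

dd-331 : DD 331
dd-331 = truncate-4 td-6-15 7 1 dd-61 dd-31

dd-335 : DD 335
dd-335 = truncate-4 td-6-15 8 1 dd-61 dd-35

dd-341 : DD 341
dd-341 = truncate-4 td-6-15 10 0 dd-61 dd-41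

dd-345 : DD 345
dd-345 = truncate-4 td-6-15 11 0 dd-61 dd-45

dd-351 : DD 351
dd-351 = truncate-10 (td₆ (coprime₁ 1)) 0 0 dd-71 dd-1

dd-355 : DD 355
dd-355 = truncate-4 td-6-15 13 1 dd-61 dd-55

dd-361 : DD 361
dd-361 = truncate-10 (td₆ (coprime₁ 1)) 0 1 dd-71 dd-11

dd-365 : DD 365
dd-365 = truncate-4 td-6-16 11 0 dd-65 dd-45

dd-421 : DD 421
dd-421 = truncate-10 (td₆ (coprime₁ 1)) 0 7 dd-71 dd-71

dd-425 : DD 425
dd-425 = truncate-10 td-6-8 1 2 dd-81 dd-25

dd-431 : DD 431
dd-431 = truncate-10 td-6-8 0 3 dd-81 dd-31

dd-435 : DD 435
dd-435 = truncate-10 td-6-8 1 3 dd-81 dd-35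

dd-441 : DD 441
dd-441 = truncate-10 td-6-8 0 4 dd-81 dd-41

dd-445 : DD 445
dd-445 = truncate-10 td-6-8 1 4 dd-81 dd-45

dd-451 : DD 451
dd-451 = truncate-10 td-6-8 0 5 dd-81 dd-51

dd-455 : DD 455
dd-455 = truncate-10 td-6-8 1 5 dd-81 dd-55

dd-461 : DD 461
dd-461 = truncate-10 td-6-8 0 6 dd-81 dd-61

dd-465 : DD 465
dd-465 = truncate-10 td-6-8 1 6 dd-81 dd-65

dd-471 : DD 471
dd-471 = truncate-10 td-6-8 0 7 dd-81 dd-71

dd-475 : DD 475
dd-475 = truncate-10 td-6-8 1 7 dd-81 dd-75

dd-481 : DD 481
dd-481 = truncate-10 td-6-8 0 8 dd-81 dd-81

dd-485 : DD 485
dd-485 = truncate-10 td-6-9 1 3 dd-91 dd-35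

dd-491 : DD 491
dd-491 = truncate-10 td-6-9 0 4 dd-91 dd-41

dd-495 : DD 495
dd-495 = truncate-10 td-6-9 1 4 dd-91 dd-45

dd-501 : DD 501
dd-501 = truncate-10 td-6-9 0 5 dd-91 dd-51

dd-505 : DD 505
dd-505 = truncate-10 td-6-9 1 5 dd-91 dd-55

dd-511 : DD 511
dd-511 = truncate-10 td-6-9 0 6 dd-91 dd-61

dd-515 : DD 515
dd-515 = truncate-10 td-6-9 1 6 dd-91 dd-65

dd-521 : DD 521
dd-521 = truncate-10 td-6-9 0 7 dd-91 dd-71

dd-525 : DD 525
dd-525 = truncate-10 td-6-9 1 7 dd-91 dd-75

dd-531 : DD 531
dd-531 = truncate-10 td-6-9 0 8 dd-91 dd-81

dd-535 : DD 535
dd-535 = truncate-10 td-6-9 1 8 dd-91 dd-85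

dd-541 : DD 541
dd-541 = truncate-10 td-6-9 0 9 dd-91 dd-91

dd-545 : DD 545
dd-545 = truncate-4 (td₆ (coprime₁ 4)) 11 0 dd-101 dd-45

dd-551 : DD 551
dd-551 = truncate-10 (td₆ (coprime₅ 1)) 0 0 dd-111 dd-1

dd-555 : DD 555
dd-555 = truncate-4 (td₆ (coprime₁ 4)) 13 1 dd-101 dd-55

dd-561 : DD 561
dd-561 = truncate-10 (td₆ (coprime₅ 1)) 0 1 dd-111 dd-11

dd-565 : DD 565
dd-565 = truncate-4 (td₆ (coprime₁ 4)) 16 0 dd-101 dd-65

dd-661 : DD 661
dd-661 = truncate-10 (td₆ (coprime₅ 1)) 0 11 dd-111 dd-111

dd-665 : DD 665
dd-665 = truncate-4 (td₆ (coprime₁ 5)) 11 0 dd-125 dd-45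

dd-781 : DD 781
dd-781 = truncate-10 (td₆ (coprime₁ 2)) 0 13 dd-131 dd-131

dd-785 : DD 785
dd-785 = truncate-10 td-6-15 1 3 dd-151 dd-35

dd-791 : DD 791
dd-791 = truncate-10 td-6-15 0 4 dd-151 dd-41

dd-795 : DD 795
dd-795 = truncate-10 td-6-15 1 4 dd-151 dd-45

dd-801 : DD 801
dd-801 = truncate-10 td-6-15 0 5 dd-151 dd-51

dd-805 : DD 805
dd-805 = truncate-10 td-6-15 1 5 dd-151 dd-55

dd-811 : DD 811
dd-811 = truncate-10 td-6-15 0 6 dd-151 dd-61

dd-815 : DD 815
dd-815 = truncate-10 td-6-15 1 6 dd-151 dd-65

dd-821 : DD 821
dd-821 = truncate-10 td-6-15 0 7 dd-151 dd-71

dd-825 : DD 825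
dd-825 = truncate-10 td-6-15 1 7 dd-151 dd-75

dd-831 : DD 831
dd-831 = truncate-10 td-6-15 0 8 dd-151 dd-81

dd-835 : DD 835
dd-835 = truncate-10 td-6-15 1 8 dd-151 dd-85

dd-841 : DD 841
dd-841 = truncate-10 td-6-15 0 9 dd-151 dd-91

dd-845 : DD 845
dd-845 = truncate-10 td-6-15 1 9 dd-151 dd-95

dd-851 : DD 851
dd-851 = truncate-10 td-6-15 0 10 dd-151 dd-101

dd-855 : DD 855
dd-855 = truncate-10 td-6-15 1 10 dd-151 dd-105

dd-861 : DD 861
dd-861 = truncate-10 td-6-15 0 11 dd-151 dd-111

dd-865 : DD 865
dd-865 = truncate-10 td-6-15 1 11 dd-151 dd-115

dd-1141 : DD 1141
dd-1141 = truncate-10 (td₆ (coprime₁ 3)) 0 19 dd-191 dd-191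

dd-1145 : DD 1145
dd-1145 = truncate-4 (td₆ (coprime₁ 9)) 11 0 dd-221 dd-45

dd-1151 : DD 1151
dd-1151 = truncate-10 (td₆ (coprime₅ 3)) 0 0 dd-231 dd-1

dd-1155 : DD 1155
dd-1155 = truncate-4 (td₆ (coprime₁ 9)) 13 1 dd-221 dd-55

dd-1161 : DD 1161
dd-1161 = truncate-10 (td₆ (coprime₅ 3)) 0 1 dd-231 dd-11

dd-1165 : DD 1165
dd-1165 = truncate-4 (td₆ (coprime₁ 9)) 16 0 dd-221 dd-65

-- The m below 23 that are used for splitting reach the intervals from 5m + 2 to 6m - 1: 27-29,
-- 37-41, 57-65, 67-77, 87-101 and 97-113. Listed are the values from 2 to 116 in the gaps.
exceptions₁ : List (Σ ℕ λ n → DD (n * 10 + 1))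
exceptions₁ =
  (2 , dd-21) ∷ (3 , dd-31) ∷ (4 , dd-41) ∷ (5 , dd-51) ∷ (6 , dd-61) ∷ (7 , dd-71) ∷ (8 , dd-81) ∷
  (9 , dd-91) ∷ (10 , dd-101) ∷ (11 , dd-111) ∷ (12 , dd-121) ∷ (13 , dd-131) ∷ (14 , dd-141) ∷
  (15 , dd-151) ∷ (16 , dd-161) ∷ (17 , dd-171) ∷ (18 , dd-181) ∷ (19 , dd-191) ∷ (20 , dd-201) ∷
  (21 , dd-211) ∷ (22 , dd-221) ∷ (23 , dd-231) ∷ (24 , dd-241) ∷ (25 , dd-251) ∷ (26 , dd-261) ∷
  (30 , dd-301) ∷ (31 , dd-311) ∷ (32 , dd-321) ∷ (33 , dd-331) ∷ (34 , dd-341) ∷ (35 , dd-351) ∷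
  (36 , dd-361) ∷ (42 , dd-421) ∷ (43 , dd-431) ∷ (44 , dd-441) ∷ (45 , dd-451) ∷ (46 , dd-461) ∷
  (47 , dd-471) ∷ (48 , dd-481) ∷ (49 , dd-491) ∷ (50 , dd-501) ∷ (51 , dd-511) ∷ (52 , dd-521) ∷
  (53 , dd-531) ∷ (54 , dd-541) ∷ (55 , dd-551) ∷ (56 , dd-561) ∷ (66 , dd-661) ∷ (78 , dd-781) ∷
  (79 , dd-791) ∷ (80 , dd-801) ∷ (81 , dd-811) ∷ (82 , dd-821) ∷ (83 , dd-831) ∷ (84 , dd-841) ∷
  (85 , dd-851) ∷ (86 , dd-861) ∷ (114 , dd-1141) ∷ (115 , dd-1151) ∷ (116 , dd-1161) ∷ []

exceptions₅ : List (Σ ℕ λ n → DD (n * 10 + 5))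
exceptions₅ =
  (2 , dd-25) ∷ (3 , dd-35) ∷ (4 , dd-45) ∷ (5 , dd-55) ∷ (6 , dd-65) ∷ (7 , dd-75) ∷ (8 , dd-85) ∷
  (9 , dd-95) ∷ (10 , dd-105) ∷ (11 , dd-115) ∷ (12 , dd-125) ∷ (13 , dd-135) ∷ (14 , dd-145) ∷
  (15 , dd-155) ∷ (16 , dd-165) ∷ (17 , dd-175) ∷ (18 , dd-185) ∷ (19 , dd-195) ∷ (20 , dd-205) ∷
  (21 , dd-215) ∷ (22 , dd-225) ∷ (23 , dd-235) ∷ (24 , dd-245) ∷ (25 , dd-255) ∷ (26 , dd-265) ∷
  (30 , dd-305) ∷ (31 , dd-315) ∷ (32 , dd-325) ∷ (33 , dd-335) ∷ (34 , dd-345) ∷ (35 , dd-355) ∷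
  (36 , dd-365) ∷ (42 , dd-425) ∷ (43 , dd-435) ∷ (44 , dd-445) ∷ (45 , dd-455) ∷ (46 , dd-465) ∷
  (47 , dd-475) ∷ (48 , dd-485) ∷ (49 , dd-495) ∷ (50 , dd-505) ∷ (51 , dd-515) ∷ (52 , dd-525) ∷
  (53 , dd-535) ∷ (54 , dd-545) ∷ (55 , dd-555) ∷ (56 , dd-565) ∷ (66 , dd-665) ∷ (78 , dd-785) ∷
  (79 , dd-795) ∷ (80 , dd-805) ∷ (81 , dd-815) ∷ (82 , dd-825) ∷ (83 , dd-835) ∷ (84 , dd-845) ∷
  (85 , dd-855) ∷ (86 , dd-865) ∷ (114 , dd-1145) ∷ (115 , dd-1155) ∷ (116 , dd-1165) ∷ []

-- Induction on the order

-- Tuned to the residue 5: t = 0 and t = 1 would call for the orders 5 and 15, and t < m leaves a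
-- point for weight 4.
record Split (n : ℕ) : Set₁ where
  constructor splits
  field
    {m t} : ℕ
    td    : TD 6 m
    2≤t   : 2 ≤ t
    t<m   : t < m
    n≡    : n ≡ 5 * m + t

-- With m = 23 + 6j and m = 25 + 6j the values 5m + 2 are 117 + 30j and 127 + 30j. Runs of 10 and 20
-- values of t from there fill a period of 30, since the next m is 29 + 6j. The largest t used, 11
-- and 21, stay below m.
split-large : ∀ j r → r < 30 → Split (117 + (j * 30 + r))
split-large j r r<30 with r <ⁿ? 10
... | yes r<10 = splits (td₆ (coprime₅ (3 + j))) (s≤s (s≤s z≤n))
      (≤-trans (s≤s (s≤s r<10)) (m≤m+n 12 (11 + j * 6))) (eq j r)
  where
  eq : ∀ j r → 117 + (j * 30 + r) ≡ 5 * (5 + (3 + j) * 6) + (2 + r)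
  eq = solve-∀
... | no r≮10 with m≤n⇒∃[o]m+o≡n (≮⇒≥ r≮10)
...   | s , refl = splits (td₆ (coprime₁ (4 + j))) (s≤s (s≤s z≤n))
        (≤-trans (+-cancelˡ-≤ 8 (3 + s) 22 r<30) (bound j)) (eq j s)
  where
  eq : ∀ j s → 117 + (j * 30 + (10 + s)) ≡ 5 * (1 + (4 + j) * 6) + (2 + s)
  eq = solve-∀
  bound : ∀ j → 22 ≤ 1 + (4 + j) * 6
  bound j = m≤m+n 22 (3 + j * 6)

trySplit : ∀ n {m} → TD 6 m → Maybe (Split n)
trySplit n {m} T with 2 ≤? n ∸ 5 * m | n ∸ 5 * m <ⁿ? m | n ≟ⁿ 5 * m + (n ∸ 5 * m)
... | yes 2≤t | yes t<m | yes n≡ = just (splits T 2≤t t<m n≡)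
... | _       | _       | _      = nothing

-- The values m = 5, 7, 11, 13, 17, 19; the next one coprime to 6 is 23, where `split-large` begins.
find-split : ∀ n → Maybe (Split n)
find-split n = trySplit n (td₆ (coprime₅ 0)) <∣> trySplit n (td₆ (coprime₁ 1)) <∣> trySplit n (td₆ (coprime₅ 1))
           <∣> trySplit n (td₆ (coprime₁ 2)) <∣> trySplit n (td₆ (coprime₅ 2)) <∣> trySplit n (td₆ (coprime₁ 3))

find-entry : ∀ {P : ℕ → Set₁} → List (Σ ℕ P) → ∀ n → Maybe (P n)
find-entry []             n = nothing
find-entry ((k , p) ∷ ps) n with k ≟ⁿ n
... | yes refl = just p
... | no  _    = find-entry ps n

-- Asks only whether an entry or a splitting exists, so evaluating it for all n < 117 leaves the
-- designs themselves unevaluated.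
covered : ∀ {P : ℕ → Set₁} → List (Σ ℕ P) → ℕ → Bool
covered exceptions n = (n <ᵇ 2) ∨ is-just (find-entry exceptions n) ∨ is-just (find-split n)

module Recursion (r : ℕ) (exceptions : List (Σ ℕ λ n → DD (n * 10 + r)))
  (step : ∀ {m t} → TD 6 m → t < m → DD (m * 10 + 1) → DD (t * 10 + r) → DD ((5 * m + t) * 10 + r))
  (complete : all 117 (covered exceptions ∘ toℕ) ≡ true)
  where

  Goal : ℕ → Set₁
  Goal n = 2 ≤ n → DD (n * 10 + r)

  by-split : ∀ n → (∀ {m} → m < n → Goal m) → (∀ {m} → m < n → 2 ≤ m → DD (m * 10 + 1)) → Split n → DD (n * 10 + r)
  by-split n rec first (splits {m} {t} T 2≤t t<m refl) =
    step T t<m (first m<n (≤-trans 2≤t (<⇒≤ t<m))) (rec t<n 2≤t)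
    where
    0<t : 0 < t
    0<t = ≤-trans (s≤s z≤n) 2≤t
    m<n : m < 5 * m + t
    m<n = ≤-trans (≤-trans (≤-reflexive (+-comm 1 m)) (+-monoʳ-≤ m 0<t)) (+-monoˡ-≤ t (m≤m+n m (4 * m)))
    t<n : t < 5 * m + t
    t<n = ≤-trans t<m (≤-trans (m≤m+n m (4 * m)) (m≤m+n (5 * m) t))

  from-maybe : ∀ {ℓ ℓ′} {A : Set ℓ} {B : Set ℓ′} {a} (x : Maybe A) (y : Maybe B) →
               a ∨ is-just x ∨ is-just y ≡ true → a ≡ false → A ⊎ B
  from-maybe {a = false} (just x) _        _ _ = inj₁ x
  from-maybe {a = false} nothing  (just y) _ _ = inj₂ y

  not-<2 : ∀ {n} → 2 ≤ n → (n <ᵇ 2) ≡ false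
  not-<2 (s≤s (s≤s _)) = refl

  small : ∀ n → n < 117 → covered exceptions n ≡ true
  small n n<117 = subst (λ n → covered exceptions n ≡ true) (toℕ-fromℕ< n<117)
    (all-sound 117 (covered exceptions ∘ toℕ) complete (fromℕ< n<117))

  large : ∀ n k → 117 + k ≡ n → Split n
  large n k eq = subst Split (trans (cong (117 +_)
    (trans (+-comm (k / 30 * 30) (k % 30)) (sym (m≡m%n+[m/n]*n k 30)))) eq)
    (split-large (k / 30) (k % 30) (m%n<n k 30))

  entry-or-split : ∀ n → 2 ≤ n → Dec (n < 117) → DD (n * 10 + r) ⊎ Split n
  entry-or-split n 2≤n (yes n<117) =
    from-maybe (find-entry exceptions n) (find-split n) (small n n<117) (not-<2 2≤n)
  entry-or-split n 2≤n (no n≮117) = inj₂ (large n (n ∸ 117) (m+[n∸m]≡n (≮⇒≥ n≮117)))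

  -- The full groups have order 10m + 1 for either residue. The argument `first` supplies them: the
  -- induction hypothesis itself for residue 1, the finished result `dd-10n+1` for residue 5.
  existence : (∀ n → (∀ {m} → m < n → Goal m) → ∀ {m} → m < n → 2 ≤ m → DD (m * 10 + 1)) → ∀ n → Goal n
  existence first = <-rec Goal λ n rec 2≤n → [ (λ D → D) , by-split n rec (first n rec) ]′ (entry-or-split n 2≤n (n <ⁿ? 117))

step₁ : ∀ {m t} → TD 6 m → t < m → DD (m * 10 + 1) → DD (t * 10 + 1) → DD ((5 * m + t) * 10 + 1)
step₁ {m} {t} T t<m D E = subst DD (eq m t) (truncate-10-≤ T 0 t (<⇒≤ t<m) D E)
  where
  eq : ∀ m t → t * 10 + 5 * (m * 10) + 1 ≡ (5 * m + t) * 10 + 1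
  eq = solve-∀

step₅ : ∀ {m t} → TD 6 m → t < m → DD (m * 10 + 1) → DD (t * 10 + 5) → DD ((5 * m + t) * 10 + 5)
-- One point of weight 4 and t of weight 10 make the sixth group, with the new point, of order 10t +
-- 5.
step₅ {m} {t} T t<m D E = subst DD (eq m t) (truncate-10-≤ T 1 t t<m D (subst DD (eq′ t) E))
  where
  eq : ∀ m t → 4 + t * 10 + 5 * (m * 10) + 1 ≡ (5 * m + t) * 10 + 5
  eq = solve-∀
  eq′ : ∀ t → t * 10 + 5 ≡ 4 + t * 10 + 1
  eq′ = solve-∀

dd-10n+1 : ∀ n → DD (n * 10 + 1)
dd-10n+1 0 = dd-1
dd-10n+1 1 = dd-11
dd-10n+1 (suc (suc n)) = Recursion.existence 1 exceptions₁ step₁ refl (λ _ rec → rec) (suc (suc n)) (s≤s (s≤s z≤n))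

dd-10n+5 : ∀ n → 2 ≤ n → DD (n * 10 + 5)
dd-10n+5 = Recursion.existence 5 exceptions₅ step₅ refl (λ _ _ {m} _ _ → dd-10n+1 m)

v≡ : ∀ {v r} → v % 10 ≡ r → v ≡ v / 10 * 10 + r
v≡ {v} refl = trans (m≡m%n+[m/n]*n v 10) (+-comm (v % 10) (v / 10 * 10))

theorem3p4 : (v : ℕ) → (v % 10 ≡ 1 ⊎ v % 10 ≡ 5) → v ≢ 5 → v ≢ 15 →
    Σ (DirectedDesign v) SuperSimple
theorem3p4 v (inj₁ v%10≡1) _ _ = toDirectedDesign (subst DD (sym (v≡ v%10≡1)) (dd-10n+1 (v / 10)))
theorem3p4 v (inj₂ v%10≡5) v≢5 v≢15 = toDirectedDesign (subst DD (sym (v≡ v%10≡5)) (dd-10n+5 (v / 10) (2≤v/10 (v / 10) refl)))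
  where
  2≤v/10 : ∀ q → v / 10 ≡ q → 2 ≤ q
  2≤v/10 0 eq = contradiction (trans (v≡ v%10≡5) (cong (λ q → q * 10 + 5) eq)) v≢5
  2≤v/10 1 eq = contradiction (trans (v≡ v%10≡5) (cong (λ q → q * 10 + 5) eq)) v≢15
  2≤v/10 (suc (suc _)) _ = s≤s (s≤s z≤n)
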